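{- Consider the following three assertions. (ABC) (Masser–Oesterlé $abc$ Conjecture) For every $\epsilon>0$ there is a constant $\kappa_\epsilon>0$ such that for all coprime positive integers $a,b,c$ with $a+b=c$ we have $c<\kappa_\epsilon\cdot\mathrm{rad}(abc)^{1+\epsilon}$. (SDC) (Small Derivatives Conjecture) There is an absolute constant $0<\eta<1$ such that for all but finitely many triples of coprime positive integers $(a,b,c)$ satisfying $a+b=c$ and not of the form $(1,N,q)$ with $q$ prime (up to order), there is $\psi\in\mathscr{T}(a,b)$ such that $a,b$ are $\psi$-independent and $\|\psi\|<c^\eta$. (O) (Oesterlé's $abc$ Conjecture) There is an absolute constant $M$ such that for all coprime positive integers $a,b,c$ with $a+b=c$ we have $c<\mathrm{rad}(abc)^M$. Then (ABC) implies (SDC), and (SDC) implies (O).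
   Context: For a prime $p$, $v_p$ is the $p$-adic valuation. For a non-zero integer $n$, $\mathrm{supp}(n)$ is the set of primes dividing $n$; for a positive integer $n$, $\mathrm{rad}(n)$ is the product of the distinct primes dividing $n$. Let $\Omega$ be the free $\mathbb{Z}$-module on symbols $\xi_p$, one for each prime $p$. Define $\mathrm{d}:\mathbb{Z}\to\Omega$ by $\mathrm{d}0=0$ and $\mathrm{d}n=\sum_{p\mid n}\frac{n\,v_p(n)}{p}\,\xi_p$ for $n\ne 0$ (the coefficients are integers). For a $\mathbb{Z}$-linear map $\psi:\Omega\to\mathbb{Z}$ put $\|\psi\|=\sup_p|\psi(\xi_p)|$. Let $\mathscr{T}$ be the $\mathbb{Z}$-module of all $\mathbb{Z}$-linear $\psi:\Omega\to\mathbb{Z}$ with $\|\psi\|<\infty$. For $\psi\in\mathscr{T}$ let $\mathrm{d}^\psi=\psi\circ\mathrm{d}:\mathbb{Z}\to\mathbb{Z}$ and $\mathrm{supp}(\psi)=\{p:\psi(\xi_p)\neq0\}$. For positive integers $a,b$, $$\mathscr{T}(a,b)=\{\psi\in\mathscr{T}:\ \mathrm{supp}(\psi)\subseteq\mathrm{supp}(ab(a+b))\ \text{and}\ \mathrm{d}^\psi(a+b)=\mathrm{d}^\psi a+\mathrm{d}^\psi b\}.$$ Integers $a,b$ are $\psi$-independent if $W^\psi(a,b):=a\,\mathrm{d}^\psi b-b\,\mathrm{d}^\psi a\neq 0$. A triple is "of the form $(1,N,q)$ up to order" if some permutation of it equals $(1,N,q)$ with $N$ a positive integer and $q$ prime.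 -}

module Defs where

open import Algebra.Bundles using (Ring)
open import Algebra.Module.Bundles using (LeftModule)
import Algebra.Module.Construct.TensorUnit as TensorUnit
open import Algebra.Module.Morphism.Structures using (module LeftModuleMorphisms)
import Algebra.Properties.Semiring.Exp as Exp
open import Data.Bool.Base using (if_then_else_)
open import Data.Integer.Base as ℤ using (ℤ; +_; _⊖_; ∣_∣; 0ℤ; 1ℤ; _/ℕ_)
import Data.Integer.Properties as ℤ
open import Data.List.Base using (List; []; _∷_; filter; upTo)
open import Data.List.Membership.Propositional using (_∉_)
open import Data.List.Relation.Binary.Permutation.Propositional using (_↭_)
import Data.List.Relation.Unary.All as All
open import Data.List.Relation.Unary.All.Properties using (all-filter)
open import Data.Nat.Base as ℕ using (ℕ; zero; suc; NonZero)
open import Data.Nat.Divisibility using (_∣_; _∣?_; ∣-trans; m∣m*n; ∣⇒≤)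
import Data.Nat.DivMod as ℕ
open import Data.Nat.GCD using (gcd)
open import Data.Nat.ListAction using (product)
open import Data.Nat.Primality
  using (Prime; prime?; prime[2]; prime⇒nonZero; productOfPrimes≢0)
import Data.Nat.Properties as ℕ
open import Data.Product.Base using (∃; ∃-syntax; Σ-syntax; ∃₂; _×_; _,_; proj₁)
open import Data.Rational.Base as ℚ using (ℚ; _/_; 0ℚ; 1ℚ)
import Data.Rational.Properties as ℚ
open import Data.Rational.Unnormalised.Base as ℚᵘ using (mkℚᵘ)
import Data.Rational.Unnormalised.Properties as ℚᵘ
open import Data.Sum.Base using (inj₁; inj₂)
open import Function.Base using (_∘_)
open import Level using (0ℓ)
open import Relation.Binary.PropositionalEquality
open import Relation.Nullary.Decidable using (yes; no; does; dec-false; _×-dec_)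
open import Relation.Nullary.Negation using (¬_; contradiction)
open import Relation.Unary using (Pred; Decidable; _⊆_)

open Exp (Ring.semiring ℚ.+-*-ring) using () renaming
  (_^_ to _^ℚ_; ^-homo-* to ^ℚ-homo-*; ^-assocʳ to ^ℚ-assocʳ)

-- A real number is a Dedekind cut, given by its lower part: a nonempty,
-- bounded above, downward closed set of rationals without greatest element.

record ℝ : Set₁ where
  field
    lower       : Pred ℚ 0ℓ
    inhabited   : ∃ lower
    bounded     : ∃[ u ] ∀ {q} → lower q → q ℚ.≤ u
    down-closed : ∀ {p q} → p ℚ.< q → lower q → lower p
    open-above  : ∀ {p} → lower p → ∃[ q ] p ℚ.< q × lower q

open ℝ

infix 4 _<ᴿ_
_<ᴿ_ : ℝ → ℝ → Set
x <ᴿ y = ∃[ q ] (∀ {p} → lower x p → p ℚ.≤ q) × lower y q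

sup : (S : Pred ℚ 0ℓ) → ∃ S → ∃[ u ] (∀ {s} → S s → s ℚ.≤ u) → ℝ
sup S (s₀ , s₀∈S) (u , S≤u) = record
  { lower       = λ q → ∃[ s ] S s × q ℚ.< s
  ; inhabited   = s₀ ℚ.- 1ℚ , s₀ , s₀∈S ,
      subst (s₀ ℚ.- 1ℚ ℚ.<_) (ℚ.+-identityʳ s₀)
        (ℚ.+-monoʳ-< s₀ {ℚ.- 1ℚ} {0ℚ} (ℚ.negative⁻¹ (ℚ.- 1ℚ)))
  ; bounded     = u , λ (_ , s∈S , q<s) → ℚ.≤-trans (ℚ.<⇒≤ q<s) (S≤u s∈S)
  ; down-closed = λ p<q (s , s∈S , q<s) → s , s∈S , ℚ.<-trans p<q q<s
  ; open-above  = λ (s , s∈S , p<s) →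
      let q , p<q , q<s = ℚ.<-dense p<s in q , p<q , s , s∈S , q<s
  }

fromℚ : ℚ → ℝ
fromℚ q = sup (_≡ q) (q , refl) (q , ℚ.≤-reflexive)

ℕ→ℚ : ℕ → ℚ
ℕ→ℚ n = + n / 1

fromℕ : ℕ → ℝ
fromℕ = fromℚ ∘ ℕ→ℚ

0ᴿ 1ᴿ : ℝ
0ᴿ = fromℕ 0
1ᴿ = fromℕ 1

infixl 6 _+ᴿ_
_+ᴿ_ : ℝ → ℝ → ℝ
x +ᴿ y = sup
  (λ s → ∃₂ λ p q → lower x p × lower y q × s ≡ p ℚ.+ q)
  (let p , p∈x = inhabited x ; q , q∈y = inhabited y in
     p ℚ.+ q , p , q , p∈x , q∈y , refl)
  (let u , x≤u = bounded x ; v , y≤v = bounded y in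
     u ℚ.+ v , λ { (_ , _ , p∈x , q∈y , refl) → ℚ.+-mono-≤ (x≤u p∈x) (y≤v q∈y) })

0≤⊔0 : ∀ p → 0ℚ ℚ.≤ p ℚ.⊔ 0ℚ
0≤⊔0 p = ℚ.p≤q⊔p p 0ℚ

-- The product of nonnegative reals; a negative factor is replaced by 0.

infixl 7 _*ᴿ_
_*ᴿ_ : ℝ → ℝ → ℝ
x *ᴿ y = sup
  (λ s → ∃₂ λ p q → lower x p × lower y q × s ≡ (p ℚ.⊔ 0ℚ) ℚ.* (q ℚ.⊔ 0ℚ))
  (let p , p∈x = inhabited x ; q , q∈y = inhabited y in
     _ , p , q , p∈x , q∈y , refl)
  (let u , x≤u = bounded x ; v , y≤v = bounded y in
     (u ℚ.⊔ 0ℚ) ℚ.* (v ℚ.⊔ 0ℚ) , λ { (p , q , p∈x , q∈y , refl) →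
       ℚ.≤-trans
         (ℚ.*-monoˡ-≤-nonNeg (p ℚ.⊔ 0ℚ) {{ℚ.nonNegative (0≤⊔0 p)}}
           (ℚ.⊔-monoˡ-≤ 0ℚ (y≤v q∈y)))
         (ℚ.*-monoʳ-≤-nonNeg (v ℚ.⊔ 0ℚ) {{ℚ.nonNegative (0≤⊔0 v)}}
           (ℚ.⊔-monoˡ-≤ 0ℚ (x≤u p∈x))) })

-- Powers n ^ α with n a positive integer and α real: n ^ α is the supremum of
-- the rationals s ≥ 0 with s ≤ n ^ t for some rational t < α.  Writing
-- t = (m - k) / b, the inequality s ≤ n ^ t reads s ^ b * n ^ k ≤ n ^ m.

PowerSet : ℕ → ℝ → Pred ℚ 0ℓ
PowerSet n α s =
  0ℚ ℚ.≤ s ×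
  (∃[ m ] ∃[ k ] ∃[ b ] Σ[ b≢0 ∈ NonZero b ]
     lower α (_/_ (m ⊖ k) b {{b≢0}}) × s ^ℚ b ℚ.* ℕ→ℚ n ^ℚ k ℚ.≤ ℕ→ℚ n ^ℚ m)

^ℚ-pos : ∀ {x} → ℚ.Positive x → ∀ n → ℚ.Positive (x ^ℚ n)
^ℚ-pos     x>0 zero    = _
^ℚ-pos {x} x>0 (suc n) = ℚ.pos*pos⇒pos x {{x>0}} (x ^ℚ n) {{^ℚ-pos x>0 n}}

^ℚ-mono-< : ∀ {x y} → ℚ.Positive x → x ℚ.< y → ∀ b .{{_ : NonZero b}} → x ^ℚ b ℚ.< y ^ℚ b
^ℚ-mono-< {x} {y} x>0 x<y 1 = subst₂ ℚ._<_ (sym (ℚ.*-identityʳ x)) (sym (ℚ.*-identityʳ y)) x<y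
^ℚ-mono-< {x} {y} x>0 x<y (suc (suc b)) = ℚ.<-trans
  (ℚ.*-monoʳ-<-pos x {{x>0}} (^ℚ-mono-< {x} {y} x>0 x<y (suc b)))
  (ℚ.*-monoˡ-<-pos (y ^ℚ suc b) {{^ℚ-pos {y} y>0 (suc b)}} x<y)
  where y>0 = ℚ.positive (ℚ.<-trans (ℚ.positive⁻¹ x {{x>0}}) x<y)

^ℚ-monoʳ-≤ : ∀ {x} → ℚ.Positive x → 1ℚ ℚ.≤ x → ∀ {m n} → m ℕ.≤ n → x ^ℚ m ℚ.≤ x ^ℚ n
^ℚ-monoʳ-≤ {x} x>0 1≤x {n = zero}  ℕ.z≤n = ℚ.≤-refl
^ℚ-monoʳ-≤ {x} x>0 1≤x {n = suc n} ℕ.z≤n = ℚ.≤-trans (^ℚ-monoʳ-≤ x>0 1≤x {n = n} ℕ.z≤n)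
  (subst (ℚ._≤ x ^ℚ suc n) (ℚ.*-identityˡ (x ^ℚ n))
    (ℚ.*-monoʳ-≤-nonNeg (x ^ℚ n) {{ℚ.pos⇒nonNeg (x ^ℚ n) {{^ℚ-pos x>0 n}}}} 1≤x))
^ℚ-monoʳ-≤ {x} x>0 1≤x (ℕ.s≤s m≤n) =
  ℚ.*-monoˡ-≤-nonNeg x {{ℚ.pos⇒nonNeg x {{x>0}}}} (^ℚ-monoʳ-≤ x>0 1≤x m≤n)

i/b-≃ : ∀ i b → ℚ.toℚᵘ (i / suc b) ℚᵘ.≃ mkℚᵘ i b
i/b-≃ i b = ℚ.toℚᵘ-fromℚᵘ (mkℚᵘ i b)

q≤∣↥q∣ : ∀ q → q ℚ.≤ ℕ→ℚ ∣ ℚ.↥ q ∣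
q≤∣↥q∣ q@record{} = ℚ.toℚᵘ-cancel-≤
  (ℚᵘ.≤-respʳ-≃ (ℚᵘ.≃-sym (i/b-≃ (+ ∣ ℚ.↥ q ∣) 0)) (ℚᵘ.*≤* (begin
    ℚ.↥ q ℤ.* 1ℤ               ≡⟨ ℤ.*-identityʳ (ℚ.↥ q) ⟩
    ℚ.↥ q                      ≤⟨ i≤∣i∣ (ℚ.↥ q) ⟩
    + ∣ ℚ.↥ q ∣                ≤⟨ ℤ.+≤+ (ℕ.m≤m*n ∣ ℚ.↥ q ∣ (ℚ.↧ₙ q)) ⟩
    + (∣ ℚ.↥ q ∣ ℕ.* ℚ.↧ₙ q)   ≡⟨ ℤ.pos-* ∣ ℚ.↥ q ∣ (ℚ.↧ₙ q) ⟩
    + ∣ ℚ.↥ q ∣ ℤ.* ℚ.↧ q      ∎)))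
  where
  open ℤ.≤-Reasoning
  i≤∣i∣ : ∀ i → i ℤ.≤ + ∣ i ∣
  i≤∣i∣ (+ n)      = ℤ.≤-refl
  i≤∣i∣ ℤ.-[1+ n ] = ℤ.-≤+

t≤K⇒m≤Kb+k : ∀ m k b .{{_ : NonZero b}} K → (m ⊖ k) / b ℚ.≤ ℕ→ℚ K → m ℕ.≤ K ℕ.* b ℕ.+ k
t≤K⇒m≤Kb+k m k (suc b) K t≤K = ℤ.drop‿+≤+ (begin
  + m                            ≡⟨ cong +_ (ℕ.+-comm 0 m) ⟩
  + (m ℕ.+ 0)                    ≡⟨ ℤ.⊖-≥ {m ℕ.+ 0} ℕ.z≤n ⟨
  m ℕ.+ 0 ⊖ 0                    ≡⟨ ℤ.+-cancelˡ-⊖ k (m ℕ.+ 0) 0 ⟨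
  k ℕ.+ (m ℕ.+ 0) ⊖ (k ℕ.+ 0)    ≡⟨ cong₂ _⊖_ (trans (cong (k ℕ.+_) (ℕ.+-identityʳ m)) (ℕ.+-comm k m)) (ℕ.+-identityʳ k) ⟩
  m ℕ.+ k ⊖ k                    ≡⟨ ℤ.distribˡ-⊖-+-pos k m k ⟨
  (m ⊖ k) ℤ.+ + k                ≡⟨ cong (ℤ._+ + k) (ℤ.*-identityʳ (m ⊖ k)) ⟨
  (m ⊖ k) ℤ.* 1ℤ ℤ.+ + k         ≤⟨ ℤ.+-monoˡ-≤ (+ k) (ℚᵘ.drop-*≤* t≤Kᵘ) ⟩
  + K ℤ.* + suc b ℤ.+ + k        ≡⟨ cong (ℤ._+ + k) (ℤ.pos-* K (suc b)) ⟨
  + (K ℕ.* suc b ℕ.+ k)          ∎)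
  where
  open ℤ.≤-Reasoning
  t≤Kᵘ : mkℚᵘ (m ⊖ k) b ℚᵘ.≤ mkℚᵘ (+ K) 0
  t≤Kᵘ = ℚᵘ.≤-respˡ-≃ (i/b-≃ (m ⊖ k) b)
           (ℚᵘ.≤-respʳ-≃ (i/b-≃ (+ K) 0) (ℚ.toℚᵘ-mono-≤ t≤K))

1≤ℕ→ℚ : ∀ n .{{_ : NonZero n}} → 1ℚ ℚ.≤ ℕ→ℚ n
1≤ℕ→ℚ n@(suc _) = ℚ.toℚᵘ-cancel-≤ (ℚᵘ.≤-respʳ-≃ (ℚᵘ.≃-sym (i/b-≃ (+ n) 0))
  (ℚᵘ.*≤* (ℤ.+≤+ (ℕ.s≤s ℕ.z≤n))))

PowerSet-inhabited : ∀ n .{{_ : NonZero n}} α → ∃ (PowerSet n α)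
PowerSet-inhabited n α = let t , t∈α = inhabited α in
  0ℚ , ℚ.≤-refl , witness t t∈α
  where
  n>0 = ℚ.positive (ℚ.<-≤-trans (ℚ.positive⁻¹ 1ℚ) (1≤ℕ→ℚ n))

  i≡m⊖k : ∀ i → ∃₂ λ m k → i ≡ m ⊖ k
  i≡m⊖k (+ m)      = m , 0 , refl
  i≡m⊖k ℤ.-[1+ k ] = 0 , suc k , refl

  below : ∀ b .{{_ : NonZero b}} k m → 0ℚ ^ℚ b ℚ.* ℕ→ℚ n ^ℚ k ℚ.≤ ℕ→ℚ n ^ℚ m
  below (suc b) k m = subst (ℚ._≤ ℕ→ℚ n ^ℚ m)
    (sym (trans (cong (ℚ._* ℕ→ℚ n ^ℚ k) (ℚ.*-zeroˡ (0ℚ ^ℚ b))) (ℚ.*-zeroˡ (ℕ→ℚ n ^ℚ k))))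
    (ℚ.<⇒≤ (ℚ.positive⁻¹ (ℕ→ℚ n ^ℚ m) {{^ℚ-pos n>0 m}}))

  witness : ∀ t → lower α t → _
  witness t t∈α with i≡m⊖k (ℚ.↥ t)
  ... | m , k , eq = m , k , ℚ.↧ₙ t , _ ,
    subst (lower α) (trans (sym (ℚ.↥p/↧p≡p t)) (cong (_/ ℚ.↧ₙ t) eq)) t∈α ,
    below (ℚ.↧ₙ t) k m

PowerSet-bounded : ∀ n .{{_ : NonZero n}} α → ∃[ u ] (∀ {s} → PowerSet n α s → s ℚ.≤ u)
PowerSet-bounded n α = N ^ℚ K , bound
  where
  N = ℕ→ℚ n
  u = proj₁ (bounded α)
  K = ∣ ℚ.↥ u ∣
  N>0 = ℚ.positive (ℚ.<-≤-trans (ℚ.positive⁻¹ 1ℚ) (1≤ℕ→ℚ n))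

  bound : ∀ {s} → PowerSet n α s → s ℚ.≤ N ^ℚ K
  bound {s} (_ , m , k , b , b≢0 , t∈α , le) = ℚ.≮⇒≥ λ N^K<s → ℚ.<-irrefl refl (ℚ.<-≤-trans
    (^ℚ-mono-< (^ℚ-pos N>0 K) N^K<s b {{b≢0}})
    (ℚ.*-cancelʳ-≤-pos (N ^ℚ k) {{^ℚ-pos N>0 k}} (begin
      s ^ℚ b ℚ.* N ^ℚ k           ≤⟨ le ⟩
      N ^ℚ m                      ≤⟨ ^ℚ-monoʳ-≤ N>0 (1≤ℕ→ℚ n) m≤Kb+k ⟩
      N ^ℚ (K ℕ.* b ℕ.+ k)        ≡⟨ ^ℚ-homo-* N (K ℕ.* b) k ⟩
      N ^ℚ (K ℕ.* b) ℚ.* N ^ℚ k   ≡⟨ cong (ℚ._* N ^ℚ k) (^ℚ-assocʳ N K b) ⟨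
      (N ^ℚ K) ^ℚ b ℚ.* N ^ℚ k    ∎)))
    where
    open ℚ.≤-Reasoning
    instance _ = b≢0
    m≤Kb+k = t≤K⇒m≤Kb+k m k b K (ℚ.≤-trans (let _ , α≤u = bounded α in α≤u t∈α) (q≤∣↥q∣ u))

infixr 8 _^ᴿ_
_^ᴿ_ : (n : ℕ) .{{_ : NonZero n}} → ℝ → ℝ
n ^ᴿ α = sup (PowerSet n α) (PowerSet-inhabited n α) (PowerSet-bounded n α)

record ℙ : Set where
  constructor mkℙ
  field
    value    : ℕ
    .isPrime : Prime value

open ℙ

supp : ℕ → Pred ℙ 0ℓ
supp n p = value p ∣ n

primeDivisors : ℕ → List ℕ
primeDivisors n = filter (λ p → prime? p ×-dec (p ∣? n)) (upTo (suc n))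

rad : ℕ → ℕ
rad n = product (primeDivisors n)

rad-nonZero : ∀ n → NonZero (rad n)
rad-nonZero n = productOfPrimes≢0
  (All.map proj₁ (all-filter (λ p → prime? p ×-dec (p ∣? n)) (upTo (suc n))))

infixr 8 rad[_]^_
rad[_]^_ : ℕ → ℝ → ℝ
rad[ n ]^ α = _^ᴿ_ (rad n) {{rad-nonZero n}} α

-- The result is 0 if no k with 1 ≤ k ≤ b satisfies P.

largest : {P : Pred ℕ 0ℓ} → Decidable P → ℕ → ℕ
largest P? zero    = 0
largest P? (suc b) = if does (P? (suc b)) then suc b else largest P? b

-- The search may stop at k = n because p ^ k ∣ n with n ≥ 1 and p ≥ 2 forces
-- k < n.  The value at n = 0 is the dummy 0.

valuation : ℕ → ℕ → ℕ
valuation p n = largest (λ k → p ℕ.^ k ∣? n) n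

-- The free ℤ-module on the symbols ξ p, as finitely supported functions.

record Ω : Set where
  field
    coeff         : ℙ → ℤ
    finiteSupport : ∃[ N ] ∀ p → N ℕ.< value p → coeff p ≡ 0ℤ

open Ω

_≈Ω_ : Ω → Ω → Set
x ≈Ω y = ∀ p → coeff x p ≡ coeff y p

Ω-leftModule : LeftModule ℤ.+-*-ring 0ℓ 0ℓ
Ω-leftModule = record
  { Carrierᴹ = Ω
  ; _≈ᴹ_     = _≈Ω_
  ; _+ᴹ_     = λ x y → record
    { coeff         = λ p → coeff x p ℤ.+ coeff y p
    ; finiteSupport =
        let M , x≡0 = finiteSupport x ; N , y≡0 = finiteSupport y in
        M ℕ.⊔ N , λ p lt → cong₂ ℤ._+_
          (x≡0 p (ℕ.m⊔n<o⇒m<o M N lt)) (y≡0 p (ℕ.m⊔n<o⇒n<o M N lt))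
    }
  ; _*ₗ_     = λ i x → record
    { coeff         = λ p → i ℤ.* coeff x p
    ; finiteSupport = let N , x≡0 = finiteSupport x in
        N , λ p lt → trans (cong (i ℤ.*_) (x≡0 p lt)) (ℤ.*-zeroʳ i)
    }
  ; 0ᴹ       = record { coeff = λ _ → 0ℤ ; finiteSupport = 0 , λ _ _ → refl }
  ; -ᴹ_      = λ x → record
    { coeff         = λ p → ℤ.- coeff x p
    ; finiteSupport = let N , x≡0 = finiteSupport x in
        N , λ p lt → cong ℤ.-_ (x≡0 p lt)
    }
  ; isLeftModule = record
    { isLeftSemimodule = record
      { +ᴹ-isCommutativeMonoid = record
        { isMonoid = record
          { isSemigroup = record
            { isMagma = record
              { isEquivalence = record
                { refl  = λ _ → refl
                ; sym   = λ e p → sym (e p)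
                ; trans = λ e f p → trans (e p) (f p)
                }
              ; ∙-cong = λ e f p → cong₂ ℤ._+_ (e p) (f p)
              }
            ; assoc = λ x y z p → ℤ.+-assoc (coeff x p) (coeff y p) (coeff z p)
            }
          ; identity = (λ x p → ℤ.+-identityˡ (coeff x p))
                     , (λ x p → ℤ.+-identityʳ (coeff x p))
          }
        ; comm = λ x y p → ℤ.+-comm (coeff x p) (coeff y p)
        }
      ; isPreleftSemimodule = record
        { *ₗ-cong      = λ i≡j e p → cong₂ ℤ._*_ i≡j (e p)
        ; *ₗ-zeroˡ     = λ x p → ℤ.*-zeroˡ (coeff x p)
        ; *ₗ-distribʳ  = λ x i j p → ℤ.*-distribʳ-+ (coeff x p) i j
        ; *ₗ-identityˡ = λ x p → ℤ.*-identityˡ (coeff x p)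
        ; *ₗ-assoc     = λ i j x p → ℤ.*-assoc i j (coeff x p)
        ; *ₗ-zeroʳ     = λ i p → ℤ.*-zeroʳ i
        ; *ₗ-distribˡ  = λ i x y p → ℤ.*-distribˡ-+ i (coeff x p) (coeff y p)
        }
      }
    ; -ᴹ‿cong    = λ e p → cong ℤ.-_ (e p)
    ; -ᴹ‿inverse = (λ x p → ℤ.+-inverseˡ (coeff x p))
                 , (λ x p → ℤ.+-inverseʳ (coeff x p))
    }
  }

ξ : ℙ → Ω
ξ p = record
  { coeff         = λ q → if does (value p ℕ.≟ value q) then 1ℤ else 0ℤ
  ; finiteSupport = value p , λ q p<q →
      cong (if_then 1ℤ else 0ℤ) (dec-false (value p ℕ.≟ value q) (ℕ.<⇒≢ p<q))
  }

-- The coefficient n * v_p(n) / p of ξ p in d n, by an exact division.  It is 0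
-- when p does not divide n and when n = 0.

dCoeff : ℤ → ℙ → ℤ
dCoeff n (mkℙ p p-prime) =
  _/ℕ_ (n ℤ.* + valuation p ∣ n ∣) p {{prime⇒nonZero p-prime}}

largest≡0 : ∀ {P : Pred ℕ 0ℓ} (P? : Decidable P) b →
            (∀ k → .{{NonZero k}} → k ℕ.≤ b → ¬ P k) → largest P? b ≡ 0
largest≡0 P? zero    ¬P = refl
largest≡0 P? (suc b) ¬P rewrite dec-false (P? (suc b)) (¬P (suc b) ℕ.≤-refl) =
  largest≡0 P? b λ k k≤b → ¬P k (ℕ.m≤n⇒m≤1+n k≤b)

valuation≡0 : ∀ p n → n ℕ.< p → valuation p n ≡ 0
valuation≡0 p zero      n<p = refl
valuation≡0 p n@(suc _) n<p = largest≡0 (λ k → p ℕ.^ k ∣? n) n λ where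
  (suc k) _ p^k∣n → ℕ.<⇒≱ n<p (∣⇒≤ (∣-trans (m∣m*n (p ℕ.^ k)) p^k∣n))

n*0/p≡0 : ∀ n {v} p .{{_ : NonZero p}} → v ≡ 0 → (n ℤ.* + v) /ℕ p ≡ 0ℤ
n*0/p≡0 n p refl = trans (cong (_/ℕ p) (ℤ.*-zeroʳ n)) (cong +_ (ℕ.0/n≡0 p))

d : ℤ → Ω
d n = record
  { coeff         = dCoeff n
  ; finiteSupport = ∣ n ∣ , λ (mkℙ p p-prime) n<p →
      n*0/p≡0 n p {{prime⇒nonZero p-prime}} (valuation≡0 p ∣ n ∣ n<p)
  }

ℤ-leftModule : LeftModule ℤ.+-*-ring 0ℓ 0ℓ
ℤ-leftModule = TensorUnit.leftModule

open LeftModuleMorphisms (LeftModule.rawLeftModule Ω-leftModule)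
                         (LeftModule.rawLeftModule ℤ-leftModule)
  using (IsLeftModuleHomomorphism)

record 𝒯 : Set where
  field
    ⟦_⟧        : Ω → ℤ
    isLinear   : IsLeftModuleHomomorphism ⟦_⟧
    normFinite : ∃[ B ] ∀ p → ∣ ⟦ ξ p ⟧ ∣ ℕ.≤ B

open 𝒯

‖_‖ : 𝒯 → ℝ
‖ ψ ‖ = sup
  (λ s → ∃[ p ] s ≡ ℕ→ℚ ∣ ⟦ ψ ⟧ (ξ p) ∣)
  (_ , mkℙ 2 prime[2] , refl)
  (let B , ψ≤B = normFinite ψ in
     ℕ→ℚ B , λ { (p , refl) → ℕ→ℚ-mono-≤ (ψ≤B p) })
  where
  ℕ→ℚ-mono-≤ : ∀ {m n} → m ℕ.≤ n → ℕ→ℚ m ℚ.≤ ℕ→ℚ n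
  ℕ→ℚ-mono-≤ {m} {n} m≤n = ℚ.toℚᵘ-cancel-≤
    (ℚᵘ.≤-respˡ-≃ (ℚᵘ.≃-sym (i/b-≃ (+ m) 0))
      (ℚᵘ.≤-respʳ-≃ (ℚᵘ.≃-sym (i/b-≃ (+ n) 0))
        (ℚᵘ.*≤* (ℤ.*-monoʳ-≤-nonNeg 1ℤ (ℤ.+≤+ m≤n)))))

d^ : 𝒯 → ℤ → ℤ
d^ ψ = ⟦ ψ ⟧ ∘ d

supp𝒯 : 𝒯 → Pred ℙ 0ℓ
supp𝒯 ψ p = ⟦ ψ ⟧ (ξ p) ≢ 0ℤ

𝒯[_,_] : ℕ → ℕ → Pred 𝒯 0ℓ
𝒯[ a , b ] ψ =
  supp𝒯 ψ ⊆ supp (a ℕ.* b ℕ.* (a ℕ.+ b)) ×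
  d^ ψ (+ (a ℕ.+ b)) ≡ d^ ψ (+ a) ℤ.+ d^ ψ (+ b)

W : 𝒯 → ℤ → ℤ → ℤ
W ψ a b = a ℤ.* d^ ψ b ℤ.- b ℤ.* d^ ψ a

Independent : 𝒯 → ℤ → ℤ → Set
Independent ψ a b = W ψ a b ≢ 0ℤ

Coprime₃ : ℕ → ℕ → ℕ → Set
Coprime₃ a b c = gcd (gcd a b) c ≡ 1

OfForm1Nq : ℕ → ℕ → ℕ → Set
OfForm1Nq a b c = ∃₂ λ N q → NonZero N × Prime q ×
  (a ∷ b ∷ c ∷ [] ↭ 1 ∷ N ∷ q ∷ [])

ABC : Set₁
ABC = ∀ (ε : ℝ) → 0ᴿ <ᴿ ε → ∃[ κ ] 0ᴿ <ᴿ κ ×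
  (∀ a b c .{{_ : NonZero a}} .{{_ : NonZero b}} .{{_ : NonZero c}} →
     Coprime₃ a b c → a ℕ.+ b ≡ c →
     fromℕ c <ᴿ κ *ᴿ rad[ a ℕ.* b ℕ.* c ]^ (1ᴿ +ᴿ ε))

SDC : Set₁
SDC = ∃[ η ] 0ᴿ <ᴿ η × η <ᴿ 1ᴿ ×
  (Σ[ exceptions ∈ List (ℕ × ℕ × ℕ) ]
    (∀ a b c .{{_ : NonZero a}} .{{_ : NonZero b}} .{{_ : NonZero c}} →
       Coprime₃ a b c → a ℕ.+ b ≡ c → ¬ OfForm1Nq a b c →
       (a , b , c) ∉ exceptions →
       ∃[ ψ ] 𝒯[ a , b ] ψ × Independent ψ (+ a) (+ b) × ‖ ψ ‖ <ᴿ c ^ᴿ η))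

OesterléABC : Set₁
OesterléABC = ∃[ M ]
  (∀ a b c .{{_ : NonZero a}} .{{_ : NonZero b}} .{{_ : NonZero c}} →
     Coprime₃ a b c → a ℕ.+ b ≡ c →
     fromℕ c <ᴿ rad[ a ℕ.* b ℕ.* c ]^ M)

module Submission where

-- ABC ⇒ SDC.  Let p range over the primes dividing abc.  If ψ (ξ p) = y p V / v p, where V is the product
-- of the exponents v p, then d^ψ n = V D n with D n = Σ_{p ∣ n} (n / p) y p for n = a, b, c, so a
-- small integer solution y of D a + D b = D c is wanted.  It is found by the pigeonhole principle: one
-- coordinate p₀ is left free by working modulo n₀ / p₀, the others range over boxes of height at most p,
-- except for one prime p₁ dividing another of the three numbers.  If D a / a = D b / b, then every p divides
-- y p; so y vanishes outside p₀ and p₁, hence D vanishes at the third number, and y = 0.  The boxes must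
-- contain more than n₀ / p₀ points.  If all primes are at most c ^ (3 / 4), full boxes, enlarged by
-- T ≈ c / rad (abc) at p₁, suffice, and ABC bounds T.  If some prime q exceeds c ^ (3 / 4), boxes of height
-- √c at q and p₁ suffice; p₀, p₁ ≠ q in different numbers exist unless the triple is (1, N, q).
-- The divisor bound makes V negligible.
--
-- SDC ⇒ O.  Each of a, b, c divides rad (abc) W^ψ (a, b), which is nonzero, so abc ≤ rad (abc) |W^ψ (a, b)|.
-- Since |W^ψ (a, b)| is at most 2 ab ‖ψ‖ times the number of prime factors of abc, c ^ (1 - η) is bounded by
-- rad (abc) up to a logarithm.

-- The obstacle is dependence: the pigeonhole principle yields a small nonzero solution, but W
-- vanishes when D is proportional to (a, b, c). In such a solution y p = p x p for integers x p
-- whose sums over the primes of a, of b and of c all agree. Sides of at most p rule this out, but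
-- full boxes hold only rad (abc) points in all, possibly fewer than c. Two coordinates may
-- nevertheless stay unrestricted if their primes lie in different numbers: the third number then
-- has x-sum 0, so both remaining sums are 0 as well. One of the two is solved for, the other
-- receives the missing points.
--
-- The threshold is 3 / 4 = 1 / 4 + 1 / 2: a prime above c ^ (3 / 4) has a cofactor of at most c ^
-- (1 / 4), and a box of side about c ^ (1 / 2) at that prime then moves the free coordinate by at
-- most about c ^ (3 / 4). All other factors of the norm are at most a constant times a small power
-- of c, so η can be taken slightly above 3 / 4. No root or logarithm is estimated: every inequality
-- is raised to a large integer power and proved in ℕ.

open import Defs
open import Algebra.Bundles using (CommutativeMonoid; CommutativeRing)
open import Algebra.Module.Bundles using (LeftModule)
open import Algebra.Module.Morphism.Structures using (module LeftModuleMorphisms)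
import Algebra.Properties.CommutativeMonoid.Sum as MonoidSum
import Algebra.Properties.CommutativeSemiring.Exp as Exp
import Algebra.Properties.Semiring.Sum as SemiringSum
open import Data.Bool.Base using (if_then_else_; true; false)
open import Data.Fin.Base as Fin using (Fin; zero; suc; toℕ; fromℕ<; remQuot; combine; punchIn)
open import Data.Fin.Patterns
import Data.Fin.Properties as Fin
open import Data.Integer.Base as ℤ using (ℤ; +_; _⊖_; ∣_∣; 0ℤ; 1ℤ; _/ℕ_; _%ℕ_)
import Data.Integer.Coprimality as ℤ
open import Data.Integer.Divisibility.Signed as ℤ∣ using () renaming (_∣_ to _∣ℤ_)
import Data.Integer.DivMod as ℤ
import Data.Integer.Properties as ℤ
import Data.Integer.Tactic.RingSolver as ℤ-Ring
open import Data.List.Base using (List; []; _∷_; upTo; length; lookup; cartesianProduct)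
open import Data.List.Membership.Propositional using (_∈_; _∉_)
open import Data.List.Membership.Propositional.Properties
  using (∈-filter⁺; ∈-filter⁻; ∈-upTo⁺; ∈-lookup; ∈-cartesianProduct⁺)
open import Data.List.Relation.Binary.Permutation.Propositional
  using (_↭_; ↭-sym; ↭-refl; ↭-trans; ↭-prep; ↭-swap)
open import Data.List.Relation.Binary.Permutation.Propositional.Properties using (∈-resp-↭)
open import Data.List.Relation.Unary.All as All using ([]; _∷_)
open import Data.List.Relation.Unary.AllPairs.Core using ([]; _∷_)
open import Data.List.Relation.Unary.Any as Any using (here; there)
import Data.List.Relation.Unary.Any.Properties as Any
open import Data.List.Relation.Unary.Unique.Propositional using (Unique)
import Data.List.Relation.Unary.Unique.Propositional.Properties as Unique
open import Data.Nat.Base as ℕ using (ℕ; zero; suc; NonZero; _*_; _^_; _≤_; _<_)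
open import Data.Nat.Coprimality using (Coprime; coprime-divisor)
open import Data.Nat.Divisibility
  using (_∣_; _∣?_; divides; quotient; quotient-∣; ∣-refl; ∣-reflexive; ∣-trans; ∣⇒≤; 1∣_; 0∣⇒≡0; ∣1⇒≡1;
         m∣m*n; n∣m*n; ∣m⇒∣m*n; *-monoʳ-∣; m∣n⇒n≡quotient*m; ∣m∣n⇒∣m+n; ∣m+n∣m⇒∣n)
import Data.Nat.DivMod as ℕ
open import Data.Nat.GCD using (gcd-greatest)
open import Data.Nat.ListAction using (product)
open import Data.Nat.Primality
  using (Prime; prime?; prime⇒nonZero; prime⇒nonTrivial; prime⇒irreducible; euclidsLemma)
open import Data.Nat.Primality.Factorisation using (PrimeFactorisation; factorise)
import Data.Nat.Properties as ℕ
import Data.Nat.Tactic.RingSolver as ℕ-Ring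
open import Data.Product.Base using (∃-syntax; ∃₂; _×_; _,_; proj₁; proj₂; uncurry)
open import Data.Rational.Base as ℚ using (_/_; 0ℚ; 1ℚ)
import Data.Rational.Properties as ℚ
open import Data.Rational.Unnormalised.Base as ℚᵘ using (mkℚᵘ)
import Data.Rational.Unnormalised.Properties as ℚᵘ
open import Data.Sum.Base using (_⊎_; inj₁; inj₂; [_,_]′)
open import Data.Vec.Functional using (removeAt)
open import Function.Base using (_∘_; id; it; _⟨_⟩_)
open import Level using (0ℓ)
open import Relation.Binary.PropositionalEquality
open import Relation.Nullary.Decidable
  using (Dec; yes; no; does; _×-dec_; dec-true; dec-false; decidable-stable; recompute)
open import Relation.Nullary.Negation using (¬_; contradiction)
open import Relation.Unary using (Pred; Decidable)

open Exp (CommutativeRing.commutativeSemiring ℚ.+-*-commutativeRing) using () renaming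
  (_^_ to _^ℚ_; ^-homo-* to ^ℚ-homo-*; ^-assocʳ to ^ℚ-assocʳ; ^-distrib-* to ^ℚ-distrib-*)
open LeftModuleMorphisms (LeftModule.rawLeftModule Ω-leftModule) (LeftModule.rawLeftModule ℤ-leftModule)
  using (IsLeftModuleHomomorphism; module IsLeftModuleHomomorphism)

open ℝ
open ℙ
open Ω
open 𝒯

private
  variable
    n : ℕ

-- Between real and integer inequalities

/-mono-≤ : ∀ i j b d → i ℤ.* + suc d ℤ.≤ j ℤ.* + suc b → i / suc b ℚ.≤ j / suc d
/-mono-≤ i j b d le = ℚ.toℚᵘ-cancel-≤
  (ℚᵘ.≤-respˡ-≃ (ℚᵘ.≃-sym (i/b-≃ i b)) (ℚᵘ.≤-respʳ-≃ (ℚᵘ.≃-sym (i/b-≃ j d)) (ℚᵘ.*≤* le)))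

/-cancel-≤ : ∀ i j b d → i / suc b ℚ.≤ j / suc d → i ℤ.* + suc d ℤ.≤ j ℤ.* + suc b
/-cancel-≤ i j b d le = ℚᵘ.drop-*≤*
  (ℚᵘ.≤-respˡ-≃ (i/b-≃ i b) (ℚᵘ.≤-respʳ-≃ (i/b-≃ j d) (ℚ.toℚᵘ-mono-≤ le)))

/-mono-< : ∀ i j b d → i ℤ.* + suc d ℤ.< j ℤ.* + suc b → i / suc b ℚ.< j / suc d
/-mono-< i j b d lt = ℚ.toℚᵘ-cancel-<
  (ℚᵘ.<-respˡ-≃ (ℚᵘ.≃-sym (i/b-≃ i b)) (ℚᵘ.<-respʳ-≃ (ℚᵘ.≃-sym (i/b-≃ j d)) (ℚᵘ.*<* lt)))

ℕ→ℚ-mono-≤ : ∀ {m n} → m ≤ n → ℕ→ℚ m ℚ.≤ ℕ→ℚ n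
ℕ→ℚ-mono-≤ {m} {n} m≤n = /-mono-≤ (+ m) (+ n) 0 0 (ℤ.*-monoʳ-≤-nonNeg 1ℤ (ℤ.+≤+ m≤n))

ℕ→ℚ-mono-< : ∀ {m n} → m < n → ℕ→ℚ m ℚ.< ℕ→ℚ n
ℕ→ℚ-mono-< {m} {n} m<n = /-mono-< (+ m) (+ n) 0 0 (ℤ.*-monoʳ-<-pos 1ℤ (ℤ.+<+ m<n))

ℕ→ℚ-cancel-≤ : ∀ {m n} → ℕ→ℚ m ℚ.≤ ℕ→ℚ n → m ≤ n
ℕ→ℚ-cancel-≤ {m} {n} le = ℤ.drop‿+≤+ (ℤ.*-cancelʳ-≤-pos (+ m) (+ n) 1ℤ (/-cancel-≤ (+ m) (+ n) 0 0 le))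

0≤ℕ→ℚ : ∀ n → 0ℚ ℚ.≤ ℕ→ℚ n
0≤ℕ→ℚ n = ℕ→ℚ-mono-≤ {0} {n} ℕ.z≤n

ℕ→ℚ-homo-* : ∀ m n → ℕ→ℚ (m * n) ≡ ℕ→ℚ m ℚ.* ℕ→ℚ n
ℕ→ℚ-homo-* m n = ℚ.toℚᵘ-injective (begin
  ℚ.toℚᵘ (ℕ→ℚ (m * n))                     ≈⟨ i/b-≃ (+ (m * n)) 0 ⟩
  mkℚᵘ (+ (m * n)) 0                        ≡⟨ cong (λ i → mkℚᵘ i 0) (ℤ.pos-* m n) ⟩
  mkℚᵘ (+ m) 0 ℚᵘ.* mkℚᵘ (+ n) 0            ≈⟨ ℚᵘ.*-cong (i/b-≃ (+ m) 0) (i/b-≃ (+ n) 0) ⟨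
  ℚ.toℚᵘ (ℕ→ℚ m) ℚᵘ.* ℚ.toℚᵘ (ℕ→ℚ n)       ≈⟨ ℚ.toℚᵘ-homo-* (ℕ→ℚ m) (ℕ→ℚ n) ⟨
  ℚ.toℚᵘ (ℕ→ℚ m ℚ.* ℕ→ℚ n)                 ∎)
  where open ℚᵘ.≃-Reasoning

ℕ→ℚ-homo-^ : ∀ m n → ℕ→ℚ (m ^ n) ≡ ℕ→ℚ m ^ℚ n
ℕ→ℚ-homo-^ m zero    = refl
ℕ→ℚ-homo-^ m (suc n) = trans (ℕ→ℚ-homo-* m (m ^ n)) (cong (ℕ→ℚ m ℚ.*_) (ℕ→ℚ-homo-^ m n))

*-mono-≤-nonNeg : ∀ {p q r s} → 0ℚ ℚ.≤ q → 0ℚ ℚ.≤ r → p ℚ.≤ q → r ℚ.≤ s → p ℚ.* r ℚ.≤ q ℚ.* s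
*-mono-≤-nonNeg {p} {q} {r} {s} 0≤q 0≤r p≤q r≤s = ℚ.≤-trans
  (ℚ.*-monoʳ-≤-nonNeg r {{ℚ.nonNegative 0≤r}} p≤q)
  (ℚ.*-monoˡ-≤-nonNeg q {{ℚ.nonNegative 0≤q}} r≤s)

^ℚ-nonNeg : ∀ {x} → 0ℚ ℚ.≤ x → ∀ n → 0ℚ ℚ.≤ x ^ℚ n
^ℚ-nonNeg     0≤x zero    = ℚ.nonNegative⁻¹ 1ℚ
^ℚ-nonNeg {x} 0≤x (suc n) = subst (ℚ._≤ x ℚ.* x ^ℚ n) (ℚ.*-zeroʳ x)
  (ℚ.*-monoˡ-≤-nonNeg x {{ℚ.nonNegative 0≤x}} (^ℚ-nonNeg 0≤x n))

^ℚ-mono-≤ : ∀ {x y} → 0ℚ ℚ.≤ x → x ℚ.≤ y → ∀ n → x ^ℚ n ℚ.≤ y ^ℚ n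
^ℚ-mono-≤ 0≤x x≤y zero    = ℚ.≤-refl
^ℚ-mono-≤ 0≤x x≤y (suc n) =
  *-mono-≤-nonNeg (ℚ.≤-trans 0≤x x≤y) (^ℚ-nonNeg 0≤x n) x≤y (^ℚ-mono-≤ 0≤x x≤y n)

^ℚ-cancel-≤ : ∀ {x y} → 0ℚ ℚ.< y → ∀ b .{{_ : NonZero b}} → x ^ℚ b ℚ.≤ y ^ℚ b → x ℚ.≤ y
^ℚ-cancel-≤ 0<y b le = ℚ.≮⇒≥ λ y<x →
  ℚ.<-irrefl refl (ℚ.<-≤-trans (^ℚ-mono-< (ℚ.positive 0<y) y<x b) le)

⊖-/-≤⇒ : ∀ m k b u v .{{_ : NonZero b}} .{{_ : NonZero v}} →
         (m ⊖ k) / b ℚ.≤ + u / v → m * v ≤ u * b ℕ.+ k * v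
⊖-/-≤⇒ m k b@(suc b-1) u v@(suc v-1) le = ℤ.drop‿+≤+ (begin
  + (m * v)                                  ≡⟨ ℤ.pos-* m v ⟩
  + m ℤ.* + v                                ≡⟨ cong (ℤ._* + v) (m≡m⊖k+k m k) ⟩
  ((m ⊖ k) ℤ.+ + k) ℤ.* + v                  ≡⟨ ℤ.*-distribʳ-+ (+ v) (m ⊖ k) (+ k) ⟩
  (m ⊖ k) ℤ.* + v ℤ.+ + k ℤ.* + v
    ≤⟨ ℤ.+-monoˡ-≤ (+ k ℤ.* + v) (/-cancel-≤ (m ⊖ k) (+ u) b-1 v-1 le) ⟩
  + u ℤ.* + b ℤ.+ + k ℤ.* + v                ≡⟨ cong₂ ℤ._+_ (ℤ.pos-* u b) (ℤ.pos-* k v) ⟨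
  + (u * b) ℤ.+ + (k * v)                    ∎)
  where
  open ℤ.≤-Reasoning
  m≡m⊖k+k : ∀ m k → + m ≡ (m ⊖ k) ℤ.+ + k
  m≡m⊖k+k m k = sym (begin-equality
    (m ⊖ k) ℤ.+ + k   ≡⟨ ℤ.distribˡ-⊖-+-pos k m k ⟩
    m ℕ.+ k ⊖ k       ≡⟨ ℤ.⊖-≥ (ℕ.m≤n+m k m) ⟩
    + (m ℕ.+ k ℕ.∸ k) ≡⟨ cong +_ (ℕ.m+n∸n≡m m k) ⟩
    + m               ∎)

-- The cut `fromℕ n` contains only rationals strictly below `n`; density turns a bound for all of
-- them into `n ≤ q`.
fromℕ-<⇒ : ∀ n y → fromℕ n <ᴿ y → ∃[ q ] lower y q × ℕ→ℚ n ℚ.≤ q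
fromℕ-<⇒ n y (q , n≤q , q∈y) = q , q∈y , ℚ.≮⇒≥ λ q<n →
  let r , q<r , r<n = ℚ.<-dense q<n in
  ℚ.<-irrefl refl (ℚ.<-≤-trans q<r (n≤q (_ , refl , r<n)))

-- Real exponents are eliminated here. Membership gives s ^ b * N ^ k ≤ N ^ m with (m - k) / b ≤ u /
-- v, that is, m v ≤ u b + k v. Raising to the power v, cancelling N ^ (k v) and removing the outer
-- power b leaves only u and v.
PowerSet-≤ : ∀ n .{{_ : NonZero n}} α u v .{{_ : NonZero v}} →
             (∀ {t} → lower α t → t ℚ.≤ + u / v) → ∀ {s} → PowerSet n α s → s ^ℚ v ℚ.≤ ℕ→ℚ n ^ℚ u
PowerSet-≤ n α u v α≤u/v {s} (0≤s , m , k , b , b≢0 , t∈α , le) =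
  ^ℚ-cancel-≤ (ℚ.positive⁻¹ (N ^ℚ u) {{^ℚ-pos N>0 u}}) b
    (ℚ.*-cancelʳ-≤-pos (N ^ℚ (k * v)) {{^ℚ-pos N>0 (k * v)}} (begin
    (s ^ℚ v) ^ℚ b ℚ.* N ^ℚ (k * v)     ≡⟨ cong (ℚ._* N ^ℚ (k * v)) (^ℚ-comm s v b) ⟩
    (s ^ℚ b) ^ℚ v ℚ.* N ^ℚ (k * v)     ≡⟨ cong ((s ^ℚ b) ^ℚ v ℚ.*_) (^ℚ-assocʳ N k v) ⟨
    (s ^ℚ b) ^ℚ v ℚ.* (N ^ℚ k) ^ℚ v    ≡⟨ ^ℚ-distrib-* (s ^ℚ b) (N ^ℚ k) v ⟨
    (s ^ℚ b ℚ.* N ^ℚ k) ^ℚ v           ≤⟨ ^ℚ-mono-≤ 0≤lhs le v ⟩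
    (N ^ℚ m) ^ℚ v                      ≡⟨ ^ℚ-assocʳ N m v ⟩
    N ^ℚ (m * v)                       ≤⟨ ^ℚ-monoʳ-≤ N>0 (1≤ℕ→ℚ n) (⊖-/-≤⇒ m k b u v (α≤u/v t∈α)) ⟩
    N ^ℚ (u * b ℕ.+ k * v)             ≡⟨ ^ℚ-homo-* N (u * b) (k * v) ⟩
    N ^ℚ (u * b) ℚ.* N ^ℚ (k * v)      ≡⟨ cong (ℚ._* N ^ℚ (k * v)) (^ℚ-assocʳ N u b) ⟨
    (N ^ℚ u) ^ℚ b ℚ.* N ^ℚ (k * v)     ∎))
  where
  open ℚ.≤-Reasoning
  instance _ = b≢0
  N = ℕ→ℚ n
  N>0 = ℚ.positive (ℚ.<-≤-trans (ℚ.positive⁻¹ 1ℚ) (1≤ℕ→ℚ n))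
  ^ℚ-comm : ∀ x i j → (x ^ℚ i) ^ℚ j ≡ (x ^ℚ j) ^ℚ i
  ^ℚ-comm x i j = trans (^ℚ-assocʳ x i j) (trans (cong (x ^ℚ_) (ℕ.*-comm i j)) (sym (^ℚ-assocʳ x j i)))
  0≤lhs : 0ℚ ℚ.≤ s ^ℚ b ℚ.* N ^ℚ k
  0≤lhs = ℚ.≤-trans (ℚ.≤-reflexive (sym (ℚ.*-zeroʳ (s ^ℚ b))))
    (ℚ.*-monoˡ-≤-nonNeg (s ^ℚ b) {{ℚ.nonNegative (^ℚ-nonNeg 0≤s b)}}
      (^ℚ-nonNeg (0≤ℕ→ℚ n) k))

ℕ∈PowerSet : ∀ n α s m b .{{b≢0 : NonZero b}} → lower α (+ m / b) → s ^ b ≤ n ^ m → PowerSet n α (ℕ→ℚ s)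
ℕ∈PowerSet n α s m b {{b≢0}} m/b∈α le = 0≤ℕ→ℚ s , m , 0 , b , recomputed ,
  subst (λ i → lower α (i / b)) (sym (ℤ.⊖-≥ {m} ℕ.z≤n)) m/b∈α ,
  (begin
    ℕ→ℚ s ^ℚ b ℚ.* 1ℚ     ≡⟨ ℚ.*-identityʳ (ℕ→ℚ s ^ℚ b) ⟩
    ℕ→ℚ s ^ℚ b            ≡⟨ ℕ→ℚ-homo-^ s b ⟨
    ℕ→ℚ (s ^ b)           ≤⟨ ℕ→ℚ-mono-≤ le ⟩
    ℕ→ℚ (n ^ m)           ≡⟨ ℕ→ℚ-homo-^ n m ⟩
    ℕ→ℚ n ^ℚ m            ∎)
  where
  open ℚ.≤-Reasoning
  -- `PowerSet` stores a relevant proof that `b` is nonzero, so the irrelevant instance is converted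
  -- by way of `b ≢ 0`.
  recomputed : NonZero b
  recomputed = ℕ.≢-nonZero (ℕ.≢-nonZero⁻¹ b)

PowerSet-ℕ-≤ : ∀ x s y v u .{{_ : NonZero v}} → ℕ→ℚ x ℚ.≤ s → s ^ℚ v ℚ.≤ ℕ→ℚ y ^ℚ u → x ^ v ≤ y ^ u
PowerSet-ℕ-≤ x s y v u x≤s s^v≤y^u = ℕ→ℚ-cancel-≤ {x ^ v} {y ^ u} (begin
  ℕ→ℚ (x ^ v)   ≡⟨ ℕ→ℚ-homo-^ x v ⟩
  ℕ→ℚ x ^ℚ v    ≤⟨ ^ℚ-mono-≤ (0≤ℕ→ℚ x) x≤s v ⟩
  s ^ℚ v        ≤⟨ s^v≤y^u ⟩
  ℕ→ℚ y ^ℚ u    ≡⟨ ℕ→ℚ-homo-^ y u ⟨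
  ℕ→ℚ (y ^ u)   ∎)
  where open ℚ.≤-Reasoning

1+1/E≡ : ∀ E .{{_ : NonZero E}} → 1ℚ ℚ.+ + 1 / E ≡ + suc E / E
1+1/E≡ E@(suc E-1) = ℚ.toℚᵘ-injective (begin
  ℚ.toℚᵘ (1ℚ ℚ.+ + 1 / E)             ≈⟨ ℚ.toℚᵘ-homo-+ 1ℚ (+ 1 / E) ⟩
  mkℚᵘ (+ 1) 0 ℚᵘ.+ ℚ.toℚᵘ (+ 1 / E)  ≈⟨ ℚᵘ.+-cong (ℚᵘ.≃-refl {mkℚᵘ (+ 1) 0}) (i/b-≃ (+ 1) E-1) ⟩
  mkℚᵘ (+ 1) 0 ℚᵘ.+ mkℚᵘ (+ 1) E-1    ≈⟨ ℚᵘ.*≡* (cong₂ ℤ._*_ {+ 1 ℤ.* + E ℤ.+ + 1} {+ suc E} {+ E} {+ suc (E-1 ℕ.+ 0)}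
                                           (trans (cong (ℤ._+ + 1) (ℤ.*-identityˡ (+ E))) (cong +_ (ℕ.+-comm E 1)))
                                           (cong (λ e → + suc e) (sym (ℕ.+-identityʳ E-1)))) ⟩
  mkℚᵘ (+ suc E) E-1                  ≈⟨ i/b-≃ (+ suc E) E-1 ⟨
  ℚ.toℚᵘ (+ suc E / E)                ∎)
  where open ℚᵘ.≃-Reasoning

-- Multiplying the exponent by E turns c < κ R ^ (1 + 1 / E) into an inequality of integers.

ABC⇒^-bound : ABC → ∀ E .{{_ : NonZero E}} → ∃[ K ]
  (∀ a b c .{{_ : NonZero a}} .{{_ : NonZero b}} .{{_ : NonZero c}} →
   Coprime₃ a b c → a ℕ.+ b ≡ c → c ^ E ≤ K ^ E * rad (a * b * c) ^ suc E)
ABC⇒^-bound abc E@(suc E-1) =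
  let κ , _ , c<κR = abc ε 0<ε in
  -- A rational bound of κ is at most the absolute value of its numerator, which serves as the
  -- integer K.
  ∣ ℚ.↥ proj₁ (bounded κ) ∣ , λ a b c cop eq →
    bound κ c (rad (a * b * c)) {{rad-nonZero (a * b * c)}}
      (fromℕ-<⇒ c (κ *ᴿ rad[ a * b * c ]^ (1ᴿ +ᴿ ε)) (c<κR a b c cop eq))
  where
  ε = fromℚ (+ 1 / E)

  0<ε : 0ᴿ <ᴿ ε
  0<ε = 0ℚ , (λ { (_ , refl , p<0) → ℚ.<⇒≤ p<0 }) , _ , refl ,
    /-mono-< 0ℤ (+ 1) 0 E-1 (ℤ.+<+ (ℕ.s≤s ℕ.z≤n))

  1+ε≤ : ∀ {t} → lower (1ᴿ +ᴿ ε) t → t ℚ.≤ + suc E / E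
  1+ε≤ (_ , (p , q , (_ , refl , p<1) , (_ , refl , q<ε) , refl) , t<p+q) =
    ℚ.<⇒≤ (ℚ.<-trans t<p+q (subst (p ℚ.+ q ℚ.<_) (1+1/E≡ E) (ℚ.+-mono-< p<1 q<ε)))

  bound : ∀ κ c R .{{_ : NonZero R}} →
          ∃[ q ] lower (κ *ᴿ R ^ᴿ (1ᴿ +ᴿ ε)) q × ℕ→ℚ c ℚ.≤ q →
          c ^ E ≤ ∣ ℚ.↥ proj₁ (bounded κ) ∣ ^ E * R ^ suc E
  bound κ c R (q , (_ , (k , r , k∈κ , (s , s∈ , r<s) , refl) , q<kr) , c≤q) =
    ℕ→ℚ-cancel-≤ {c ^ E} {K ^ E * R ^ suc E} (begin
    ℕ→ℚ (c ^ E)                     ≡⟨ ℕ→ℚ-homo-^ c E ⟩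
    ℕ→ℚ c ^ℚ E                      ≤⟨ ^ℚ-mono-≤ (0≤ℕ→ℚ c) c≤Ks E ⟩
    (ℕ→ℚ K ℚ.* s) ^ℚ E              ≡⟨ ^ℚ-distrib-* (ℕ→ℚ K) s E ⟩
    ℕ→ℚ K ^ℚ E ℚ.* s ^ℚ E           ≤⟨ ℚ.*-monoˡ-≤-nonNeg (ℕ→ℚ K ^ℚ E) {{ℚ.nonNegative (^ℚ-nonNeg (0≤ℕ→ℚ K) E)}}
                                         (PowerSet-≤ R (1ᴿ +ᴿ ε) (suc E) E 1+ε≤ s∈) ⟩
    ℕ→ℚ K ^ℚ E ℚ.* ℕ→ℚ R ^ℚ suc E   ≡⟨ cong₂ ℚ._*_ (ℕ→ℚ-homo-^ K E) (ℕ→ℚ-homo-^ R (suc E)) ⟨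
    ℕ→ℚ (K ^ E) ℚ.* ℕ→ℚ (R ^ suc E) ≡⟨ ℕ→ℚ-homo-* (K ^ E) (R ^ suc E) ⟨
    ℕ→ℚ (K ^ E * R ^ suc E)         ∎)
    where
    open ℚ.≤-Reasoning
    K = ∣ ℚ.↥ proj₁ (bounded κ) ∣
    c≤Ks : ℕ→ℚ c ℚ.≤ ℕ→ℚ K ℚ.* s
    c≤Ks = ℚ.≤-trans c≤q (ℚ.≤-trans (ℚ.<⇒≤ q<kr) (*-mono-≤-nonNeg (0≤ℕ→ℚ K) (0≤⊔0 r)
      (ℚ.⊔-lub (ℚ.≤-trans (proj₂ (bounded κ) k∈κ) (q≤∣↥q∣ (proj₁ (bounded κ)))) (0≤ℕ→ℚ K))
      (ℚ.⊔-lub (ℚ.<⇒≤ r<s) (proj₁ s∈))))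

-- The cut of `n ^ᴿ α` is built from exponents strictly below α, so α = m + 1 is taken to make the
-- exponent m itself available.
<-^ᴿ : ∀ c n m .{{_ : NonZero n}} → c < n ^ m → fromℕ c <ᴿ n ^ᴿ fromℕ (suc m)
<-^ᴿ c n m c<n^m = ℕ→ℚ c , (λ { (_ , refl , p<c) → ℚ.<⇒≤ p<c }) , _ ,
  ℕ∈PowerSet n (fromℕ (suc m)) (n ^ m) m 1 (_ , refl , ℕ→ℚ-mono-< (ℕ.n<1+n m))
    (ℕ.≤-reflexive (ℕ.*-identityʳ (n ^ m))) ,
  ℕ→ℚ-mono-< c<n^m

-- Strictness is paid for twice: `suc B` is a power-set element strictly above the norm bound `B`,
-- and `suc u / v` is an exponent strictly above u / v.
‖‖-<-^ᴿ : ∀ ψ B n u v .{{_ : NonZero n}} .{{_ : NonZero v}} →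
          (∀ p → ∣ ⟦ ψ ⟧ (ξ p) ∣ ≤ B) → suc B ^ v ≤ n ^ u → ‖ ψ ‖ <ᴿ n ^ᴿ fromℚ (+ suc u / v)
‖‖-<-^ᴿ ψ B n u v@(suc v-1) ψ≤B le = ℕ→ℚ B ,
  (λ { (_ , (p , refl) , t<) → ℚ.≤-trans (ℚ.<⇒≤ t<) (ℕ→ℚ-mono-≤ (ψ≤B p)) }) , _ ,
  ℕ∈PowerSet n (fromℚ (+ suc u / v)) (suc B) u v
    (_ , refl , /-mono-< (+ u) (+ suc u) v-1 v-1 (ℤ.*-monoʳ-<-pos (+ v) (ℤ.+<+ (ℕ.n<1+n u)))) le ,
  ℕ→ℚ-mono-< (ℕ.n<1+n B)

‖‖-<-^ᴿ⇒ : ∀ ψ η n u v .{{_ : NonZero n}} .{{_ : NonZero v}} →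
           (∀ {t} → lower η t → t ℚ.≤ + u / v) → ‖ ψ ‖ <ᴿ n ^ᴿ η → ∀ p → ∣ ⟦ ψ ⟧ (ξ p) ∣ ^ v ≤ n ^ u
‖‖-<-^ᴿ⇒ ψ η n u v η≤ (q , ψ≤q , s , s∈ , q<s) p = PowerSet-ℕ-≤ _ s n v u
  (ℚ.≮⇒≥ λ s<ψ → ℚ.<-irrefl refl (ℚ.<-≤-trans q<s (ψ≤q (_ , (p , refl) , s<ψ))))
  (PowerSet-≤ n η u v η≤ s∈)

-- The rational separating η from 1 is nonnegative because η is positive, so its reduced form is a
-- fraction of natural numbers. The gap between `u` and `suc v` is what later isolates a factor c.
<1⇒/-bound : ∀ {η} → 0ᴿ <ᴿ η → η <ᴿ 1ᴿ →
  ∃₂ λ u v → u < suc v × (∀ {t} → lower η t → t ℚ.≤ + u / suc v)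
<1⇒/-bound {η} (p , 0≤p , p∈η) (q , η≤q , _ , refl , q<1) = from q refl 0≤q q<1
  where
  0≤q : 0ℚ ℚ.≤ q
  0≤q = ℚ.≮⇒≥ λ q<0 → ℚ.<-irrefl refl (let r , q<r , r<0 = ℚ.<-dense q<0 in
    ℚ.<-≤-trans q<r (ℚ.≤-trans (0≤p (_ , refl , r<0)) (η≤q p∈η)))
  from : ∀ q′ → q ≡ q′ → 0ℚ ℚ.≤ q′ → q′ ℚ.< ℕ→ℚ 1 →
    ∃₂ λ u v → u < suc v × (∀ {t} → lower η t → t ℚ.≤ + u / suc v)
  from q′@(ℚ.mkℚ (+ u) v-1 _) q≡q′ _ q<1 = u , v-1 ,
    subst₂ _<_ (ℕ.*-identityʳ u) (ℕ.+-identityʳ (suc v-1)) 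
      (ℤ.drop‿+<+ (subst₂ ℤ._<_ (sym (ℤ.pos-* u 1)) (sym (ℤ.pos-* 1 (suc v-1))) (ℚ.drop-*<* q<1))) ,
    λ t∈η → subst (_ ℚ.≤_) (trans q≡q′ (sym (ℚ.↥p/↧p≡p q′))) (η≤q t∈η)
  from (ℚ.mkℚ ℤ.-[1+ _ ] v-1 _) q≡q′ (ℚ.*≤* ()) _

-- Finite sums and the pigeonhole principle

module Σℤ = SemiringSum ℤ.+-*-semiring
module Σℕ = SemiringSum ℕ.+-*-semiring
module Πℕ = MonoidSum ℕ.*-1-commutativeMonoid

open Σℤ using () renaming (sum to ∑ℤ)
open Σℕ using () renaming (sum to ∑ℕ)
open Πℕ using () renaming (sum to ∏)

module _ {c ℓ} (M : CommutativeMonoid c ℓ) where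
  open CommutativeMonoid M renaming (trans to ≈-trans; sym to ≈-sym)
  open MonoidSum M

  sum-only : ∀ (t : Fin n → Carrier) j → (∀ i → i ≢ j → t i ≈ ε) → sum t ≈ t j
  sum-only {suc n} t j t≈ε = ≈-trans (sum-remove {i = j} t) (≈-trans
    (∙-congˡ (≈-trans (sum-cong-≋ (λ i → t≈ε (punchIn j i) (Fin.punchInᵢ≢i j i))) (sum-replicate-zero n)))
    (identityʳ (t j)))

∑-∣ : ∀ {m} (t : Fin n → ℤ) → (∀ i → m ∣ℤ t i) → m ∣ℤ ∑ℤ t
∑-∣ {n = zero}  t m∣t = ℤ∣.divides 0ℤ refl
∑-∣ {n = suc _} t m∣t = ℤ∣.∣m∣n⇒∣m+n (m∣t zero) (∑-∣ (t ∘ suc) (m∣t ∘ suc))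

∑-∣⇒term-∣ : ∀ {m} (t : Fin n → ℤ) j → m ∣ℤ ∑ℤ t → (∀ i → i ≢ j → m ∣ℤ t i) → m ∣ℤ t j
∑-∣⇒term-∣ {n = suc _} t j m∣∑t m∣t = ℤ∣.∣m+n∣n⇒∣m
  (subst (_ ∣ℤ_) (Σℤ.sum-remove {i = j} t) m∣∑t)
  (∑-∣ (removeAt t j) (λ i → m∣t (punchIn j i) (Fin.punchInᵢ≢i j i)))

∣∑∣≤ : ∀ (t : Fin n → ℤ) (u : Fin n → ℕ) → (∀ i → ∣ t i ∣ ≤ u i) → ∣ ∑ℤ t ∣ ≤ ∑ℕ u
∣∑∣≤ {zero}  t u t≤u = ℕ.z≤n
∣∑∣≤ {suc _} t u t≤u = ℕ.≤-trans (ℤ.∣i+j∣≤∣i∣+∣j∣ (t zero) _)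
  (ℕ.+-mono-≤ (t≤u zero) (∣∑∣≤ (t ∘ suc) (u ∘ suc) (t≤u ∘ suc)))

∑-≤ : ∀ (t : Fin n → ℕ) x → (∀ i → t i ≤ x) → ∑ℕ t ≤ n * x
∑-≤ {zero}  t x t≤x = ℕ.z≤n
∑-≤ {suc _} t x t≤x = ℕ.+-mono-≤ (t≤x zero) (∑-≤ (t ∘ suc) x (t≤x ∘ suc))

∑-mono : ∀ (t u : Fin n → ℕ) → (∀ i → t i ≤ u i) → ∑ℕ t ≤ ∑ℕ u
∑-mono {zero}  t u t≤u = ℕ.z≤n
∑-mono {suc _} t u t≤u = ℕ.+-mono-≤ (t≤u zero) (∑-mono (t ∘ suc) (u ∘ suc) (t≤u ∘ suc))

-- Mixed-radix digits: they identify `Fin (∏ h)` with the box of vectors whose i-th entry lies below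
-- `h i`, which makes `Fin.pigeonhole` applicable.
digit : (h : Fin n → ℕ) → Fin (∏ h) → (i : Fin n) → Fin (h i)
digit {suc n} h x zero    = proj₁ (remQuot (∏ (h ∘ suc)) x)
digit {suc n} h x (suc i) = digit (h ∘ suc) (proj₂ (remQuot {h zero} (∏ (h ∘ suc)) x)) i

digit-injective : (h : Fin n → ℕ) → ∀ x y → (∀ i → digit h x i ≡ digit h y i) → x ≡ y
digit-injective {zero}  h zero zero eq = refl
digit-injective {suc n} h x y eq = begin
  x                                  ≡⟨ Fin.combine-remQuot {h zero} (∏ (h ∘ suc)) x ⟨
  uncurry combine (remQuot {h zero} (∏ (h ∘ suc)) x)
    ≡⟨ cong₂ combine (eq zero) (digit-injective (h ∘ suc) _ _ (eq ∘ suc)) ⟩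
  uncurry combine (remQuot {h zero} (∏ (h ∘ suc)) y) ≡⟨ Fin.combine-remQuot {h zero} (∏ (h ∘ suc)) y ⟩
  y                                  ∎
  where open ≡-Reasoning

%ℕ-≡⇒∣- : ∀ i j m .{{_ : NonZero m}} → i %ℕ m ≡ j %ℕ m → + m ∣ℤ i ℤ.- j
%ℕ-≡⇒∣- i j m eq = ℤ∣.divides (i /ℕ m ℤ.- j /ℕ m) (begin
  i ℤ.- j
    ≡⟨ cong₂ ℤ._-_ (ℤ.a≡a%ℕn+[a/ℕn]*n i m) (trans (ℤ.a≡a%ℕn+[a/ℕn]*n j m) (cong (λ r → + r ℤ.+ j /ℕ m ℤ.* + m) (sym eq))) ⟩
  (+ (i %ℕ m) ℤ.+ i /ℕ m ℤ.* + m) ℤ.- (+ (i %ℕ m) ℤ.+ j /ℕ m ℤ.* + m)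
    ≡⟨ regroup (+ (i %ℕ m)) (i /ℕ m) (j /ℕ m) (+ m) ⟩
  (i /ℕ m ℤ.- j /ℕ m) ℤ.* + m ∎)
  where
  open ≡-Reasoning
  regroup : ∀ r x y z → (r ℤ.+ x ℤ.* z) ℤ.- (r ℤ.+ y ℤ.* z) ≡ (x ℤ.- y) ℤ.* z
  regroup = ℤ-Ring.solve-∀

∣toℕ-toℕ∣< : ∀ {h} (x y : Fin h) → ∣ + toℕ x ℤ.- + toℕ y ∣ < h
∣toℕ-toℕ∣< x y = ℕ.≤-<-trans
  (subst (λ i → ∣ i ∣ ≤ toℕ x ℕ.⊔ toℕ y) (sym (ℤ.m-n≡m⊖n (toℕ x) (toℕ y))) (ℤ.∣m⊝n∣≤m⊔n (toℕ x) (toℕ y)))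
  (ℕ.⊔-lub (Fin.toℕ<n x) (Fin.toℕ<n y))

-- A many-variable form of Thue's lemma: two points of the box share a residue modulo m, and `y` is
-- their difference. A side `h i` equal to 1 forces `y i` to be 0, so coordinates are switched off
-- through their sides.
small-combination : ∀ (α : Fin n → ℤ) (h : Fin n → ℕ) m .{{_ : NonZero m}} → m < ∏ h →
  ∃[ y ] (∀ i → ∣ y i ∣ < h i) × (∃[ i ] y i ≢ 0ℤ) × + m ∣ℤ ∑ℤ (λ i → α i ℤ.* y i)
small-combination {n} α h m m<∏h =
  let x , x′ , x<x′ , eq = Fin.pigeonhole m<∏h (λ x → fromℕ< (ℤ.n%ℕd<d (total x) m))
      i , digits≢ = Fin.¬∀⟶∃¬ n (λ i → digit h x i ≡ digit h x′ i) (λ i → digit h x i Fin.≟ digit h x′ i)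
                      (λ same → Fin.<⇒≢ x<x′ (digit-injective h x x′ same))
  in difference x x′ ,
     (λ i → ∣toℕ-toℕ∣< (digit h x i) (digit h x′ i)) ,
     (i , λ y≡0 → digits≢ (Fin.toℕ-injective (ℤ.+-injective (ℤ.i-j≡0⇒i≡j _ _ y≡0)))) ,
     subst (+ m ∣ℤ_) (sym (∑αy≡ x x′)) (%ℕ-≡⇒∣- (total x) (total x′) m (Fin.fromℕ<-injective _ _ _ _ eq))
  where
  open ≡-Reasoning
  total : Fin (∏ h) → ℤ
  total x = ∑ℤ (λ i → α i ℤ.* + toℕ (digit h x i))

  difference : Fin (∏ h) → Fin (∏ h) → Fin n → ℤ
  difference x x′ i = + toℕ (digit h x i) ℤ.- + toℕ (digit h x′ i)

  regroup : ∀ a b c → a ℤ.* b ≡ a ℤ.* (b ℤ.- c) ℤ.+ a ℤ.* c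
  regroup = ℤ-Ring.solve-∀

  cancel : ∀ a b → a ≡ (a ℤ.+ b) ℤ.- b
  cancel = ℤ-Ring.solve-∀

  ∑αy≡ : ∀ x x′ → ∑ℤ (λ i → α i ℤ.* difference x x′ i) ≡ total x ℤ.- total x′
  ∑αy≡ x x′ = begin
    ∑ℤ (λ i → α i ℤ.* y i)
      ≡⟨ cancel _ (total x′) ⟩
    ∑ℤ (λ i → α i ℤ.* y i) ℤ.+ total x′ ℤ.- total x′
      ≡⟨ cong (ℤ._- total x′) (Σℤ.∑-distrib-+ (λ i → α i ℤ.* y i) (λ i → α i ℤ.* + toℕ (digit h x′ i))) ⟨
    ∑ℤ (λ i → α i ℤ.* y i ℤ.+ α i ℤ.* + toℕ (digit h x′ i)) ℤ.- total x′
      ≡⟨ cong (ℤ._- total x′) (Σℤ.sum-cong-≗ (λ i →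
           regroup (α i) (+ toℕ (digit h x i)) (+ toℕ (digit h x′ i)))) ⟨
    total x ℤ.- total x′ ∎
    where y = difference x x′

-- Independent solutions of D a + D b = D c

third : (k l : Fin 3) → ∃[ m ] m ≢ k × m ≢ l
third 0F 0F = 1F , (λ ()) , (λ ())
third 0F 1F = 2F , (λ ()) , (λ ())
third 0F 2F = 1F , (λ ()) , (λ ())
third 1F 0F = 2F , (λ ()) , (λ ())
third 1F 1F = 0F , (λ ()) , (λ ())
third 1F 2F = 0F , (λ ()) , (λ ())
third 2F 0F = 1F , (λ ()) , (λ ())
third 2F 1F = 0F , (λ ()) , (λ ())
third 2F 2F = 0F , (λ ()) , (λ ())

prime∣prime⇒≡ : ∀ {p q} → Prime p → Prime q → p ∣ q → p ≡ q
prime∣prime⇒≡ {p} p-prime q-prime p∣q =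
  [ (λ { refl → contradiction p-prime λ () }) , id ]′ (prime⇒irreducible q-prime p∣q)

prime∤1 : ∀ {p} → Prime p → ¬ p ∣ 1
prime∤1 p-prime p∣1 = contradiction (subst Prime (∣1⇒≡1 p∣1) p-prime) λ ()

prime∣∏ : ∀ {w p} (t : Fin w → ℕ) → Prime p → p ∣ ∏ t → ∃[ i ] p ∣ t i
prime∣∏ {zero}  t p-prime p∣1 = contradiction p∣1 (prime∤1 p-prime)
prime∣∏ {suc w} t p-prime p∣ with euclidsLemma (t 0F) (∏ (t ∘ suc)) p-prime p∣
... | inj₁ p∣t₀ = 0F , p∣t₀
... | inj₂ p∣∏  = let i , p∣tᵢ = prime∣∏ (t ∘ suc) p-prime p∣∏ in suc i , p∣tᵢ

term∣∏ : ∀ {w} (t : Fin w → ℕ) i → t i ∣ ∏ t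
term∣∏ t zero    = m∣m*n _
term∣∏ t (suc i) = ∣-trans (term∣∏ (t ∘ suc) i) (n∣m*n (t 0F))

coprime-∣ : ∀ {m n} → Coprime m n → ∀ {i} → + m ∣ℤ + n ℤ.* i → + m ∣ℤ i
coprime-∣ {m} {n} cop {i} m∣ni = ℤ∣.∣ᵤ⇒∣ (ℤ.coprime-divisor (+ m) (+ n) i cop (ℤ∣.∣⇒∣ᵤ m∣ni))

prime∤⇒coprime : ∀ {p n} → Prime p → ¬ p ∣ n → Coprime p n
prime∤⇒coprime p-prime p∤n {d} (d∣p , d∣n) with prime⇒irreducible p-prime d∣p
... | inj₁ d≡1  = d≡1
... | inj₂ refl = contradiction d∣n p∤n

∣∧∣∣<⇒≡0 : ∀ {m i} → + m ∣ℤ i → ∣ i ∣ < m → i ≡ 0ℤ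
∣∧∣∣<⇒≡0 {m} {i} m∣i ∣i∣<m with ∣ i ∣ in eq
... | zero  = ℤ.∣i∣≡0⇒i≡0 eq
... | suc _ = contradiction (subst (m ≤_) eq (∣⇒≤ {{subst NonZero (sym eq) _}} (ℤ∣.∣⇒∣ᵤ m∣i))) (ℕ.<⇒≱ ∣i∣<m)

^-distrib-* : ∀ x y k → (x * y) ^ k ≡ x ^ k * y ^ k
^-distrib-* x y zero    = refl
^-distrib-* x y (suc k) = trans (cong (x * y *_) (^-distrib-* x y k)) (interchange x y (x ^ k) (y ^ k))
  where open import Algebra.Properties.CommutativeSemigroup ℕ.*-commutativeSemigroup using (interchange)

^-cancelˡ-< : ∀ k {x y} → x ^ k < y ^ k → x < y
^-cancelˡ-< k x^k<y^k = ℕ.≰⇒> λ y≤x → ℕ.<⇒≱ x^k<y^k (ℕ.^-monoˡ-≤ k y≤x)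

floor-root : ∀ k .{{_ : NonZero k}} x → ∃[ r ] r ^ k ≤ x × x < suc r ^ k
floor-root k@(suc _) zero = 0 , ℕ.z≤n , ℕ.m^n>0 1 k
floor-root k (suc x) with floor-root k x
... | r , r^k≤x , x<[1+r]^k with suc r ^ k ℕ.≤? suc x
...   | yes le  = suc r , le , ℕ.≤-<-trans x<[1+r]^k (ℕ.^-monoˡ-< k (ℕ.n<1+n (suc r)))
...   | no  nle = r , ℕ.m≤n⇒m≤1+n r^k≤x , ℕ.≰⇒> nle

-- For use with y a prime divisor, x its cofactor, s the floor of the square root of c and M that of
-- c ^ (3 / 4). Fourth powers give c ^ 3 < y ^ 4, hence x ^ 4 ≤ c and (x s) ^ 4 ≤ c * c ^ 2; the
-- last claim then uses that x s is an integer.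
large-divisor-bounds : ∀ c x y s M .{{_ : NonZero c}} → x * y ≤ c → s ^ 2 ≤ c → c ^ 3 < suc M ^ 4 → M < y →
                       s < y × x < y × x * s ≤ M
large-divisor-bounds c x y s M xy≤c s²≤c c³<[1+M]^4 M<y = s<y , x<y , xs≤M
  where
  open ℕ.≤-Reasoning
  c³<y^4 : c ^ 3 < y ^ 4
  c³<y^4 = ℕ.<-≤-trans c³<[1+M]^4 (ℕ.^-monoˡ-≤ 4 M<y)

  s^4≤c² : s ^ 4 ≤ c ^ 2
  s^4≤c² = subst (_≤ c ^ 2) (ℕ.^-*-assoc s 2 2) (ℕ.^-monoˡ-≤ 2 s²≤c)

  s<y : s < y
  s<y = ^-cancelˡ-< 4 {s} {y} (begin-strict
    s ^ 4   ≤⟨ s^4≤c² ⟩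
    c ^ 2   ≤⟨ ℕ.^-monoʳ-≤ c (ℕ.n≤1+n 2) ⟩
    c ^ 3   <⟨ c³<y^4 ⟩
    y ^ 4   ∎)

  x^4≤c : x ^ 4 ≤ c
  x^4≤c = ℕ.*-cancelʳ-≤ _ _ (c ^ 3) {{ℕ.m^n≢0 c 3}} (begin
    x ^ 4 * c ^ 3   ≤⟨ ℕ.*-monoʳ-≤ (x ^ 4) (ℕ.<⇒≤ c³<y^4) ⟩
    x ^ 4 * y ^ 4   ≡⟨ ^-distrib-* x y 4 ⟨
    (x * y) ^ 4     ≤⟨ ℕ.^-monoˡ-≤ 4 xy≤c ⟩
    c * c ^ 3       ∎)

  x<y : x < y
  x<y = ^-cancelˡ-< 4 {x} {y} (begin-strict
    x ^ 4   ≤⟨ x^4≤c ⟩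
    c       ≤⟨ ℕ.m≤m*n c (c ^ 2) {{ℕ.m^n≢0 c 2}} ⟩
    c ^ 3   <⟨ c³<y^4 ⟩
    y ^ 4   ∎)

  xs≤M : x * s ≤ M
  xs≤M = ℕ.≤-pred (^-cancelˡ-< 4 {x * s} {suc M} (begin-strict
    (x * s) ^ 4     ≡⟨ ^-distrib-* x s 4 ⟩
    x ^ 4 * s ^ 4   ≤⟨ ℕ.*-mono-≤ x^4≤c s^4≤c² ⟩
    c ^ 3           <⟨ c³<[1+M]^4 ⟩
    suc M ^ 4       ∎))

prime-divisor : ∀ {x} → x ≢ 0 → x ≢ 1 → ∃[ r ] Prime r × r ∣ x
prime-divisor {x} x≢0 x≢1 = from (factorise x {{ℕ.≢-nonZero x≢0}})
  where
  from : PrimeFactorisation x → ∃[ r ] Prime r × r ∣ x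
  from record { factors = [] ; isFactorisation = x≡1 } = contradiction x≡1 x≢1
  from record { factors = r ∷ rs ; isFactorisation = x≡ ; factorsPrime = r-prime ∷ _ } =
    r , r-prime , subst (r ∣_) (sym x≡) (m∣m*n _)

module Triple
  (n : Fin 3 → ℕ) (n≢0 : ∀ k → NonZero (n k))
  (n-coprime : ∀ {k l} → k ≢ l → Coprime (n k) (n l))
  (n₀+n₁≡n₂ : n 0F ℕ.+ n 1F ≡ n 2F)
  {w : ℕ} (p : Fin w → ℕ) (p-prime : ∀ i → Prime (p i))
  (p-injective : ∀ {i j} → p i ≡ p j → i ≡ j)
  (owner : Fin w → Fin 3) (p∣n : ∀ i → p i ∣ n (owner i))
  (p-complete : ∀ {r} k → Prime r → r ∣ n k → ∃[ i ] p i ≡ r × owner i ≡ k)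
  where

  m : Fin w → ℕ
  m i = quotient (p∣n i)

  n≡m*p : ∀ i → n (owner i) ≡ m i * p i
  n≡m*p i = m∣n⇒n≡quotient*m (p∣n i)

  m≢0 : ∀ i → NonZero (m i)
  m≢0 i = ℕ.≢-nonZero λ m≡0 → ℕ.≢-nonZero⁻¹ (n (owner i)) {{n≢0 (owner i)}} (trans (n≡m*p i) (cong (_* p i) m≡0))

  β : Fin 3 → Fin w → ℤ
  β k i = if does (k Fin.≟ owner i) then + m i else 0ℤ

  β-owner : ∀ i → β (owner i) i ≡ + m i
  β-owner i = cong (if_then + m i else 0ℤ) (dec-true (owner i Fin.≟ owner i) refl)

  β-≢ : ∀ {k i} → k ≢ owner i → β k i ≡ 0ℤ
  β-≢ {k} {i} k≢ = cong (if_then + m i else 0ℤ) (dec-false (k Fin.≟ owner i) k≢)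

  D : Fin 3 → (Fin w → ℤ) → ℤ
  D k y = ∑ℤ (λ i → β k i ℤ.* y i)

  α : Fin w → ℤ
  α i = β 0F i ℤ.+ β 1F i ℤ.- β 2F i

  ∣α∣≡m : ∀ i → ∣ α i ∣ ≡ m i
  ∣α∣≡m i with owner i
  ... | 0F = trans (cong ∣_∣ (trans (ℤ.+-identityʳ (+ m i ℤ.+ 0ℤ)) (ℤ.+-identityʳ (+ m i)))) refl
  ... | 1F = trans (cong ∣_∣ (trans (ℤ.+-identityʳ (0ℤ ℤ.+ + m i)) (ℤ.+-identityˡ (+ m i)))) refl
  ... | 2F = trans (cong ∣_∣ (ℤ.+-identityˡ (ℤ.- + m i))) (ℤ.∣-i∣≡∣i∣ (+ m i))

  ∑α≡ : ∀ y → ∑ℤ (λ i → α i ℤ.* y i) ≡ D 0F y ℤ.+ D 1F y ℤ.- D 2F y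
  ∑α≡ y = begin
    ∑ℤ (λ i → α i ℤ.* y i)
      ≡⟨ cancel _ (D 2F y) ⟩
    ∑ℤ (λ i → α i ℤ.* y i) ℤ.+ D 2F y ℤ.- D 2F y
      ≡⟨ cong (ℤ._- D 2F y) (Σℤ.∑-distrib-+ (λ i → α i ℤ.* y i) (λ i → β 2F i ℤ.* y i)) ⟨
    ∑ℤ (λ i → α i ℤ.* y i ℤ.+ β 2F i ℤ.* y i) ℤ.- D 2F y
      ≡⟨ cong (ℤ._- D 2F y) (Σℤ.sum-cong-≗ (λ i → regroup (β 0F i) (β 1F i) (β 2F i) (y i))) ⟩
    ∑ℤ (λ i → β 0F i ℤ.* y i ℤ.+ β 1F i ℤ.* y i) ℤ.- D 2F y
      ≡⟨ cong (ℤ._- D 2F y) (Σℤ.∑-distrib-+ (λ i → β 0F i ℤ.* y i) (λ i → β 1F i ℤ.* y i)) ⟩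
    D 0F y ℤ.+ D 1F y ℤ.- D 2F y ∎
    where
    open ≡-Reasoning
    cancel : ∀ x z → x ≡ (x ℤ.+ z) ℤ.- z
    cancel = ℤ-Ring.solve-∀
    regroup : ∀ b₀ b₁ b₂ x → (b₀ ℤ.+ b₁ ℤ.- b₂) ℤ.* x ℤ.+ b₂ ℤ.* x ≡ b₀ ℤ.* x ℤ.+ b₁ ℤ.* x
    regroup = ℤ-Ring.solve-∀

  -- Multiplying by the product of the primes other than p j makes every other term of D divisible by n.

  n∣D⇒p∣y : ∀ y j → + n (owner j) ∣ℤ D (owner j) y → + p j ∣ℤ y j
  n∣D⇒p∣y y j n∣D = coprime-∣ p⊥ρ (ℤ∣.*-cancelˡ-∣ (+ m j) {{m≢0 j}}
    (subst₂ _∣ℤ_ (trans (cong +_ (n≡m*p j)) (ℤ.pos-* (m j) (p j)))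
      (trans (cong (λ b → + ρ ℤ.* (b ℤ.* y j)) (β-owner j)) (swap (+ ρ) (+ m j) (y j)))
      (∑-∣⇒term-∣ (λ i → + ρ ℤ.* (β k i ℤ.* y i)) j
        (subst (+ n k ∣ℤ_) (Σℤ.*-distribˡ-sum (+ ρ) (λ i → β k i ℤ.* y i)) (ℤ∣.∣n⇒∣m*n (+ ρ) n∣D))
        others)))
    where
    k = owner j
    swap : ∀ a b c → a ℤ.* (b ℤ.* c) ≡ b ℤ.* (a ℤ.* c)
    swap = ℤ-Ring.solve-∀
    t : Fin w → ℕ
    t i = if does (i Fin.≟ j) then 1 else p i
    ρ = ∏ t
    p⊥ρ : Coprime (p j) ρ
    p⊥ρ = prime∤⇒coprime (p-prime j) λ p∣ρ → p∤t (prime∣∏ t (p-prime j) p∣ρ)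
      where
      p∤t : ¬ (∃[ i ] p j ∣ t i)
      p∤t (i , p∣t) with i Fin.≟ j
      ... | yes _  = prime∤1 (p-prime j) p∣t
      ... | no i≢j = i≢j (sym (p-injective (prime∣prime⇒≡ (p-prime j) (p-prime i) p∣t)))
    others : ∀ i → i ≢ j → + n k ∣ℤ + ρ ℤ.* (β k i ℤ.* y i)
    others i i≢j with k Fin.≟ owner i
    ... | no  _    = ℤ∣.∣n⇒∣m*n (+ ρ) (ℤ∣.divides 0ℤ refl)
    ... | yes k≡   = subst₂ _∣ℤ_
      (trans (sym (ℤ.pos-* (p i) (m i)))
        (cong +_ (trans (ℕ.*-comm (p i) (m i)) (trans (sym (n≡m*p i)) (cong n (sym k≡))))))
      (ℤ.*-assoc (+ ρ) (+ m i) (y i))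
      (ℤ∣.∣m⇒∣m*n (y i) (ℤ∣.*-monoˡ-∣ (+ m i) (ℤ∣.∣ᵤ⇒∣ {+ p i} {+ ρ} (subst (_∣ ρ) t≡p (term∣∏ t i)))))
      where
      t≡p : t i ≡ p i
      t≡p = cong (if_then 1 else p i) (dec-false (i Fin.≟ j) i≢j)

  -- Adding the relation for the two summands extends proportionality to the third number, since
  -- both `n` and `D` are additive there; comparing every index with 0F and cancelling `n 0F` gives
  -- all pairs.
  proportional : ∀ y → D 0F y ℤ.+ D 1F y ≡ D 2F y → + n 0F ℤ.* D 1F y ≡ + n 1F ℤ.* D 0F y →
                 ∀ k l → + n k ℤ.* D l y ≡ + n l ℤ.* D k y
  proportional y D₀+D₁≡D₂ W≡0 k l = ℤ.*-cancelˡ-≡ (+ n 0F) _ _ {{n≢0 0F}} (begin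
    + n 0F ℤ.* (+ n k ℤ.* D l y)   ≡⟨ swap (+ n 0F) (+ n k) (D l y) ⟩
    + n k ℤ.* (+ n 0F ℤ.* D l y)   ≡⟨ cong (+ n k ℤ.*_) (base l) ⟩
    + n k ℤ.* (+ n l ℤ.* D 0F y)   ≡⟨ swap (+ n k) (+ n l) (D 0F y) ⟩
    + n l ℤ.* (+ n k ℤ.* D 0F y)   ≡⟨ cong (+ n l ℤ.*_) (base k) ⟨
    + n l ℤ.* (+ n 0F ℤ.* D k y)   ≡⟨ swap (+ n l) (+ n 0F) (D k y) ⟩
    + n 0F ℤ.* (+ n l ℤ.* D k y)   ∎)
    where
    open ≡-Reasoning
    swap : ∀ a b c → a ℤ.* (b ℤ.* c) ≡ b ℤ.* (a ℤ.* c)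
    swap = ℤ-Ring.solve-∀
    base : ∀ k → + n 0F ℤ.* D k y ≡ + n k ℤ.* D 0F y
    base 0F = refl
    base 1F = W≡0
    base 2F = begin
      + n 0F ℤ.* D 2F y                            ≡⟨ cong (+ n 0F ℤ.*_) D₀+D₁≡D₂ ⟨
      + n 0F ℤ.* (D 0F y ℤ.+ D 1F y)               ≡⟨ ℤ.*-distribˡ-+ (+ n 0F) (D 0F y) (D 1F y) ⟩
      + n 0F ℤ.* D 0F y ℤ.+ + n 0F ℤ.* D 1F y      ≡⟨ cong (λ x → + n 0F ℤ.* D 0F y ℤ.+ x) W≡0 ⟩
      + n 0F ℤ.* D 0F y ℤ.+ + n 1F ℤ.* D 0F y      ≡⟨ ℤ.*-distribʳ-+ (D 0F y) (+ n 0F) (+ n 1F) ⟨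
      (+ n 0F ℤ.+ + n 1F) ℤ.* D 0F y               ≡⟨ cong (λ x → + x ℤ.* D 0F y) n₀+n₁≡n₂ ⟩
      + n 2F ℤ.* D 0F y                            ∎

  D-only : ∀ y {k} j → owner j ≡ k → (∀ i → i ≢ j → owner i ≡ k → y i ≡ 0ℤ) → D k y ≡ + m j ℤ.* y j
  D-only y {k} j refl y≡0 = trans
    (sum-only ℤ.+-0-commutativeMonoid (λ i → β k i ℤ.* y i) j others)
    (cong (ℤ._* y j) (β-owner j))
    where
    others : ∀ i → i ≢ j → β k i ℤ.* y i ≡ 0ℤ
    others i i≢j with k Fin.≟ owner i
    ... | no  _  = refl
    ... | yes k≡ = trans (cong (+ m i ℤ.*_) (y≡0 i i≢j (sym k≡))) (ℤ.*-zeroʳ (+ m i))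

  D≡0 : ∀ y {k} → (∀ i → owner i ≡ k → y i ≡ 0ℤ) → D k y ≡ 0ℤ
  D≡0 y {k} y≡0 = trans (Σℤ.sum-cong-≗ terms) (Σℤ.sum-replicate-zero w)
    where
    terms : ∀ i → β k i ℤ.* y i ≡ 0ℤ
    terms i with k Fin.≟ owner i
    ... | no  _  = refl
    ... | yes k≡ = trans (cong (+ m i ℤ.*_) (y≡0 i (sym k≡))) (ℤ.*-zeroʳ (+ m i))

  module _ (y : Fin w → ℤ) {i₀ i₁ : Fin w} (o₀≢o₁ : owner i₀ ≢ owner i₁)
    (small : ∀ i → i ≢ i₀ → i ≢ i₁ → ∣ y i ∣ < p i)
    (D₀+D₁≡D₂ : D 0F y ℤ.+ D 1F y ≡ D 2F y) (W≡0 : + n 0F ℤ.* D 1F y ≡ + n 1F ℤ.* D 0F y)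
    where

    private
      prop = proportional y D₀+D₁≡D₂ W≡0

      y≡0 : ∀ i → i ≢ i₀ → i ≢ i₁ → y i ≡ 0ℤ
      y≡0 i i≢i₀ i≢i₁ = ∣∧∣∣<⇒≡0 (n∣D⇒p∣y y i n∣D) (small i i≢i₀ i≢i₁)
        where
        k = owner i
        -- `n k` divides n k * D l = n l * D k and is coprime to `n l`.
        n∣D : + n k ∣ℤ D k y
        n∣D = let l , l≢k , _ = third k k in
          coprime-∣ (n-coprime (l≢k ∘ sym)) (subst (+ n k ∣ℤ_) (prop k l) (ℤ∣.∣m⇒∣m*n (D l y) ℤ∣.∣-refl))

      D-third≡0 : D (proj₁ (third (owner i₀) (owner i₁))) y ≡ 0ℤ
      D-third≡0 = let l , l≢o₀ , l≢o₁ = third (owner i₀) (owner i₁) in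
        D≡0 y λ i o≡l → y≡0 i (λ { refl → l≢o₀ (sym o≡l) }) (λ { refl → l≢o₁ (sym o≡l) })

      D-o₁≡0 : D (owner i₁) y ≡ 0ℤ
      D-o₁≡0 = let l , _ = third (owner i₀) (owner i₁) in
        ℤ.*-cancelˡ-≡ (+ n l) _ _ {{n≢0 l}} (begin
          + n l ℤ.* D (owner i₁) y      ≡⟨ prop l (owner i₁) ⟩
          + n (owner i₁) ℤ.* D l y      ≡⟨ cong (+ n (owner i₁) ℤ.*_) D-third≡0 ⟩
          + n (owner i₁) ℤ.* 0ℤ         ≡⟨ ℤ.*-zeroʳ (+ n (owner i₁)) ⟩
          0ℤ                            ≡⟨ ℤ.*-zeroʳ (+ n l) ⟨
          + n l ℤ.* 0ℤ                  ∎)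
        where open ≡-Reasoning

      y₁≡0 : y i₁ ≡ 0ℤ
      y₁≡0 = ℤ.*-cancelˡ-≡ (+ m i₁) _ _ {{m≢0 i₁}} (begin
        + m i₁ ℤ.* y i₁   ≡⟨ D-only y i₁ refl (λ i i≢i₁ o≡ → y≡0 i (λ { refl → o₀≢o₁ o≡ }) i≢i₁) ⟨
        D (owner i₁) y    ≡⟨ D-o₁≡0 ⟩
        0ℤ                ≡⟨ ℤ.*-zeroʳ (+ m i₁) ⟨
        + m i₁ ℤ.* 0ℤ     ∎)
        where open ≡-Reasoning

    -- The coordinate i₀ may be left out: the nonzero coordinate supplied by the pigeonhole
    -- principle lies elsewhere.
    dependent⇒≡0 : ∀ i → i ≢ i₀ → y i ≡ 0ℤ
    dependent⇒≡0 i i≢i₀ with i Fin.≟ i₁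
    ... | yes refl = y₁≡0
    ... | no  i≢i₁ = y≡0 i i≢i₀ i≢i₁

  -- Modulo m i₀ the relation does not involve y i₀, which is solved for in the end.

  private
    module Correction
      {i₀ i₁} (h : Fin w → ℕ) (o₀≢o₁ : owner i₀ ≢ owner i₁) (h₀≡1 : h i₀ ≡ 1)
      (h≤p : ∀ i → i ≢ i₀ → i ≢ i₁ → h i ≤ p i)
      (y : Fin w → ℤ) (∣y∣<h : ∀ i → ∣ y i ∣ < h i) {j} (yⱼ≢0 : y j ≢ 0ℤ)
      (m₀∣∑αy : + m i₀ ∣ℤ ∑ℤ (λ i → α i ℤ.* y i))
      where

      α₀∣∑αy : α i₀ ∣ℤ ∑ℤ (λ i → α i ℤ.* y i)
      α₀∣∑αy = ℤ∣.∣ᵤ⇒∣ (subst (_∣ _) (sym (∣α∣≡m i₀)) (ℤ∣.∣⇒∣ᵤ m₀∣∑αy))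

      open _∣ℤ_ α₀∣∑αy renaming (quotient to x; equality to ∑αy≡xα₀)

      -- The sum of the `α i * y i` equals x * α i₀, and `y i₀` is 0 because its side is 1. Putting
      -- -x at i₀ therefore cancels the sum exactly.
      z : Fin w → ℤ
      z i = if does (i Fin.≟ i₀) then ℤ.- x else y i

      z≡y : ∀ i → i ≢ i₀ → z i ≡ y i
      z≡y i i≢i₀ = cong (if_then ℤ.- x else y i) (dec-false (i Fin.≟ i₀) i≢i₀)

      z₀≡-x : z i₀ ≡ ℤ.- x
      z₀≡-x = cong (if_then ℤ.- x else y i₀) (dec-true (i₀ Fin.≟ i₀) refl)

      y₀≡0 : y i₀ ≡ 0ℤ
      y₀≡0 = ℤ.∣i∣≡0⇒i≡0 (ℕ.n<1⇒n≡0 (subst (∣ y i₀ ∣ <_) h₀≡1 (∣y∣<h i₀)))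

      δ : Fin w → ℤ
      δ i = z i ℤ.- y i

      δ₀≡-x : δ i₀ ≡ ℤ.- x
      δ₀≡-x = trans (cong₂ (λ a b → a ℤ.- b) z₀≡-x y₀≡0) (ℤ.+-identityʳ (ℤ.- x))

      ∑αδ≡ : ∑ℤ (λ i → α i ℤ.* δ i) ≡ α i₀ ℤ.* ℤ.- x
      ∑αδ≡ = trans (sum-only ℤ.+-0-commutativeMonoid (λ i → α i ℤ.* δ i) i₀
          (λ i i≢i₀ → trans (cong (α i ℤ.*_) (ℤ.i≡j⇒i-j≡0 (z≡y i i≢i₀))) (ℤ.*-zeroʳ (α i))))
        (cong (α i₀ ℤ.*_) δ₀≡-x)

      ∑αz≡0 : ∑ℤ (λ i → α i ℤ.* z i) ≡ 0ℤ
      ∑αz≡0 = begin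
        ∑ℤ (λ i → α i ℤ.* z i)
          ≡⟨ Σℤ.sum-cong-≗ (λ i → split (α i) (z i) (y i)) ⟩
        ∑ℤ (λ i → α i ℤ.* y i ℤ.+ α i ℤ.* δ i)
          ≡⟨ Σℤ.∑-distrib-+ (λ i → α i ℤ.* y i) (λ i → α i ℤ.* δ i) ⟩
        ∑ℤ (λ i → α i ℤ.* y i) ℤ.+ ∑ℤ (λ i → α i ℤ.* δ i)
          ≡⟨ cong₂ ℤ._+_ ∑αy≡xα₀ ∑αδ≡ ⟩
        x ℤ.* α i₀ ℤ.+ α i₀ ℤ.* ℤ.- x
          ≡⟨ cancel x (α i₀) ⟩
        0ℤ ∎
        where
        open ≡-Reasoning
        split : ∀ a b c → a ℤ.* b ≡ a ℤ.* c ℤ.+ a ℤ.* (b ℤ.- c)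
        split = ℤ-Ring.solve-∀
        cancel : ∀ a b → a ℤ.* b ℤ.+ b ℤ.* ℤ.- a ≡ 0ℤ
        cancel = ℤ-Ring.solve-∀

      D₀+D₁≡D₂ : D 0F z ℤ.+ D 1F z ≡ D 2F z
      D₀+D₁≡D₂ = ℤ.i-j≡0⇒i≡j _ _ (trans (sym (∑α≡ z)) ∑αz≡0)

      z₀-bound : ∣ z i₀ ∣ * m i₀ ≤ ∑ℕ (λ i → m i * ∣ y i ∣)
      z₀-bound = begin
        ∣ z i₀ ∣ * m i₀              ≡⟨ cong₂ _*_ (trans (cong ∣_∣ z₀≡-x) (ℤ.∣-i∣≡∣i∣ x)) (sym (∣α∣≡m i₀)) ⟩
        ∣ x ∣ * ∣ α i₀ ∣             ≡⟨ ℤ.abs-* x (α i₀) ⟨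
        ∣ x ℤ.* α i₀ ∣               ≡⟨ cong ∣_∣ ∑αy≡xα₀ ⟨
        ∣ ∑ℤ (λ i → α i ℤ.* y i) ∣
          ≤⟨ ∣∑∣≤ _ _ (λ i → ℕ.≤-reflexive (trans (ℤ.abs-* (α i) (y i)) (cong (_* ∣ y i ∣) (∣α∣≡m i)))) ⟩
        ∑ℕ (λ i → m i * ∣ y i ∣)     ∎
        where open ℕ.≤-Reasoning

      W≢0 : + n 0F ℤ.* D 1F z ≢ + n 1F ℤ.* D 0F z
      W≢0 W≡0 = yⱼ≢0 (trans (sym (z≡y j j≢i₀)) (dependent⇒≡0 z o₀≢o₁ small D₀+D₁≡D₂ W≡0 j j≢i₀))
        where
        j≢i₀ : j ≢ i₀
        j≢i₀ refl = yⱼ≢0 y₀≡0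
        small : ∀ i → i ≢ i₀ → i ≢ i₁ → ∣ z i ∣ < p i
        small i i≢i₀ i≢i₁ = subst (λ a → ∣ a ∣ < p i) (sym (z≡y i i≢i₀)) (ℕ.<-≤-trans (∣y∣<h i) (h≤p i i≢i₀ i≢i₁))

  -- The side at i₁ is not limited by `p i₁`. The bound on `z i₀` stays multiplied by `m i₀`, and
  -- `y` is returned along with `z`, because the two choices of boxes below estimate the sum
  -- differently before dividing.
  independent-solution :
    ∀ {i₀ i₁} (h : Fin w → ℕ) → owner i₀ ≢ owner i₁ → h i₀ ≡ 1 →
    (∀ i → i ≢ i₀ → i ≢ i₁ → h i ≤ p i) → m i₀ < ∏ h →
    ∃₂ λ y z →
      (∀ i → ∣ y i ∣ < h i) × (∀ i → i ≢ i₀ → z i ≡ y i) ×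
      ∣ z i₀ ∣ * m i₀ ≤ ∑ℕ (λ i → m i * ∣ y i ∣) ×
      D 0F z ℤ.+ D 1F z ≡ D 2F z × + n 0F ℤ.* D 1F z ≢ + n 1F ℤ.* D 0F z
  independent-solution {i₀} {i₁} h o₀≢o₁ h₀≡1 h≤p m₀<∏h =
    let y , ∣y∣<h , (j , yⱼ≢0) , m₀∣∑αy = small-combination α h (m i₀) {{m≢0 i₀}} m₀<∏h
        open Correction h o₀≢o₁ h₀≡1 h≤p y ∣y∣<h yⱼ≢0 m₀∣∑αy
    in y , z , ∣y∣<h , z≡y , z₀-bound , D₀+D₁≡D₂ , W≢0

  -- Boxes for small primes and for one large prime

  module _ (n≤c : ∀ k → n k ≤ n 2F) where

    private
      δ : Fin w → ℕ → Fin w → ℕ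
      δ j x i = if does (i Fin.≟ j) then x else 1

      δ-≡ : ∀ j x → δ j x j ≡ x
      δ-≡ j x = cong (if_then x else 1) (dec-true (j Fin.≟ j) refl)

      δ-≢ : ∀ j x {i} → i ≢ j → δ j x i ≡ 1
      δ-≢ j x {i} i≢j = cong (if_then x else 1) (dec-false (i Fin.≟ j) i≢j)

      ∏-δ : ∀ j x → ∏ (δ j x) ≡ x
      ∏-δ j x = trans (sum-only ℕ.*-1-commutativeMonoid (δ j x) j (λ i → δ-≢ j x)) (δ-≡ j x)

      δ-≤ : ∀ j x .{{_ : NonZero x}} i → δ j x i ≤ x
      δ-≤ j x i with i Fin.≟ j
      ... | yes _ = ℕ.≤-refl
      ... | no  _ = ℕ.>-nonZero⁻¹ x

    -- The sides are 1 at i₀, T p at i₁ and p elsewhere, so ∏ h * p i₀ = T * ∏ p exceeds c = m i₀ *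
    -- p i₀. Taking p i₀ from the largest number c also controls the free coordinate: every term m i
    -- * ∣ y i ∣ is at most c T, and c T divided by m i₀ is p i₀ * T.
    smooth-solution : ∀ {i₀ i₁} T M .{{_ : NonZero T}} → owner i₀ ≡ 2F → owner i₁ ≢ 2F →
      (∀ i → p i ≤ M) → n 2F < T * ∏ p →
      ∃[ z ] (∀ i → ∣ z i ∣ ≤ w * (M * T)) ×
        D 0F z ℤ.+ D 1F z ≡ D 2F z × + n 0F ℤ.* D 1F z ≢ + n 1F ℤ.* D 0F z
    smooth-solution {i₀} {i₁} T M o₀≡2 o₁≢2 p≤M c<T∏p =
      let y , z , ∣y∣<h , z≡y , z₀-bound , rel , W≢0 =
            independent-solution h o₀≢o₁ h₀≡1 (λ i i≢i₀ i≢i₁ → ℕ.≤-reflexive (h≡p i i≢i₀ i≢i₁)) m₀<∏h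
      in z , bound y z ∣y∣<h z≡y z₀-bound , rel , W≢0
      where
      open ℕ.≤-Reasoning
      o₀≢o₁ : owner i₀ ≢ owner i₁
      o₀≢o₁ o₀≡o₁ = o₁≢2 (trans (sym o₀≡o₁) o₀≡2)

      g h : Fin w → ℕ
      g i = if does (i Fin.≟ i₀) then 1 else p i
      h i = g i * δ i₁ T i

      h₀≡1 : h i₀ ≡ 1
      h₀≡1 = cong₂ _*_ (cong (if_then 1 else p i₀) (dec-true (i₀ Fin.≟ i₀) refl)) (δ-≢ i₁ T (o₀≢o₁ ∘ cong owner))

      h≡p : ∀ i → i ≢ i₀ → i ≢ i₁ → h i ≡ p i
      h≡p i i≢i₀ i≢i₁ = trans
        (cong₂ _*_ (cong (if_then 1 else p i) (dec-false (i Fin.≟ i₀) i≢i₀)) (δ-≢ i₁ T i≢i₁))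
        (ℕ.*-identityʳ (p i))

      gδ≡p : ∀ i → g i * δ i₀ (p i₀) i ≡ p i
      gδ≡p i with i Fin.≟ i₀
      ... | yes refl = ℕ.*-identityˡ (p i)
      ... | no  _    = ℕ.*-identityʳ (p i)

      ∏h*p₀≡ : ∏ h * p i₀ ≡ T * ∏ p
      ∏h*p₀≡ = begin-equality
        ∏ h * p i₀                              ≡⟨ cong₂ _*_ (Πℕ.∑-distrib-+ g (δ i₁ T)) (sym (∏-δ i₀ (p i₀))) ⟩
        ∏ g * ∏ (δ i₁ T) * ∏ (δ i₀ (p i₀))      ≡⟨ cong (_* ∏ (δ i₀ (p i₀))) (ℕ.*-comm (∏ g) (∏ (δ i₁ T))) ⟩
        ∏ (δ i₁ T) * ∏ g * ∏ (δ i₀ (p i₀))      ≡⟨ ℕ.*-assoc (∏ (δ i₁ T)) (∏ g) (∏ (δ i₀ (p i₀))) ⟩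
        ∏ (δ i₁ T) * (∏ g * ∏ (δ i₀ (p i₀)))
          ≡⟨ cong₂ _*_ (∏-δ i₁ T) (trans (sym (Πℕ.∑-distrib-+ g (δ i₀ (p i₀)))) (Πℕ.sum-cong-≗ gδ≡p)) ⟩
        T * ∏ p                                 ∎

      c≡m₀*p₀ : n 2F ≡ m i₀ * p i₀
      c≡m₀*p₀ = trans (cong n (sym o₀≡2)) (n≡m*p i₀)

      m₀<∏h : m i₀ < ∏ h
      m₀<∏h = ℕ.*-cancelʳ-< (p i₀) (m i₀) (∏ h) (subst₂ _<_ c≡m₀*p₀ (sym ∏h*p₀≡) c<T∏p)

      module _ (y z : Fin w → ℤ) (∣y∣<h : ∀ i → ∣ y i ∣ < h i) (z≡y : ∀ i → i ≢ i₀ → z i ≡ y i)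
        (z₀-bound : ∣ z i₀ ∣ * m i₀ ≤ ∑ℕ (λ i → m i * ∣ y i ∣)) where

        g≤p : ∀ i → g i ≤ p i
        g≤p i with i Fin.≟ i₀
        ... | yes _ = ℕ.>-nonZero⁻¹ (p i) {{prime⇒nonZero (p-prime i)}}
        ... | no  _ = ℕ.≤-refl

        ∣y∣≤pT : ∀ i → ∣ y i ∣ ≤ p i * T
        ∣y∣≤pT i = ℕ.≤-trans (ℕ.<⇒≤ (∣y∣<h i)) (ℕ.*-mono-≤ (g≤p i) (δ-≤ i₁ T i))

        z₀≤ : ∣ z i₀ ∣ ≤ w * (p i₀ * T)
        z₀≤ = ℕ.*-cancelʳ-≤ _ _ (m i₀) {{m≢0 i₀}} (begin
          ∣ z i₀ ∣ * m i₀             ≤⟨ z₀-bound ⟩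
          ∑ℕ (λ i → m i * ∣ y i ∣)    ≤⟨ ∑-≤ _ (n 2F * T) term≤ ⟩
          w * (n 2F * T)              ≡⟨ cong (λ c → w * (c * T)) (trans c≡m₀*p₀ (ℕ.*-comm (m i₀) (p i₀))) ⟩
          w * (p i₀ * m i₀ * T)
            ≡⟨ cong (w *_) (trans (ℕ.*-assoc (p i₀) (m i₀) T) (trans (cong (p i₀ *_) (ℕ.*-comm (m i₀) T)) (sym (ℕ.*-assoc (p i₀) T (m i₀))))) ⟩
          w * (p i₀ * T * m i₀)       ≡⟨ ℕ.*-assoc w (p i₀ * T) (m i₀) ⟨
          w * (p i₀ * T) * m i₀       ∎)
          where
          term≤ : ∀ i → m i * ∣ y i ∣ ≤ n 2F * T
          term≤ i = begin
            m i * ∣ y i ∣         ≤⟨ ℕ.*-monoʳ-≤ (m i) (∣y∣≤pT i) ⟩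
            m i * (p i * T)       ≡⟨ ℕ.*-assoc (m i) (p i) T ⟨
            m i * p i * T         ≡⟨ cong (_* T) (n≡m*p i) ⟨
            n (owner i) * T       ≤⟨ ℕ.*-monoˡ-≤ T (n≤c (owner i)) ⟩
            n 2F * T              ∎

        w≢0 : NonZero w
        w≢0 = Fin.nonZeroIndex i₀

        bound : ∀ i → ∣ z i ∣ ≤ w * (M * T)
        bound i with i Fin.≟ i₀
        ... | yes refl = ℕ.≤-trans z₀≤ (ℕ.*-monoʳ-≤ w (ℕ.*-monoˡ-≤ T (p≤M i)))
        ... | no  i≢i₀ = ℕ.≤-trans (ℕ.≤-reflexive (cong ∣_∣ (z≡y i i≢i₀))) (ℕ.≤-trans (∣y∣≤pT i)
                           (ℕ.≤-trans (ℕ.*-monoˡ-≤ T (p≤M i)) (ℕ.m≤n*m (M * T) w {{w≢0}})))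

    -- Only the sides at q and i₁ differ from 1; they are s + 1, so the box has more than c points
    -- and `y` lives on two coordinates. The hypothesis `s < p q` keeps the side at q admissible,
    -- and `m i₁ ≤ m i₀` ensures that the i₁-term contributes at most s to the free coordinate.
    large-prime-solution : ∀ {q i₀ i₁} s → i₀ ≢ q → i₁ ≢ q → owner i₀ ≢ owner i₁ → m i₁ ≤ m i₀ →
      s < p q → n 2F < suc s * suc s →
      ∃[ z ] (∀ i → ∣ z i ∣ ≤ m q * s ℕ.+ s) ×
        D 0F z ℤ.+ D 1F z ≡ D 2F z × + n 0F ℤ.* D 1F z ≢ + n 1F ℤ.* D 0F z
    large-prime-solution {q} {i₀} {i₁} s i₀≢q i₁≢q o₀≢o₁ m₁≤m₀ s<q c<s² =
      let y , z , ∣y∣<h , z≡y , z₀-bound , rel , W≢0 = independent-solution h o₀≢o₁ h₀≡1 h≤p m₀<∏h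
      in z , bound y z ∣y∣<h z≡y z₀-bound , rel , W≢0
      where
      open ℕ.≤-Reasoning
      h : Fin w → ℕ
      h i = δ q (suc s) i * δ i₁ (suc s) i

      h₀≡1 : h i₀ ≡ 1
      h₀≡1 = cong₂ _*_ (δ-≢ q (suc s) i₀≢q) (δ-≢ i₁ (suc s) (o₀≢o₁ ∘ cong owner))

      h≤p : ∀ i → i ≢ i₀ → i ≢ i₁ → h i ≤ p i
      h≤p i _ i≢i₁ with i Fin.≟ q
      ... | yes refl = subst (_≤ p q)
        (sym (trans (cong (suc s *_) (δ-≢ i₁ (suc s) i≢i₁)) (ℕ.*-identityʳ (suc s)))) s<q
      ... | no  _    = subst (_≤ p i)
        (sym (trans (ℕ.*-identityˡ _) (δ-≢ i₁ (suc s) i≢i₁)))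
        (ℕ.>-nonZero⁻¹ (p i) {{prime⇒nonZero (p-prime i)}})

      m₀<∏h : m i₀ < ∏ h
      m₀<∏h = begin-strict
        m i₀                                    ≤⟨ ℕ.m≤m*n (m i₀) (p i₀) {{prime⇒nonZero (p-prime i₀)}} ⟩
        m i₀ * p i₀                             ≡⟨ n≡m*p i₀ ⟨
        n (owner i₀)                            ≤⟨ n≤c (owner i₀) ⟩
        n 2F                                    <⟨ c<s² ⟩
        suc s * suc s                           ≡⟨ cong₂ _*_ (∏-δ q (suc s)) (∏-δ i₁ (suc s)) ⟨
        ∏ (δ q (suc s)) * ∏ (δ i₁ (suc s))      ≡⟨ Πℕ.∑-distrib-+ (δ q (suc s)) (δ i₁ (suc s)) ⟨
        ∏ h                                     ∎

      module _ (y z : Fin w → ℤ) (∣y∣<h : ∀ i → ∣ y i ∣ < h i) (z≡y : ∀ i → i ≢ i₀ → z i ≡ y i)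
        (z₀-bound : ∣ z i₀ ∣ * m i₀ ≤ ∑ℕ (λ i → m i * ∣ y i ∣)) where

        η : Fin w → ℕ → Fin w → ℕ
        η j x i = if does (i Fin.≟ j) then x else 0

        ∑-η : ∀ j x → ∑ℕ (η j x) ≡ x
        ∑-η j x = trans
          (sum-only ℕ.+-0-commutativeMonoid (η j x) j (λ i i≢j → cong (if_then x else 0) (dec-false (i Fin.≟ j) i≢j)))
          (cong (if_then x else 0) (dec-true (j Fin.≟ j) refl))

        ∣y∣≤ : ∀ i → ∣ y i ∣ ≤ η q s i ℕ.+ η i₁ s i
        ∣y∣≤ i = ℕ.≤-pred (ℕ.≤-trans (∣y∣<h i) h≤)
          where
          h≤ : h i ≤ suc (η q s i ℕ.+ η i₁ s i)
          h≤ with i Fin.≟ q | i Fin.≟ i₁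
          ... | yes i≡q | yes i≡i₁ = contradiction (trans (sym i≡i₁) i≡q) i₁≢q
          ... | yes _   | no  _    = ℕ.≤-reflexive (trans (ℕ.*-identityʳ (suc s)) (cong suc (sym (ℕ.+-identityʳ s))))
          ... | no  _   | yes _    = ℕ.≤-reflexive (ℕ.*-identityˡ (suc s))
          ... | no  _   | no  _    = ℕ.≤-refl

        z₀≤ : ∣ z i₀ ∣ ≤ m q * s ℕ.+ s
        z₀≤ = ℕ.*-cancelʳ-≤ _ _ (m i₀) {{m≢0 i₀}} (begin
          ∣ z i₀ ∣ * m i₀                                      ≤⟨ z₀-bound ⟩
          ∑ℕ (λ i → m i * ∣ y i ∣)                             ≤⟨ ∑-mono _ _ term≤ ⟩
          ∑ℕ (λ i → η q (m q * s) i ℕ.+ η i₁ (m i₁ * s) i)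
            ≡⟨ Σℕ.∑-distrib-+ (η q (m q * s)) (η i₁ (m i₁ * s)) ⟩
          ∑ℕ (η q (m q * s)) ℕ.+ ∑ℕ (η i₁ (m i₁ * s))
            ≡⟨ cong₂ ℕ._+_ (∑-η q (m q * s)) (∑-η i₁ (m i₁ * s)) ⟩
          m q * s ℕ.+ m i₁ * s
            ≤⟨ ℕ.+-mono-≤ (ℕ.m≤m*n (m q * s) (m i₀) {{m≢0 i₀}}) (ℕ.≤-trans (ℕ.*-monoˡ-≤ s m₁≤m₀) (ℕ.≤-reflexive (ℕ.*-comm (m i₀) s))) ⟩
          m q * s * m i₀ ℕ.+ s * m i₀                          ≡⟨ ℕ.*-distribʳ-+ (m i₀) (m q * s) s ⟨
          (m q * s ℕ.+ s) * m i₀                               ∎)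
          where
          *-η : ∀ j i → m i * η j s i ≡ η j (m j * s) i
          *-η j i with i Fin.≟ j
          ... | yes refl = refl
          ... | no  _    = ℕ.*-zeroʳ (m i)
          term≤ : ∀ i → m i * ∣ y i ∣ ≤ η q (m q * s) i ℕ.+ η i₁ (m i₁ * s) i
          term≤ i = begin
            m i * ∣ y i ∣                           ≤⟨ ℕ.*-monoʳ-≤ (m i) (∣y∣≤ i) ⟩
            m i * (η q s i ℕ.+ η i₁ s i)            ≡⟨ ℕ.*-distribˡ-+ (m i) (η q s i) (η i₁ s i) ⟩
            m i * η q s i ℕ.+ m i * η i₁ s i        ≡⟨ cong₂ ℕ._+_ (*-η q i) (*-η i₁ i) ⟩
            η q (m q * s) i ℕ.+ η i₁ (m i₁ * s) i   ∎

        bound : ∀ i → ∣ z i ∣ ≤ m q * s ℕ.+ s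
        bound i with i Fin.≟ i₀
        ... | yes refl = z₀≤
        ... | no  i≢i₀ = ℕ.≤-trans (ℕ.≤-reflexive (cong ∣_∣ (z≡y i i≢i₀))) (ℕ.≤-trans (∣y∣≤ i) η≤)
          where
          η≤ : η q s i ℕ.+ η i₁ s i ≤ m q * s ℕ.+ s
          η≤ = ℕ.+-mono-≤ (ℕ.≤-trans (η-≤ q) (ℕ.m≤n*m s (m q) {{m≢0 q}})) (η-≤ i₁)
            where
            η-≤ : ∀ j → η j s i ≤ s
            η-≤ j with i Fin.≟ j
            ... | yes _ = ℕ.≤-refl
            ... | no  _ = ℕ.z≤n

    prime-of : ∀ {k} → n k ≢ 1 → ∃[ i ] owner i ≡ k
    prime-of {k} nk≢1 =
      let r , r-prime , r∣nk = prime-divisor (ℕ.≢-nonZero⁻¹ (n k) {{n≢0 k}}) nk≢1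
          i , _ , oᵢ≡k = p-complete k r-prime r∣nk
      in i , oᵢ≡k

    module _ (2<c : 2 < n 2F) where

      private
        c≢1 : n 2F ≢ 1
        c≢1 c≡1 = ℕ.<⇒≱ 2<c (ℕ.≤-trans (ℕ.≤-reflexive c≡1) (ℕ.s≤s ℕ.z≤n))

        at-most-one-1 : ∀ {k l} → n k ≡ 1 → n l ≡ 1 → k ≡ l
        at-most-one-1 {0F} {0F} _ _ = refl
        at-most-one-1 {1F} {1F} _ _ = refl
        at-most-one-1 {0F} {1F} a≡1 b≡1 = contradiction (trans (sym n₀+n₁≡n₂) (cong₂ ℕ._+_ a≡1 b≡1)) (ℕ.>⇒≢ 2<c)
        at-most-one-1 {1F} {0F} b≡1 a≡1 = contradiction (trans (sym n₀+n₁≡n₂) (cong₂ ℕ._+_ a≡1 b≡1)) (ℕ.>⇒≢ 2<c)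
        at-most-one-1 {2F} c≡1 _ = contradiction c≡1 c≢1
        at-most-one-1 {_} {2F} _ c≡1 = contradiction c≡1 c≢1

        -- A prime factor of `m q` is at most `m q`, hence smaller than `p q`: it is a second prime
        -- of the same number.
        cofactor-prime : ∀ q → m q < p q → m q ≢ 1 → ∃[ i ] i ≢ q × owner i ≡ owner q
        cofactor-prime q mq<pq mq≢1 =
          let r , r-prime , r∣mq = prime-divisor (ℕ.≢-nonZero⁻¹ (m q) {{m≢0 q}}) mq≢1
              i , pᵢ≡r , oᵢ≡o = p-complete (owner q) r-prime (∣-trans r∣mq (quotient-∣ (p∣n q)))
          in i , (λ i≡q → ℕ.<⇒≱ mq<pq (subst (_≤ m q) (trans (sym pᵢ≡r) (cong p i≡q)) (∣⇒≤ {{m≢0 q}} r∣mq))) , oᵢ≡o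

      -- If neither of the other two numbers is 1, each supplies a prime. If one of them is 1, the
      -- other supplies a prime, and the number containing q is not q itself, so its cofactor
      -- supplies the second one. Both cannot be 1, as c exceeds 2.
      distinct-owners : ∀ q → m q < p q → (∀ l → l ≢ owner q → m q ≡ 1 → n l ≢ 1) →
                        ∃₂ λ i j → i ≢ q × j ≢ q × owner i ≢ owner j
      distinct-owners q mq<pq not-1Nq with third (owner q) (owner q)
      ... | l , l≢o , _ with third (owner q) l
      ...   | l′ , l′≢o , l′≢l = choose (n l ℕ.≟ 1) (n l′ ℕ.≟ 1)
        where
        via-cofactor : ∀ {k l} → k ≢ owner q → n k ≡ 1 → l ≢ owner q → n l ≢ 1 →
                       ∃₂ λ i j → i ≢ q × j ≢ q × owner i ≢ owner j
        via-cofactor k≢o nk≡1 l≢o nl≢1 =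
          let i , i≢q , oᵢ≡o = cofactor-prime q mq<pq (λ mq≡1 → not-1Nq _ k≢o mq≡1 nk≡1)
              j , oⱼ≡l = prime-of nl≢1
          in i , j , i≢q , (λ j≡q → l≢o (trans (sym oⱼ≡l) (cong owner j≡q))) ,
             λ oᵢ≡oⱼ → l≢o (trans (sym oⱼ≡l) (trans (sym oᵢ≡oⱼ) oᵢ≡o))

        choose : Dec (n l ≡ 1) → Dec (n l′ ≡ 1) → ∃₂ λ i j → i ≢ q × j ≢ q × owner i ≢ owner j
        choose (no nl≢1)  (no nl′≢1)  =
          let i , oᵢ≡l = prime-of nl≢1 ; j , oⱼ≡l′ = prime-of nl′≢1 in
          i , j , (λ i≡q → l≢o (trans (sym oᵢ≡l) (cong owner i≡q))) ,
          (λ j≡q → l′≢o (trans (sym oⱼ≡l′) (cong owner j≡q))) ,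
          λ oᵢ≡oⱼ → l′≢l (trans (sym oⱼ≡l′) (trans (sym oᵢ≡oⱼ) oᵢ≡l))
        choose (yes nl≡1) (no nl′≢1)  = via-cofactor l≢o nl≡1 l′≢o nl′≢1
        choose (no nl≢1)  (yes nl′≡1) = via-cofactor l′≢o nl′≡1 l≢o nl≢1
        choose (yes nl≡1) (yes nl′≡1) = contradiction (at-most-one-1 nl′≡1 nl≡1) l′≢l

      -- Below, M is the integer part of c ^ (3 / 4).

      module _ {M} (c³<[1+M]^4 : n 2F ^ 3 < suc M ^ 4) where

        large-prime-case : ∀ q s → s ^ 2 ≤ n 2F → n 2F < suc s ^ 2 →
          M < p q → (∀ i l → l ≢ owner i → m i ≡ 1 → n l ≢ 1) →
          ∃[ z ] (∀ i → ∣ z i ∣ ≤ 2 * M) ×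
            D 0F z ℤ.+ D 1F z ≡ D 2F z × + n 0F ℤ.* D 1F z ≢ + n 1F ℤ.* D 0F z
        large-prime-case q s s²≤c c<[1+s]² M<q not-1Nq =
          let s<pq , mq<pq , mqs≤M =
                large-divisor-bounds (n 2F) (m q) (p q) s M {{n≢0 2F}} mq*pq≤c s²≤c c³<[1+M]^4 M<q
              i , j , i≢q , j≢q , oᵢ≢oⱼ = distinct-owners q mq<pq (not-1Nq q)
          in from s<pq mqs≤M i j i≢q j≢q oᵢ≢oⱼ (ℕ.≤-total (m i) (m j))
          where
          mq*pq≤c : m q * p q ≤ n 2F
          mq*pq≤c = subst (_≤ n 2F) (n≡m*p q) (n≤c (owner q))

          c<[1+s]*[1+s] : n 2F < suc s * suc s
          c<[1+s]*[1+s] = subst (n 2F <_) (cong (suc s *_) (ℕ.*-identityʳ (suc s))) c<[1+s]²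

          from : s < p q → m q * s ≤ M → ∀ i j → i ≢ q → j ≢ q → owner i ≢ owner j → m i ≤ m j ⊎ m j ≤ m i →
            ∃[ z ] (∀ i → ∣ z i ∣ ≤ 2 * M) ×
              D 0F z ℤ.+ D 1F z ≡ D 2F z × + n 0F ℤ.* D 1F z ≢ + n 1F ℤ.* D 0F z
          from s<pq mqs≤M i j i≢q j≢q oᵢ≢oⱼ (inj₂ mⱼ≤mᵢ) =
            let z , ∣z∣≤ , rel , W≢0 = large-prime-solution {q} {i} {j} s i≢q j≢q oᵢ≢oⱼ mⱼ≤mᵢ s<pq c<[1+s]*[1+s]
            in z , (λ i → ℕ.≤-trans (∣z∣≤ i) (ℕ.+-mono-≤ mqs≤M (ℕ.≤-trans s≤M (ℕ.m≤m+n M 0)))) , rel , W≢0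
            where
            s≤M : s ≤ M
            s≤M = ℕ.≤-trans (ℕ.m≤n*m s (m q) {{m≢0 q}}) mqs≤M
          -- The roles are exchanged so that the free coordinate is the one with the larger
          -- cofactor.
          from s<pq mqs≤M i j i≢q j≢q oᵢ≢oⱼ (inj₁ mᵢ≤mⱼ) =
            from s<pq mqs≤M j i j≢q i≢q (oᵢ≢oⱼ ∘ sym) (inj₂ mᵢ≤mⱼ)

        -- The common bound covers w M T, from the case of small primes, as well as 2 M, from the
        -- case of a large prime.
        small-solution : ∀ T .{{_ : NonZero T}} → n 2F < T * ∏ p →
          (∀ i l → l ≢ owner i → m i ≡ 1 → n l ≢ 1) →
          ∃[ z ] (∀ i → ∣ z i ∣ ≤ 2 * (w * (M * T))) ×
            D 0F z ℤ.+ D 1F z ≡ D 2F z × + n 0F ℤ.* D 1F z ≢ + n 1F ℤ.* D 0F z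
        small-solution T c<T∏p not-1Nq = by-cases (Fin.all? (λ i → p i ℕ.≤? M))
          where
          prime-of-summand : Dec (n 0F ≡ 1) → ∃[ i ] owner i ≢ 2F
          prime-of-summand (no  a≢1) = let i , oᵢ≡0 = prime-of a≢1 in
            i , λ oᵢ≡2 → contradiction (trans (sym oᵢ≡0) oᵢ≡2) λ ()
          prime-of-summand (yes a≡1) =
            let i , oᵢ≡1 = prime-of (λ b≡1 → contradiction (at-most-one-1 {0F} {1F} a≡1 b≡1) λ ()) in
            i , λ oᵢ≡2 → contradiction (trans (sym oᵢ≡1) oᵢ≡2) λ ()

          by-cases : Dec (∀ i → p i ≤ M) →
            ∃[ z ] (∀ i → ∣ z i ∣ ≤ 2 * (w * (M * T))) ×
              D 0F z ℤ.+ D 1F z ≡ D 2F z × + n 0F ℤ.* D 1F z ≢ + n 1F ℤ.* D 0F z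
          by-cases (yes p≤M) =
            let i₀ , o₀≡2 = prime-of c≢1
                i₁ , o₁≢2 = prime-of-summand (n 0F ℕ.≟ 1)
                z , ∣z∣≤ , rel , W≢0 = smooth-solution {i₀} {i₁} T M o₀≡2 o₁≢2 p≤M c<T∏p
            in z , (λ i → ℕ.≤-trans (∣z∣≤ i) (ℕ.m≤n*m _ 2)) , rel , W≢0
          by-cases (no ¬p≤M) =
            let q , pq≰M = Fin.¬∀⟶∃¬ w (λ i → p i ≤ M) (λ i → p i ℕ.≤? M) ¬p≤M
                s , s²≤c , c<[1+s]² = floor-root 2 (n 2F)
                z , ∣z∣≤ , rel , W≢0 = large-prime-case q s s²≤c c<[1+s]² (ℕ.≰⇒> pq≰M) not-1Nq
                w≢0 = Fin.nonZeroIndex q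
            in z , (λ i → ℕ.≤-trans (∣z∣≤ i)
                 (ℕ.*-monoʳ-≤ 2 (ℕ.≤-trans (ℕ.m≤m*n M T) (ℕ.m≤n*m (M * T) w {{w≢0}})))) , rel , W≢0

-- Valuations, prime divisors and linear functionals

largest-satisfies : ∀ {P : Pred ℕ 0ℓ} (P? : Decidable P) → P 0 → ∀ b → P (largest P? b)
largest-satisfies P? P0 zero    = P0
largest-satisfies P? P0 (suc b) with P? (suc b)
... | yes Pb = Pb
... | no  _  = largest-satisfies P? P0 b

≤-largest : ∀ {P : Pred ℕ 0ℓ} (P? : Decidable P) b {k} → P k → k ≤ b → k ≤ largest P? b
≤-largest P? zero    Pk k≤0 = k≤0
≤-largest P? (suc b) {k} Pk k≤1+b with P? (suc b)
... | yes _ = k≤1+b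
... | no ¬P = ≤-largest P? b Pk (ℕ.≤-pred (ℕ.≤∧≢⇒< k≤1+b λ { refl → ¬P Pk }))

^-valuation∣ : ∀ p n → p ^ valuation p n ∣ n
^-valuation∣ p n = largest-satisfies (λ k → p ^ k ∣? n) (1∣ n) n

valuation>0 : ∀ {p} n .{{_ : NonZero n}} → p ∣ n → 0 < valuation p n
valuation>0 {p} n p∣n = ≤-largest (λ k → p ^ k ∣? n) n
  (subst (_∣ n) (sym (ℕ.*-identityʳ p)) p∣n) (ℕ.>-nonZero⁻¹ n)

∤⇒valuation≡0 : ∀ {p n} → ¬ p ∣ n → valuation p n ≡ 0
∤⇒valuation≡0 {p} {n} p∤n = largest≡0 (λ k → p ^ k ∣? n) n λ where
  (suc k) _ p^k∣n → p∤n (∣-trans (m∣m*n (p ^ k)) p^k∣n)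

lookup-injective : ∀ {xs : List ℕ} → Unique xs → ∀ i j → lookup xs i ≡ lookup xs j → i ≡ j
lookup-injective (_ ∷ _)     zero    zero    _  = refl
lookup-injective (x∉xs ∷ _)  zero    (suc j) eq = contradiction eq (All.lookup x∉xs (∈-lookup j))
lookup-injective (x∉xs ∷ _)  (suc i) zero    eq = contradiction (sym eq) (All.lookup x∉xs (∈-lookup i))
lookup-injective (_ ∷ xs!)   (suc i) (suc j) eq = cong suc (lookup-injective xs! i j eq)

module _ (N : ℕ) .{{_ : NonZero N}} where

  private
    prime-divisor? : Decidable (λ p → Prime p × p ∣ N)
    prime-divisor? p = prime? p ×-dec (p ∣? N)

  primeDivisor : Fin (length (primeDivisors N)) → ℕ
  primeDivisor = lookup (primeDivisors N)

  primeDivisor-prime : ∀ i → Prime (primeDivisor i)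
  primeDivisor-prime i = proj₁ (proj₂ (∈-filter⁻ prime-divisor? {xs = upTo (suc N)} (∈-lookup i)))

  primeDivisor-∣ : ∀ i → primeDivisor i ∣ N
  primeDivisor-∣ i = proj₂ (proj₂ (∈-filter⁻ prime-divisor? {xs = upTo (suc N)} (∈-lookup i)))

  primeDivisor-injective : ∀ {i j} → primeDivisor i ≡ primeDivisor j → i ≡ j
  primeDivisor-injective = lookup-injective (Unique.filter⁺ prime-divisor? (Unique.upTo⁺ (suc N))) _ _

  primeDivisor-complete : ∀ {p} → Prime p → p ∣ N → ∃[ i ] primeDivisor i ≡ p
  primeDivisor-complete p-prime p∣N =
    let p∈ = ∈-filter⁺ prime-divisor? (∈-upTo⁺ (ℕ.s≤s (∣⇒≤ p∣N))) (p-prime , p∣N)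
    in Any.index p∈ , sym (Any.lookup-index p∈)

∏-lookup : ∀ xs → ∏ (lookup xs) ≡ product xs
∏-lookup []       = refl
∏-lookup (x ∷ xs) = cong (x *_) (∏-lookup xs)

value-injective : ∀ {p q : ℙ} → value p ≡ value q → p ≡ q
value-injective {mkℙ _ _} {mkℙ _ _} refl = refl

-- Functionals with prescribed values, and expansion in the `ξ`

module _ {w} (P : Fin w → ℙ) (P-injective : ∀ {i j} → value (P i) ≡ value (P j) → i ≡ j) where

  coeff-ξ-≡ : ∀ {q} i → value q ≡ value (P i) → coeff (ξ q) (P i) ≡ 1ℤ
  coeff-ξ-≡ {q} i eq = cong (if_then 1ℤ else 0ℤ) (dec-true (value q ℕ.≟ value (P i)) eq)

  coeff-ξ-≢ : ∀ {q} i → value q ≢ value (P i) → coeff (ξ q) (P i) ≡ 0ℤ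
  coeff-ξ-≢ {q} i neq = cong (if_then 1ℤ else 0ℤ) (dec-false (value q ℕ.≟ value (P i)) neq)

  module _ (c : Fin w → ℤ) where

    private
      eval : Ω → ℤ
      eval x = ∑ℤ (λ i → coeff x (P i) ℤ.* c i)

      eval-+ : ∀ x y → eval (LeftModule._+ᴹ_ Ω-leftModule x y) ≡ eval x ℤ.+ eval y
      eval-+ x y = trans
        (Σℤ.sum-cong-≗ (λ i → ℤ.*-distribʳ-+ (c i) (coeff x (P i)) (coeff y (P i))))
        (Σℤ.∑-distrib-+ (λ i → coeff x (P i) ℤ.* c i) (λ i → coeff y (P i) ℤ.* c i))

      eval-* : ∀ k x → eval (LeftModule._*ₗ_ Ω-leftModule k x) ≡ k ℤ.* eval x
      eval-* k x = trans
        (Σℤ.sum-cong-≗ (λ i → ℤ.*-assoc k (coeff x (P i)) (c i)))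
        (sym (Σℤ.*-distribˡ-sum k (λ i → coeff x (P i) ℤ.* c i)))

      eval-cong : ∀ {x y} → LeftModule._≈ᴹ_ Ω-leftModule x y → eval x ≡ eval y
      eval-cong x≈y = Σℤ.sum-cong-≗ (λ i → cong (ℤ._* c i) (x≈y (P i)))

      eval-0 : eval (LeftModule.0ᴹ Ω-leftModule) ≡ 0ℤ
      eval-0 = Σℤ.sum-replicate-zero w

      eval-neg : ∀ x → eval (LeftModule.-ᴹ_ Ω-leftModule x) ≡ ℤ.- eval x
      eval-neg x = trans
        (eval-cong {LeftModule.-ᴹ_ Ω-leftModule x} {LeftModule._*ₗ_ Ω-leftModule ℤ.-1ℤ x}
          (λ p → sym (ℤ.-1*i≡-i (coeff x p))))
        (trans (eval-* ℤ.-1ℤ x) (ℤ.-1*i≡-i (eval x)))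

      eval-isLinear : IsLeftModuleHomomorphism eval
      eval-isLinear = record
        { +ᴹ-isGroupHomomorphism = record
          { isMonoidHomomorphism = record
            { isMagmaHomomorphism = record
              { isRelHomomorphism = record { cong = λ {x} {y} → eval-cong {x} {y} }
              ; homo = eval-+
              }
            ; ε-homo = eval-0
            }
          ; ⁻¹-homo = eval-neg
          }
        ; *ₗ-homo = eval-*
        }

      eval-ξ-∈ : ∀ q j → value q ≡ value (P j) → eval (ξ q) ≡ c j
      eval-ξ-∈ q j q≡Pj = trans
        (sum-only ℤ.+-0-commutativeMonoid (λ i → coeff (ξ q) (P i) ℤ.* c i) j λ i i≢j →
          cong (ℤ._* c i) (coeff-ξ-≢ {q} i λ q≡Pi → i≢j (P-injective (trans (sym q≡Pi) q≡Pj))))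
        (trans (cong (ℤ._* c j) (coeff-ξ-≡ {q} j q≡Pj)) (ℤ.*-identityˡ (c j)))

      eval-ξ-∉ : ∀ q → (∀ i → value q ≢ value (P i)) → eval (ξ q) ≡ 0ℤ
      eval-ξ-∉ q q≢P = trans
        (Σℤ.sum-cong-≗ (λ i → cong (ℤ._* c i) (coeff-ξ-≢ {q} i (q≢P i))))
        (Σℤ.sum-replicate-zero w)

      index? : ∀ q → Dec (∃[ i ] value q ≡ value (P i))
      index? q = Fin.any? (λ i → value q ℕ.≟ value (P i))

    module _ {B} (c≤B : ∀ i → ∣ c i ∣ ≤ B) where

      private
        eval-ξ-≤ : ∀ q → ∣ eval (ξ q) ∣ ≤ B
        eval-ξ-≤ q with index? q
        ... | yes (i , q≡Pi) = subst (λ x → ∣ x ∣ ≤ B) (sym (eval-ξ-∈ q i q≡Pi)) (c≤B i)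
        ... | no  ∄i = subst (λ x → ∣ x ∣ ≤ B) (sym (eval-ξ-∉ q (λ i q≡Pi → ∄i (i , q≡Pi)))) ℕ.z≤n

      functional : 𝒯
      functional = record { ⟦_⟧ = eval ; isLinear = eval-isLinear ; normFinite = B , eval-ξ-≤ }

      functional-≤ : ∀ q → ∣ ⟦ functional ⟧ (ξ q) ∣ ≤ B
      functional-≤ = eval-ξ-≤

      functional-supp : ∀ {q} → supp𝒯 functional q → ∃[ i ] value q ≡ value (P i)
      functional-supp {q} ψξ≢0 with index? q
      ... | yes i∈ = i∈
      ... | no  ∄i = contradiction (eval-ξ-∉ q (λ i q≡Pi → ∄i (i , q≡Pi))) ψξ≢0

  module _ (ψ : 𝒯) where

    private
      module ψ = IsLeftModuleHomomorphism (isLinear ψ)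

    -- Coefficientwise, `x` is the finite combination of the `ξ (P i)` with its own coefficients,
    -- and linearity does the rest. This makes an arbitrary ψ computable on `d n`, not only one
    -- built by `functional`.
    ⟦⟧-expand : ∀ x → (∀ q → (∀ i → value q ≢ value (P i)) → coeff x q ≡ 0ℤ) →
                ⟦ ψ ⟧ x ≡ ∑ℤ (λ i → coeff x (P i) ℤ.* ⟦ ψ ⟧ (ξ (P i)))
    ⟦⟧-expand x x-supp = trans (ψ.⟦⟧-cong x≈) (⟦⟧-∑ P (coeff x ∘ P))
      where
      ∑Ω : ∀ {w} → (Fin w → ℙ) → (Fin w → ℤ) → Ω
      ∑Ω {zero}  P a = LeftModule.0ᴹ Ω-leftModule
      ∑Ω {suc w} P a = LeftModule._+ᴹ_ Ω-leftModule
        (LeftModule._*ₗ_ Ω-leftModule (a 0F) (ξ (P 0F)))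
        (∑Ω (P ∘ suc) (a ∘ suc))

      coeff-∑Ω : ∀ {w} (P : Fin w → ℙ) a q → coeff (∑Ω P a) q ≡ ∑ℤ (λ i → a i ℤ.* coeff (ξ (P i)) q)
      coeff-∑Ω {zero}  P a q = refl
      coeff-∑Ω {suc w} P a q = cong (λ t → a 0F ℤ.* coeff (ξ (P 0F)) q ℤ.+ t) (coeff-∑Ω (P ∘ suc) (a ∘ suc) q)

      ⟦⟧-∑ : ∀ {w} (P : Fin w → ℙ) a → ⟦ ψ ⟧ (∑Ω P a) ≡ ∑ℤ (λ i → a i ℤ.* ⟦ ψ ⟧ (ξ (P i)))
      ⟦⟧-∑ {zero}  P a = ψ.0ᴹ-homo
      ⟦⟧-∑ {suc w} P a = trans (ψ.+ᴹ-homo _ _) (cong₂ ℤ._+_ (ψ.*ₗ-homo (a 0F) (ξ (P 0F))) (⟦⟧-∑ (P ∘ suc) (a ∘ suc)))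

      δ-≢ : ∀ q i → value q ≢ value (P i) → coeff x (P i) ℤ.* coeff (ξ (P i)) q ≡ 0ℤ
      δ-≢ q i q≢Pi = trans
        (cong (λ b → coeff x (P i) ℤ.* (if b then 1ℤ else 0ℤ)) (dec-false (value (P i) ℕ.≟ value q) (q≢Pi ∘ sym)))
        (ℤ.*-zeroʳ (coeff x (P i)))

      x≈ : ∀ q → coeff x q ≡ coeff (∑Ω P (coeff x ∘ P)) q
      x≈ q with Fin.any? (λ i → value q ℕ.≟ value (P i))
      ... | no ∄i = trans (x-supp q (λ i q≡Pi → ∄i (i , q≡Pi))) (sym (trans (coeff-∑Ω P (coeff x ∘ P) q)
        (trans (Σℤ.sum-cong-≗ (λ i → δ-≢ q i (λ q≡Pi → ∄i (i , q≡Pi)))) (Σℤ.sum-replicate-zero w))))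
      ... | yes (j , q≡Pj) = sym (begin
        coeff (∑Ω P (coeff x ∘ P)) q
          ≡⟨ coeff-∑Ω P (coeff x ∘ P) q ⟩
        ∑ℤ (λ i → coeff x (P i) ℤ.* coeff (ξ (P i)) q)
          ≡⟨ sum-only ℤ.+-0-commutativeMonoid _ j (λ i i≢j → δ-≢ q i λ q≡Pi → i≢j (P-injective (trans (sym q≡Pi) q≡Pj))) ⟩
        coeff x (P j) ℤ.* coeff (ξ (P j)) q
          ≡⟨ cong (λ b → coeff x (P j) ℤ.* (if b then 1ℤ else 0ℤ)) (dec-true (value (P j) ℕ.≟ value q) (sym q≡Pj)) ⟩
        coeff x (P j) ℤ.* 1ℤ
          ≡⟨ ℤ.*-identityʳ (coeff x (P j)) ⟩
        coeff x (P j)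
          ≡⟨ cong (coeff x) (value-injective q≡Pj) ⟨
        coeff x q ∎)
        where open ≡-Reasoning

-- Bounds for the exponents in a factorisation

^-comm : ∀ x m n → (x ^ m) ^ n ≡ (x ^ n) ^ m
^-comm x m n = trans (ℕ.^-*-assoc x m n) (trans (cong (x ^_) (ℕ.*-comm m n)) (sym (ℕ.^-*-assoc x n m)))

n<2^n : ∀ n → n < 2 ^ n
n<2^n zero    = ℕ.s≤s ℕ.z≤n
n<2^n (suc n) = ℕ.≤-trans (ℕ.+-mono-≤ (ℕ.m^n>0 2 n) (n<2^n n))
  (ℕ.≤-reflexive (cong (2 ^ n ℕ.+_) (sym (ℕ.+-identityʳ (2 ^ n)))))

-- Write x = r + q E with r < E; then x < E (1 + q) ≤ E 2 ^ q.

x^E≤E^E*2^x : ∀ E .{{_ : NonZero E}} x → x ^ E ≤ E ^ E * 2 ^ x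
x^E≤E^E*2^x E x = begin
  x ^ E                  ≤⟨ ℕ.^-monoˡ-≤ E x≤E*2^q ⟩
  (E * 2 ^ q) ^ E        ≡⟨ ^-distrib-* E (2 ^ q) E ⟩
  E ^ E * (2 ^ q) ^ E    ≡⟨ cong (E ^ E *_) (ℕ.^-*-assoc 2 q E) ⟩
  E ^ E * 2 ^ (q * E)    ≤⟨ ℕ.*-monoʳ-≤ (E ^ E) (ℕ.^-monoʳ-≤ 2 (ℕ.m/n*n≤m x E)) ⟩
  E ^ E * 2 ^ x          ∎
  where
  open ℕ.≤-Reasoning
  q = x ℕ./ E
  x≤E*2^q : x ≤ E * 2 ^ q
  x≤E*2^q = begin
    x                    ≡⟨ ℕ.m≡m%n+[m/n]*n x E ⟩
    x ℕ.% E ℕ.+ q * E    ≤⟨ ℕ.+-monoˡ-≤ (q * E) (ℕ.m%n≤n x E) ⟩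
    suc q * E            ≤⟨ ℕ.*-monoˡ-≤ E (n<2^n q) ⟩
    2 ^ q * E            ≡⟨ ℕ.*-comm (2 ^ q) E ⟩
    E * 2 ^ q            ∎

∏-mono : ∀ {w} (t u : Fin w → ℕ) → (∀ i → t i ≤ u i) → ∏ t ≤ ∏ u
∏-mono {zero}  t u t≤u = ℕ.≤-refl
∏-mono {suc _} t u t≤u = ℕ.*-mono-≤ (t≤u zero) (∏-mono (t ∘ suc) (u ∘ suc) (t≤u ∘ suc))

∏-^ : ∀ {w} (t : Fin w → ℕ) E → ∏ t ^ E ≡ ∏ (λ i → t i ^ E)
∏-^ {zero}  t E = ℕ.^-zeroˡ E
∏-^ {suc _} t E = trans (^-distrib-* (t zero) (∏ (t ∘ suc)) E) (cong (t zero ^ E *_) (∏-^ (t ∘ suc) E))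

^-∑ : ∀ {w} x (t : Fin w → ℕ) → x ^ ∑ℕ t ≡ ∏ (λ i → x ^ t i)
^-∑ {zero}  x t = refl
^-∑ {suc _} x t = trans (ℕ.^-distribˡ-+-* x (t zero) (∑ℕ (t ∘ suc))) (cong (x ^ t zero *_) (^-∑ x (t ∘ suc)))

∏-nonZero : ∀ {w} (t : Fin w → ℕ) → (∀ i → NonZero (t i)) → NonZero (∏ t)
∏-nonZero {zero}  t t≢0 = _
∏-nonZero {suc _} t t≢0 = ℕ.m*n≢0 _ _ {{t≢0 zero}} {{∏-nonZero (t ∘ suc) (t≢0 ∘ suc)}}

coprime-∏-∣ : ∀ {w} (t : Fin w → ℕ) {N} → (∀ {i j} → i ≢ j → Coprime (t i) (t j)) → (∀ i → t i ∣ N) → ∏ t ∣ N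
coprime-∏-∣ {zero}  t {N} cop t∣N = divides N (sym (ℕ.*-identityʳ N))
coprime-∏-∣ {suc _} t {N} cop t∣N with t∣N zero
... | divides Q refl = subst (∏ t ∣_) (ℕ.*-comm (t zero) Q) (*-monoʳ-∣ (t zero)
  (coprime-∏-∣ (t ∘ suc) (λ i≢j → cop (i≢j ∘ Fin.suc-injective))
    (λ i → coprime-divisor (cop {suc i} {zero} λ ()) (subst (t (suc i) ∣_) (ℕ.*-comm Q (t zero)) (t∣N (suc i))))))

prime∣^ : ∀ {p x} n → Prime p → p ∣ x ^ n → p ∣ x
prime∣^ zero    p-prime p∣1 = contradiction p∣1 (prime∤1 p-prime)
prime∣^ {p} {x} (suc n) p-prime p∣ = [ id , prime∣^ n p-prime ]′ (euclidsLemma x (x ^ n) p-prime p∣)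

prime-^-coprime : ∀ {p q} m n → Prime p → Prime q → p ≢ q → Coprime (p ^ m) (q ^ n)
prime-^-coprime {p} {q} m n p-prime q-prime p≢q {d} (d∣p^m , d∣q^n) with d ℕ.≟ 1
... | yes d≡1 = d≡1
... | no  d≢1 =
  let r , r-prime , r∣d = prime-divisor
        (λ { refl → ℕ.≢-nonZero⁻¹ (p ^ m) {{ℕ.m^n≢0 p m {{prime⇒nonZero p-prime}}}} (0∣⇒≡0 d∣p^m) }) d≢1
      r≡p = prime∣prime⇒≡ r-prime p-prime (prime∣^ m r-prime (∣-trans r∣d d∣p^m))
      r≡q = prime∣prime⇒≡ r-prime q-prime (prime∣^ n r-prime (∣-trans r∣d d∣q^n))
  in contradiction (trans (sym r≡p) r≡q) p≢q

module _ {w} (p : Fin w → ℕ) (p-injective : ∀ {i j} → p i ≡ p j → i ≡ j) where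

  -- By injectivity each number below Y is attained by at most one `p i`, so at most Y factors equal
  -- C. The induction on Y splits off the factor with `p i` equal to Y, if there is one.
  ∏-below-≤ : ∀ C .{{_ : NonZero C}} Y → ∏ (λ i → if does (p i ℕ.<? Y) then C else 1) ≤ C ^ Y
  ∏-below-≤ C zero    = ℕ.≤-reflexive (trans (Πℕ.sum-cong-≗ below-0) (Πℕ.sum-replicate-zero w))
    where
    below-0 : ∀ i → (if does (p i ℕ.<? 0) then C else 1) ≡ 1
    below-0 i = cong (if_then C else 1) (dec-false (p i ℕ.<? 0) λ ())
  ∏-below-≤ C (suc Y) = begin
    ∏ (below (suc Y))    ≤⟨ ∏-mono (below (suc Y)) (λ i → at i * below Y i) split ⟩
    ∏ (λ i → at i * below Y i) ≡⟨ Πℕ.∑-distrib-+ at (below Y) ⟩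
    ∏ at * ∏ (below Y)   ≤⟨ ℕ.*-mono-≤ ∏at≤C (∏-below-≤ C Y) ⟩
    C * C ^ Y            ∎
    where
    open ℕ.≤-Reasoning
    below : ℕ → Fin w → ℕ
    below Y i = if does (p i ℕ.<? Y) then C else 1
    at : Fin w → ℕ
    at i = if does (p i ℕ.≟ Y) then C else 1
    at-≡ : ∀ i → p i ≡ Y → at i ≡ C
    at-≡ i pi≡Y = cong (if_then C else 1) (dec-true (p i ℕ.≟ Y) pi≡Y)
    at-≢ : ∀ i → p i ≢ Y → at i ≡ 1
    at-≢ i pi≢Y = cong (if_then C else 1) (dec-false (p i ℕ.≟ Y) pi≢Y)
    1≤C = ℕ.>-nonZero⁻¹ C
    1≤if : ∀ b → 1 ≤ (if b then C else 1)
    1≤if true  = 1≤C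
    1≤if false = ℕ.≤-refl
    below-≡ : ∀ {Y i} → p i < Y → below Y i ≡ C
    below-≡ {Y} {i} p<Y = cong (if_then C else 1) (dec-true (p i ℕ.<? Y) p<Y)
    below-≢ : ∀ {Y i} → ¬ p i < Y → below Y i ≡ 1
    below-≢ {Y} {i} p≮Y = cong (if_then C else 1) (dec-false (p i ℕ.<? Y) p≮Y)
    ∏at≤C : ∏ at ≤ C
    ∏at≤C with Fin.any? (λ i → p i ℕ.≟ Y)
    ... | yes (j , pj≡Y) = ℕ.≤-reflexive (trans
      (sum-only ℕ.*-1-commutativeMonoid at j (λ i i≢j → at-≢ i (λ pi≡Y → i≢j (p-injective (trans pi≡Y (sym pj≡Y))))))
      (at-≡ j pj≡Y))
    ... | no ∄i = ℕ.≤-trans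
      (ℕ.≤-reflexive (trans (Πℕ.sum-cong-≗ (λ i → at-≢ i (λ pi≡Y → ∄i (i , pi≡Y)))) (Πℕ.sum-replicate-zero w)))
      1≤C
    split : ∀ i → below (suc Y) i ≤ at i * below Y i
    split i = by-cases (p i ℕ.<? suc Y) (p i ℕ.≟ Y)
      where
      by-cases : Dec (p i < suc Y) → Dec (p i ≡ Y) → below (suc Y) i ≤ at i * below Y i
      by-cases (no p≮1+Y)  _ = subst (_≤ at i * below Y i) (sym (below-≢ p≮1+Y))
        (ℕ.*-mono-≤ (1≤if (does (p i ℕ.≟ Y))) (1≤if (does (p i ℕ.<? Y))))
      by-cases (yes p<1+Y) (yes p≡Y) = subst₂ (λ x y → x ≤ y * below Y i) (sym (below-≡ p<1+Y)) (sym (at-≡ i p≡Y))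
        (ℕ.m≤m*n C (below Y i) {{ℕ.>-nonZero (1≤if (does (p i ℕ.<? Y)))}})
      by-cases (yes p<1+Y) (no p≢Y)  = ℕ.≤-reflexive (trans (below-≡ p<1+Y) (sym (cong₂ _*_ (at-≢ i p≢Y)
        (below-≡ (ℕ.≤∧≢⇒< (ℕ.≤-pred p<1+Y) p≢Y)) ⟨ trans ⟩ ℕ.*-identityˡ C)))

  -- For p ≥ 2 ^ E one has e ^ E ≤ (2 ^ e) ^ E ≤ p ^ e, so only boundedly many primes contribute to the
  -- constant.

  ∏-exponents-≤ : ∀ E .{{_ : NonZero E}} → (∀ i → 2 ≤ p i) → (e : Fin w → ℕ) →
                  ∏ e ^ E ≤ (E ^ E) ^ (2 ^ E) * ∏ (λ i → p i ^ e i)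
  ∏-exponents-≤ E 2≤p e = begin
    ∏ e ^ E                                   ≡⟨ ∏-^ e E ⟩
    ∏ (λ i → e i ^ E)                         ≤⟨ ∏-mono (λ i → e i ^ E) (λ i → c i * p i ^ e i) factor ⟩
    ∏ (λ i → c i * p i ^ e i)                 ≡⟨ Πℕ.∑-distrib-+ c (λ i → p i ^ e i) ⟩
    ∏ c * ∏ (λ i → p i ^ e i)                 ≤⟨ ℕ.*-monoˡ-≤ _ (∏-below-≤ (E ^ E) {{ℕ.m^n≢0 E E}} (2 ^ E)) ⟩
    (E ^ E) ^ (2 ^ E) * ∏ (λ i → p i ^ e i)   ∎
    where
    open ℕ.≤-Reasoning
    c : Fin w → ℕ
    c i = if does (p i ℕ.<? 2 ^ E) then E ^ E else 1
    factor : ∀ i → e i ^ E ≤ c i * p i ^ e i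
    factor i = by-cases (p i ℕ.<? 2 ^ E)
      where
      by-cases : Dec (p i < 2 ^ E) → e i ^ E ≤ c i * p i ^ e i
      by-cases (yes p<2^E) = subst (λ x → e i ^ E ≤ x * p i ^ e i)
        (sym (cong (if_then E ^ E else 1) (dec-true (p i ℕ.<? 2 ^ E) p<2^E)))
        (ℕ.≤-trans (x^E≤E^E*2^x E (e i)) (ℕ.*-monoʳ-≤ (E ^ E) (ℕ.^-monoˡ-≤ (e i) (2≤p i))))
      by-cases (no p≮2^E) = begin
        e i ^ E             ≤⟨ ℕ.^-monoˡ-≤ E (ℕ.<⇒≤ (n<2^n (e i))) ⟩
        (2 ^ e i) ^ E       ≡⟨ ^-comm 2 (e i) E ⟩
        (2 ^ E) ^ e i       ≤⟨ ℕ.^-monoˡ-≤ (e i) (ℕ.≮⇒≥ p≮2^E) ⟩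
        p i ^ e i           ≡⟨ ℕ.*-identityˡ (p i ^ e i) ⟨
        1 * p i ^ e i
          ≡⟨ cong (λ b → (if b then E ^ E else 1) * p i ^ e i) (dec-false (p i ℕ.<? 2 ^ E) p≮2^E) ⟨
        c i * p i ^ e i     ∎

  -- The sum of the exponents is at most logarithmic in the product of the prime powers, as 2 ^ ∑ e
  -- ≤ ∏ p ^ e; `x^E≤E^E*2^x` turns this into a bound by an arbitrarily small power.
  ∑-exponents-≤ : ∀ E .{{_ : NonZero E}} → (∀ i → 2 ≤ p i) → (e : Fin w → ℕ) →
                  ∑ℕ e ^ E ≤ E ^ E * ∏ (λ i → p i ^ e i)
  ∑-exponents-≤ E 2≤p e = ℕ.≤-trans (x^E≤E^E*2^x E (∑ℕ e)) (ℕ.*-monoʳ-≤ (E ^ E)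
    (ℕ.≤-trans (ℕ.≤-reflexive (^-∑ 2 e)) (∏-mono (λ i → 2 ^ e i) _ (λ i → ℕ.^-monoˡ-≤ (e i) (2≤p i)))))

-- Coprime triples

-- Makes an irrelevant instance relevant, as required for values of functions such as `summand≢0`.
nonZero! : ∀ x .{{_ : NonZero x}} → NonZero x
nonZero! x = ℕ.≢-nonZero (ℕ.≢-nonZero⁻¹ x)

module CoprimeTriple
  (a b : ℕ) .{{_ : NonZero a}} .{{_ : NonZero b}} .{{_ : NonZero (a ℕ.+ b)}} (a⊥b⊥c : Coprime₃ a b (a ℕ.+ b))
  where

  summand : Fin 3 → ℕ
  summand 0F = a
  summand 1F = b
  summand 2F = a ℕ.+ b

  N : ℕ
  N = a * b * (a ℕ.+ b)

  instance
    N≢0 : NonZero N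
    N≢0 = ℕ.m*n≢0 (a * b) (a ℕ.+ b) {{ℕ.m*n≢0 a b}}

  summand≢0 : ∀ k → NonZero (summand k)
  summand≢0 0F = nonZero! a
  summand≢0 1F = nonZero! b
  summand≢0 2F = nonZero! (a ℕ.+ b)

  private
    common⇒≡1 : ∀ {d} → d ∣ a → d ∣ b → d ≡ 1
    common⇒≡1 d∣a d∣b = ∣1⇒≡1 (subst (_ ∣_) a⊥b⊥c (gcd-greatest (gcd-greatest d∣a d∣b) (∣m∣n⇒∣m+n d∣a d∣b)))

    ∣b+c⇒∣a : ∀ {d} → d ∣ a ℕ.+ b → d ∣ b → d ∣ a
    ∣b+c⇒∣a {d} d∣c d∣b = ∣m+n∣m⇒∣n (subst (d ∣_) (ℕ.+-comm a b) d∣c) d∣b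

  summand-coprime : ∀ {k l} → k ≢ l → Coprime (summand k) (summand l)
  summand-coprime {0F} {0F} k≢l _ = contradiction refl k≢l
  summand-coprime {0F} {1F} _ (d∣a , d∣b) = common⇒≡1 d∣a d∣b
  summand-coprime {0F} {2F} _ (d∣a , d∣c) = common⇒≡1 d∣a (∣m+n∣m⇒∣n d∣c d∣a)
  summand-coprime {1F} {0F} _ (d∣b , d∣a) = common⇒≡1 d∣a d∣b
  summand-coprime {1F} {1F} k≢l _ = contradiction refl k≢l
  summand-coprime {1F} {2F} _ (d∣b , d∣c) = common⇒≡1 (∣b+c⇒∣a d∣c d∣b) d∣b
  summand-coprime {2F} {0F} _ (d∣c , d∣a) = common⇒≡1 d∣a (∣m+n∣m⇒∣n d∣c d∣a)
  summand-coprime {2F} {1F} _ (d∣c , d∣b) = common⇒≡1 (∣b+c⇒∣a d∣c d∣b) d∣b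
  summand-coprime {2F} {2F} k≢l _ = contradiction refl k≢l

  summand∣N : ∀ k → summand k ∣ N
  summand∣N 0F = ∣m⇒∣m*n (a ℕ.+ b) (m∣m*n b)
  summand∣N 1F = ∣m⇒∣m*n (a ℕ.+ b) (n∣m*n a)
  summand∣N 2F = n∣m*n (a * b)

  w : ℕ
  w = length (primeDivisors N)

  p : Fin w → ℕ
  p = primeDivisor N

  p-prime : ∀ i → Prime (p i)
  p-prime = primeDivisor-prime N

  p-injective : ∀ {i j} → p i ≡ p j → i ≡ j
  p-injective = primeDivisor-injective N

  private
    owned : ∀ i → ∃[ k ] p i ∣ summand k
    owned i = [ [ 0F ,_ , 1F ,_ ]′ ∘ euclidsLemma a b (p-prime i) , 2F ,_ ]′
                (euclidsLemma (a * b) (a ℕ.+ b) (p-prime i) (primeDivisor-∣ N i))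

  owner : Fin w → Fin 3
  owner i = proj₁ (owned i)

  p∣summand : ∀ i → p i ∣ summand (owner i)
  p∣summand i = proj₂ (owned i)

  p∣⇒owner : ∀ i k → p i ∣ summand k → owner i ≡ k
  p∣⇒owner i k p∣nk with owner i Fin.≟ k
  ... | yes o≡k = o≡k
  ... | no  o≢k = contradiction (summand-coprime o≢k (p∣summand i , p∣nk))
    λ p≡1 → prime∤1 (p-prime i) (∣-reflexive p≡1)

  p-complete : ∀ {r} k → Prime r → r ∣ summand k → ∃[ i ] p i ≡ r × owner i ≡ k
  p-complete k r-prime r∣nk =
    let i , pᵢ≡r = primeDivisor-complete N r-prime (∣-trans r∣nk (summand∣N k)) in
    i , pᵢ≡r , p∣⇒owner i k (subst (_∣ summand k) (sym pᵢ≡r) r∣nk)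

  open Triple summand summand≢0 summand-coprime refl p p-prime p-injective owner p∣summand p-complete public

  P : Fin w → ℙ
  P i = mkℙ (p i) (p-prime i)

  exponent : Fin w → ℕ
  exponent i = valuation (p i) (summand (owner i))

  exponent≢0 : ∀ i → NonZero (exponent i)
  exponent≢0 i = ℕ.>-nonZero (valuation>0 (summand (owner i)) {{summand≢0 (owner i)}} (p∣summand i))

  coeff-d : ∀ k i → coeff (d (+ summand k)) (P i) ≡ β k i ℤ.* + exponent i
  coeff-d k i = by-cases (k Fin.≟ owner i)
    where
    open ≡-Reasoning
    instance _ = prime⇒nonZero (p-prime i)
    by-cases : Dec (k ≡ owner i) → coeff (d (+ summand k)) (P i) ≡ β k i ℤ.* + exponent i
    by-cases (yes refl) = begin
      (+ summand (owner i) ℤ.* + exponent i) /ℕ p i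
        ≡⟨ cong (_/ℕ p i) (ℤ.pos-* (summand (owner i)) (exponent i)) ⟨
      + (summand (owner i) * exponent i ℕ./ p i)     ≡⟨ cong (λ x → + (x ℕ./ p i)) rearrange ⟩
      + (m i * exponent i * p i ℕ./ p i)             ≡⟨ cong +_ (ℕ.m*n/n≡m (m i * exponent i) (p i)) ⟩
      + (m i * exponent i)                           ≡⟨ ℤ.pos-* (m i) (exponent i) ⟩
      + m i ℤ.* + exponent i                         ≡⟨ cong (ℤ._* + exponent i) (β-owner i) ⟨
      β (owner i) i ℤ.* + exponent i                 ∎
      where
      rearrange : summand (owner i) * exponent i ≡ m i * exponent i * p i
      rearrange = trans (cong (_* exponent i) (n≡m*p i)) (trans (ℕ.*-assoc (m i) (p i) (exponent i))
        (trans (cong (m i *_) (ℕ.*-comm (p i) (exponent i))) (sym (ℕ.*-assoc (m i) (exponent i) (p i)))))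
    by-cases (no k≢o) = trans
      (n*0/p≡0 (+ summand k) (p i) (∤⇒valuation≡0 λ p∣nk → k≢o (sym (p∣⇒owner i k p∣nk))))
      (cong (ℤ._* + exponent i) (sym (β-≢ k≢o)))

  coeff-d-∉ : ∀ k q → (∀ i → value q ≢ value (P i)) → coeff (d (+ summand k)) q ≡ 0ℤ
  coeff-d-∉ k (mkℙ q q-prime) q∉P = n*0/p≡0 (+ summand k) q {{prime⇒nonZero q-prime}}
    -- Primality is irrelevant inside `ℙ`; being decidable, it can be recomputed.
    (∤⇒valuation≡0 λ q∣nk → let i , pᵢ≡q , _ = p-complete k (recompute (prime? q) q-prime) q∣nk in q∉P i (sym pᵢ≡q))

  -- Each prime power divides its owner and hence `N`, and pairwise coprime divisors multiply to a
  -- divisor.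
  ∏-p^exponent-≤ : ∏ (λ i → p i ^ exponent i) ≤ N
  ∏-p^exponent-≤ = ∣⇒≤ (coprime-∏-∣ (λ i → p i ^ exponent i)
    (λ {i} {j} i≢j → prime-^-coprime (exponent i) (exponent j) (p-prime i) (p-prime j) (i≢j ∘ p-injective))
    (λ i → ∣-trans (^-valuation∣ (p i) (summand (owner i))) (summand∣N (owner i))))

  2≤p : ∀ i → 2 ≤ p i
  2≤p i = ℕ.nonTrivial⇒n>1 (p i) {{prime⇒nonTrivial (p-prime i)}}

  -- The coefficient of ξ p in d n is v p (n / p); scaling by V / v p turns d n into V D n.

  V : ℕ
  V = ∏ exponent

  weight : Fin w → ℕ
  weight i = ℕ._/_ V (exponent i) {{exponent≢0 i}}

  weight*exponent≡V : ∀ i → weight i * exponent i ≡ V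
  weight*exponent≡V i = ℕ.m/n*n≡m {{exponent≢0 i}} (term∣∏ exponent i)

  V≢0 : NonZero V
  V≢0 = ∏-nonZero exponent exponent≢0

  solution⇒ψ : ∀ z Z → (∀ i → ∣ z i ∣ ≤ Z) → D 0F z ℤ.+ D 1F z ≡ D 2F z →
               + a ℤ.* D 1F z ≢ + b ℤ.* D 0F z →
               ∃[ ψ ] 𝒯[ a , b ] ψ × Independent ψ (+ a) (+ b) × (∀ q → ∣ ⟦ ψ ⟧ (ξ q) ∣ ≤ V * Z)
  solution⇒ψ z Z z≤Z D₀+D₁≡D₂ W≢0 =
    ψ , ((λ {q} → supp⊆ {q}) , additive) , independent , functional-≤ P p-injective c c≤VZ
    where
    open ≡-Reasoning
    c : Fin w → ℤ
    c i = + weight i ℤ.* z i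

    weight≤V : ∀ i → weight i ≤ V
    weight≤V i = ℕ.m/n≤m V (exponent i) {{exponent≢0 i}}

    c≤VZ : ∀ i → ∣ c i ∣ ≤ V * Z
    c≤VZ i = ℕ.≤-trans (ℕ.≤-reflexive (ℤ.abs-* (+ weight i) (z i))) (ℕ.*-mono-≤ (weight≤V i) (z≤Z i))

    ψ : 𝒯
    ψ = functional P p-injective c c≤VZ

    d^ψ≡ : ∀ k → d^ ψ (+ summand k) ≡ + V ℤ.* D k z
    d^ψ≡ k = trans (Σℤ.sum-cong-≗ term) (sym (Σℤ.*-distribˡ-sum (+ V) (λ i → β k i ℤ.* z i)))
      where
      regroup : ∀ b e u x → (b ℤ.* e) ℤ.* (u ℤ.* x) ≡ (u ℤ.* e) ℤ.* (b ℤ.* x)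
      regroup = ℤ-Ring.solve-∀
      term : ∀ i → coeff (d (+ summand k)) (P i) ℤ.* c i ≡ + V ℤ.* (β k i ℤ.* z i)
      term i = begin
        coeff (d (+ summand k)) (P i) ℤ.* c i                ≡⟨ cong (ℤ._* c i) (coeff-d k i) ⟩
        (β k i ℤ.* + exponent i) ℤ.* (+ weight i ℤ.* z i)
          ≡⟨ regroup (β k i) (+ exponent i) (+ weight i) (z i) ⟩
        (+ weight i ℤ.* + exponent i) ℤ.* (β k i ℤ.* z i)
          ≡⟨ cong (ℤ._* (β k i ℤ.* z i)) (ℤ.pos-* (weight i) (exponent i)) ⟨
        + (weight i * exponent i) ℤ.* (β k i ℤ.* z i)
          ≡⟨ cong (λ v → + v ℤ.* (β k i ℤ.* z i)) (weight*exponent≡V i) ⟩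
        + V ℤ.* (β k i ℤ.* z i)                              ∎

    supp⊆ : ∀ {q} → supp𝒯 ψ q → value q ∣ N
    supp⊆ {q} ψξ≢0 = let i , q≡pᵢ = functional-supp P p-injective c c≤VZ {q} ψξ≢0 in
      subst (_∣ N) (sym q≡pᵢ) (primeDivisor-∣ N i)

    additive : d^ ψ (+ (a ℕ.+ b)) ≡ d^ ψ (+ a) ℤ.+ d^ ψ (+ b)
    additive = begin
      d^ ψ (+ (a ℕ.+ b))                       ≡⟨ d^ψ≡ 2F ⟩
      + V ℤ.* D 2F z                           ≡⟨ cong (+ V ℤ.*_) D₀+D₁≡D₂ ⟨
      + V ℤ.* (D 0F z ℤ.+ D 1F z)              ≡⟨ ℤ.*-distribˡ-+ (+ V) (D 0F z) (D 1F z) ⟩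
      + V ℤ.* D 0F z ℤ.+ + V ℤ.* D 1F z        ≡⟨ cong₂ ℤ._+_ (d^ψ≡ 0F) (d^ψ≡ 1F) ⟨
      d^ ψ (+ a) ℤ.+ d^ ψ (+ b)                ∎

    independent : W ψ (+ a) (+ b) ≢ 0ℤ
    independent W≡0 = W≢0 (ℤ.*-cancelˡ-≡ (+ V) _ _ {{V≢0}} (begin
      + V ℤ.* (+ a ℤ.* D 1F z)     ≡⟨ swap (+ V) (+ a) (D 1F z) ⟩
      + a ℤ.* (+ V ℤ.* D 1F z)     ≡⟨ cong (+ a ℤ.*_) (d^ψ≡ 1F) ⟨
      + a ℤ.* d^ ψ (+ b)           ≡⟨ ℤ.i-j≡0⇒i≡j (+ a ℤ.* d^ ψ (+ b)) (+ b ℤ.* d^ ψ (+ a)) W≡0 ⟩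
      + b ℤ.* d^ ψ (+ a)           ≡⟨ cong (+ b ℤ.*_) (d^ψ≡ 0F) ⟩
      + b ℤ.* (+ V ℤ.* D 0F z)     ≡⟨ swap (+ b) (+ V) (D 0F z) ⟩
      + V ℤ.* (+ b ℤ.* D 0F z)     ∎))
      where
      swap : ∀ x y t → x ℤ.* (y ℤ.* t) ≡ y ℤ.* (x ℤ.* t)
      swap = ℤ-Ring.solve-∀

  R : ℕ
  R = ∏ p

  R≡rad : R ≡ rad N
  R≡rad = ∏-lookup (primeDivisors N)

  -- The number of prime factors of `N`, counted with multiplicity.
  L : ℕ
  L = ∑ℕ exponent

  -- Divisibility and size of the derivatives for an arbitrary ψ

  module _ (ψ : 𝒯) where

    private
      dψ : Fin 3 → ℤ
      dψ k = d^ ψ (+ summand k)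

      dψ≡ : ∀ k → dψ k ≡ ∑ℤ (λ i → β k i ℤ.* + exponent i ℤ.* ⟦ ψ ⟧ (ξ (P i)))
      dψ≡ k = trans (⟦⟧-expand P p-injective ψ (d (+ summand k)) (coeff-d-∉ k))
        (Σℤ.sum-cong-≗ (λ i → cong (ℤ._* ⟦ ψ ⟧ (ξ (P i))) (coeff-d k i)))

    -- The term of p in the derivative of n is a multiple of n / p, and p divides `R`; so `R`
    -- restores the one factor p lost in each term.
    summand∣R*d : ∀ k → + summand k ∣ℤ + R ℤ.* dψ k
    summand∣R*d k = subst (+ summand k ∣ℤ_)
      (sym (trans (cong (+ R ℤ.*_) (dψ≡ k))
        (Σℤ.*-distribˡ-sum (+ R) (λ i → β k i ℤ.* + exponent i ℤ.* ⟦ ψ ⟧ (ξ (P i))))))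
      (∑-∣ _ λ i → subst (+ summand k ∣ℤ_) (assoc (+ R) (β k i) (+ exponent i) (⟦ ψ ⟧ (ξ (P i))))
        (ℤ∣.∣m⇒∣m*n (⟦ ψ ⟧ (ξ (P i))) (ℤ∣.∣m⇒∣m*n (+ exponent i) (n∣Rβ i (k Fin.≟ owner i)))))
      where
      assoc : ∀ r x y t → r ℤ.* x ℤ.* y ℤ.* t ≡ r ℤ.* (x ℤ.* y ℤ.* t)
      assoc = ℤ-Ring.solve-∀
      n∣Rβ : ∀ i → Dec (k ≡ owner i) → + summand k ∣ℤ + R ℤ.* β k i
      n∣Rβ i (no k≢o)   = subst (λ x → + summand k ∣ℤ + R ℤ.* x) (sym (β-≢ k≢o))
        (ℤ∣.∣n⇒∣m*n (+ R) (ℤ∣.divides 0ℤ refl))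
      n∣Rβ i (yes refl) = subst₂ _∣ℤ_
        (trans (sym (ℤ.pos-* (p i) (m i))) (cong +_ (trans (ℕ.*-comm (p i) (m i)) (sym (n≡m*p i)))))
        (cong (+ R ℤ.*_) (sym (β-owner i)))
        (ℤ∣.*-monoˡ-∣ (+ m i) (ℤ∣.∣ᵤ⇒∣ {+ p i} {+ R} (term∣∏ p i)))

    ∣d∣-≤ : ∀ {B} → (∀ q → ∣ ⟦ ψ ⟧ (ξ q) ∣ ≤ B) → ∀ k → ∣ dψ k ∣ ≤ summand k * (L * B)
    ∣d∣-≤ {B} ψ≤B k = begin
      ∣ dψ k ∣                                      ≡⟨ cong ∣_∣ (dψ≡ k) ⟩
      ∣ ∑ℤ (λ i → β k i ℤ.* + exponent i ℤ.* ⟦ ψ ⟧ (ξ (P i))) ∣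
        ≤⟨ ∣∑∣≤ _ (λ i → summand k * (exponent i * B)) term≤ ⟩
      ∑ℕ (λ i → summand k * (exponent i * B))       ≡⟨ Σℕ.*-distribˡ-sum (summand k) (λ i → exponent i * B) ⟨
      summand k * ∑ℕ (λ i → exponent i * B)         ≡⟨ cong (summand k *_) (Σℕ.*-distribʳ-sum B exponent) ⟨
      summand k * (L * B)                           ∎
      where
      open ℕ.≤-Reasoning
      β≤ : ∀ i → Dec (k ≡ owner i) → ∣ β k i ∣ ≤ summand k
      β≤ i (no k≢o)   = subst (λ x → ∣ x ∣ ≤ summand k) (sym (β-≢ k≢o)) ℕ.z≤n
      β≤ i (yes refl) = subst₂ (λ x y → ∣ x ∣ ≤ y) (sym (β-owner i)) (sym (n≡m*p i))
        (ℕ.m≤m*n (m i) (p i) {{prime⇒nonZero (p-prime i)}})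
      term≤ : ∀ i → ∣ β k i ℤ.* + exponent i ℤ.* ⟦ ψ ⟧ (ξ (P i)) ∣ ≤ summand k * (exponent i * B)
      term≤ i = begin
        ∣ β k i ℤ.* + exponent i ℤ.* ⟦ ψ ⟧ (ξ (P i)) ∣
          ≡⟨ ℤ.abs-* (β k i ℤ.* + exponent i) (⟦ ψ ⟧ (ξ (P i))) ⟩
        ∣ β k i ℤ.* + exponent i ∣ * ∣ ⟦ ψ ⟧ (ξ (P i)) ∣
          ≡⟨ cong (_* ∣ ⟦ ψ ⟧ (ξ (P i)) ∣) (ℤ.abs-* (β k i) (+ exponent i)) ⟩
        ∣ β k i ∣ * exponent i * ∣ ⟦ ψ ⟧ (ξ (P i)) ∣
          ≤⟨ ℕ.*-mono-≤ (ℕ.*-monoˡ-≤ (exponent i) (β≤ i (k Fin.≟ owner i))) (ψ≤B (P i)) ⟩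
        summand k * exponent i * B                          ≡⟨ ℕ.*-assoc (summand k) (exponent i) B ⟩
        summand k * (exponent i * B)                        ∎

    -- For a and b, one term of R W contains the number itself and the other contains R times its
    -- derivative. Additivity gives W (a, b) = W (a, c), which treats c in the same way; pairwise
    -- coprimality multiplies the three divisors.
    N∣R*W : d^ ψ (+ (a ℕ.+ b)) ≡ d^ ψ (+ a) ℤ.+ d^ ψ (+ b) → N ∣ R * ∣ W ψ (+ a) (+ b) ∣
    N∣R*W additive = subst (_∣ R * ∣ W′ ∣) ∏summand≡N (coprime-∏-∣ summand summand-coprime λ k →
      subst (summand k ∣_) (ℤ.abs-* (+ R) W′) (ℤ∣.∣⇒∣ᵤ (summand∣ k)))
      where
      W′ = W ψ (+ a) (+ b)
      ∏summand≡N : ∏ summand ≡ N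
      ∏summand≡N = trans (cong (λ x → a * (b * x)) (ℕ.*-identityʳ (a ℕ.+ b))) (sym (ℕ.*-assoc a b (a ℕ.+ b)))
      n∣ : ∀ k x → + summand k ∣ℤ x ℤ.* (+ R ℤ.* dψ k)
      n∣ k x = ℤ∣.∣n⇒∣m*n x (summand∣R*d k)
      expand : ∀ r x y u v → x ℤ.* (r ℤ.* v) ℤ.- y ℤ.* (r ℤ.* u) ≡ r ℤ.* (x ℤ.* v ℤ.- y ℤ.* u)
      expand = ℤ-Ring.solve-∀
      expand-c : ∀ r x y u v → x ℤ.* (r ℤ.* (u ℤ.+ v)) ℤ.- (x ℤ.+ y) ℤ.* (r ℤ.* u) ≡ r ℤ.* (x ℤ.* v ℤ.- y ℤ.* u)
      expand-c = ℤ-Ring.solve-∀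
      summand∣ : ∀ k → + summand k ∣ℤ + R ℤ.* W′
      summand∣ 0F = subst (+ a ∣ℤ_) (expand (+ R) (+ a) (+ b) (dψ 0F) (dψ 1F))
        (ℤ∣.∣m∣n⇒∣m-n (ℤ∣.∣m⇒∣m*n (+ R ℤ.* dψ 1F) ℤ∣.∣-refl) (n∣ 0F (+ b)))
      summand∣ 1F = subst (+ b ∣ℤ_) (expand (+ R) (+ a) (+ b) (dψ 0F) (dψ 1F))
        (ℤ∣.∣m∣n⇒∣m-n (n∣ 1F (+ a)) (ℤ∣.∣m⇒∣m*n (+ R ℤ.* dψ 0F) ℤ∣.∣-refl))
      summand∣ 2F = subst (+ (a ℕ.+ b) ∣ℤ_)
        (trans (cong (λ x → + a ℤ.* (+ R ℤ.* x) ℤ.- + (a ℕ.+ b) ℤ.* (+ R ℤ.* dψ 0F)) additive)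
          (expand-c (+ R) (+ a) (+ b) (dψ 0F) (dψ 1F)))
        (ℤ∣.∣m∣n⇒∣m-n (n∣ 2F (+ a)) (ℤ∣.∣m⇒∣m*n (+ R ℤ.* dψ 0F) ℤ∣.∣-refl))

    independent⇒c≤ : ∀ {B} → d^ ψ (+ (a ℕ.+ b)) ≡ d^ ψ (+ a) ℤ.+ d^ ψ (+ b) → Independent ψ (+ a) (+ b) →
                     (∀ q → ∣ ⟦ ψ ⟧ (ξ q) ∣ ≤ B) → a ℕ.+ b ≤ R * 2 * (L * B)
    independent⇒c≤ {B} additive W≢0 ψ≤B = ℕ.*-cancelˡ-≤ (a * b) {{ℕ.m*n≢0 a b}} (begin
      N                                      ≤⟨ ∣⇒≤ {{RW≢0}} (N∣R*W additive) ⟩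
      R * ∣ W ψ (+ a) (+ b) ∣                ≤⟨ ℕ.*-monoʳ-≤ R W≤ ⟩
      R * (2 * (a * b * (L * B)))            ≡⟨ ℕ.*-assoc R 2 (a * b * (L * B)) ⟨
      R * 2 * (a * b * (L * B))              ≡⟨ swap (R * 2) (a * b) (L * B) ⟩
      a * b * (R * 2 * (L * B))              ∎)
      where
      open ℕ.≤-Reasoning
      swap : ∀ x y t → x * (y * t) ≡ y * (x * t)
      swap x y t = trans (sym (ℕ.*-assoc x y t)) (trans (cong (_* t) (ℕ.*-comm x y)) (ℕ.*-assoc y x t))
      RW≢0 : NonZero (R * ∣ W ψ (+ a) (+ b) ∣)
      RW≢0 = ℕ.m*n≢0 R _ {{∏-nonZero p (λ i → prime⇒nonZero (p-prime i))}} {{ℕ.≢-nonZero (W≢0 ∘ ℤ.∣i∣≡0⇒i≡0)}}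
      W≤ : ∣ W ψ (+ a) (+ b) ∣ ≤ 2 * (a * b * (L * B))
      W≤ = begin
        ∣ + a ℤ.* dψ 1F ℤ.- + b ℤ.* dψ 0F ∣              ≤⟨ ℤ.∣i-j∣≤∣i∣+∣j∣ (+ a ℤ.* dψ 1F) (+ b ℤ.* dψ 0F) ⟩
        ∣ + a ℤ.* dψ 1F ∣ ℕ.+ ∣ + b ℤ.* dψ 0F ∣
          ≡⟨ cong₂ ℕ._+_ (ℤ.abs-* (+ a) (dψ 1F)) (ℤ.abs-* (+ b) (dψ 0F)) ⟩
        a * ∣ dψ 1F ∣ ℕ.+ b * ∣ dψ 0F ∣
          ≤⟨ ℕ.+-mono-≤ (ℕ.*-monoʳ-≤ a (∣d∣-≤ ψ≤B 1F)) (ℕ.*-monoʳ-≤ b (∣d∣-≤ ψ≤B 0F)) ⟩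
        a * (b * (L * B)) ℕ.+ b * (a * (L * B))
          ≡⟨ cong₂ ℕ._+_ (sym (ℕ.*-assoc a b (L * B))) (trans (swap b a (L * B)) (trans (sym (ℕ.*-assoc a b (L * B))) (sym (ℕ.+-identityʳ _)))) ⟩
        2 * (a * b * (L * B))                            ∎

-- The two implications

summands≤c : ∀ a b k .{{_ : NonZero a}} .{{_ : NonZero b}} .{{_ : NonZero (a ℕ.+ b)}} (cop : Coprime₃ a b (a ℕ.+ b)) →
             CoprimeTriple.summand a b cop k ≤ a ℕ.+ b
summands≤c a b 0F cop = ℕ.m≤m+n a b
summands≤c a b 1F cop = ℕ.m≤n+m b a
summands≤c a b 2F cop = ℕ.≤-refl

2≤a+b : ∀ a b .{{_ : NonZero a}} .{{_ : NonZero b}} → 2 ≤ a ℕ.+ b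
2≤a+b a b = ℕ.+-mono-≤ (ℕ.>-nonZero⁻¹ a) (ℕ.>-nonZero⁻¹ b)

module Bounds
  (a b : ℕ) .{{_ : NonZero a}} .{{_ : NonZero b}} .{{_ : NonZero (a ℕ.+ b)}} (cop : Coprime₃ a b (a ℕ.+ b))
  where

  open CoprimeTriple a b cop

  c : ℕ
  c = a ℕ.+ b

  N≤c³ : N ≤ c ^ 3
  N≤c³ = begin
    a * b * c     ≤⟨ ℕ.*-monoˡ-≤ c (ℕ.*-mono-≤ (ℕ.m≤m+n a b) (ℕ.m≤n+m b a)) ⟩
    c * c * c     ≡⟨ trans (ℕ.*-assoc c c c) (cong (λ x → c * (c * x)) (sym (ℕ.*-identityʳ c))) ⟩
    c ^ 3         ∎
    where open ℕ.≤-Reasoning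

  V-≤ : ∀ E .{{_ : NonZero E}} → V ^ E ≤ (E ^ E) ^ (2 ^ E) * c ^ 3
  V-≤ E = ℕ.≤-trans (∏-exponents-≤ p p-injective E 2≤p exponent)
    (ℕ.*-monoʳ-≤ ((E ^ E) ^ (2 ^ E)) (ℕ.≤-trans ∏-p^exponent-≤ N≤c³))

  L-≤ : ∀ E .{{_ : NonZero E}} → L ^ E ≤ E ^ E * c ^ 3
  L-≤ E = ℕ.≤-trans (∑-exponents-≤ p p-injective E 2≤p exponent) (ℕ.*-monoʳ-≤ (E ^ E) (ℕ.≤-trans ∏-p^exponent-≤ N≤c³))

  w≤L : w ≤ L
  w≤L = w≤∑ exponent exponent≢0
    where
    w≤∑ : ∀ {w} (t : Fin w → ℕ) → (∀ i → NonZero (t i)) → w ≤ ∑ℕ t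
    w≤∑ {zero}  t t≢0 = ℕ.z≤n
    w≤∑ {suc _} t t≢0 = ℕ.+-mono-≤ (ℕ.>-nonZero⁻¹ (t 0F) {{t≢0 0F}}) (w≤∑ (t ∘ suc) (t≢0 ∘ suc))

  p≤R : ∀ i → p i ≤ R
  p≤R i = ∣⇒≤ {{∏-nonZero p (λ i → prime⇒nonZero (p-prime i))}} (term∣∏ p i)

  prime≤R : ∀ {q} k → Prime q → q ∣ summand k → q ≤ R
  prime≤R k q-prime q∣ = let i , pᵢ≡q , _ = p-complete k q-prime q∣ in subst (_≤ R) pᵢ≡q (p≤R i)

  2≤R : 2 ≤ R
  2≤R = let r , r-prime , r∣c = prime-divisor (ℕ.≢-nonZero⁻¹ c) (ℕ.>⇒≢ (2≤a+b a b)) in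
    ℕ.≤-trans (ℕ.nonTrivial⇒n>1 r {{prime⇒nonTrivial r-prime}}) (prime≤R 2F r-prime r∣c)

  -- The entry 1 cannot be c, so either q is c, or q and 1 are the two summands and c = q + 1. In
  -- both cases q divides abc and is at most `R`.
  form⇒c≤1+R : OfForm1Nq a b c → c ≤ suc R
  form⇒c≤1+R (n , q , _ , q-prime , perm) =
    cases (∈-resp-↭ (↭-sym perm) (there (there (here refl)))) (∈-resp-↭ (↭-sym perm) (here refl))
    where
    1≢q : 1 ≢ q
    1≢q refl = contradiction q-prime λ ()
    1≢c : 1 ≢ c
    1≢c 1≡c = ℕ.<⇒≢ (2≤a+b a b) 1≡c
    cases : q ∈ a ∷ b ∷ c ∷ [] → 1 ∈ a ∷ b ∷ c ∷ [] → c ≤ suc R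
    cases (there (there (here q≡c))) _ = ℕ.m≤n⇒m≤1+n (subst (_≤ R) q≡c (prime≤R 2F q-prime (subst (q ∣_) q≡c ∣-refl)))
    cases (here q≡a) (here 1≡a) = contradiction (trans 1≡a (sym q≡a)) 1≢q
    cases (here q≡a) (there (here 1≡b)) = subst₂ (λ x y → x ℕ.+ y ≤ suc R) q≡a 1≡b
      (subst (_≤ suc R) (ℕ.+-comm 1 q) (ℕ.s≤s (prime≤R 0F q-prime (subst (q ∣_) q≡a ∣-refl))))
    cases (there (here q≡b)) (here 1≡a) = subst₂ (λ x y → x ℕ.+ y ≤ suc R) 1≡a q≡b
      (ℕ.s≤s (prime≤R 1F q-prime (subst (q ∣_) q≡b ∣-refl)))
    cases (there (here q≡b)) (there (here 1≡b)) = contradiction (trans 1≡b (sym q≡b)) 1≢q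
    cases (here _) (there (there (here 1≡c))) = contradiction 1≡c 1≢c
    cases (there (here _)) (there (there (here 1≡c))) = contradiction 1≡c 1≢c

  form : ∀ {k l} → k ≢ l → Prime (summand k) → summand l ≡ 1 → OfForm1Nq a b c
  form {k} {l} k≢l k-prime l≡1 = let x , perm = arrange k l k≢l in
    summand x , summand k , summand≢0 x , k-prime , subst (λ y → _ ↭ y ∷ summand x ∷ summand k ∷ []) l≡1 perm
    where
    arrange : ∀ k l → k ≢ l → ∃[ x ] a ∷ b ∷ c ∷ [] ↭ summand l ∷ summand x ∷ summand k ∷ []
    arrange 2F 0F _ = 1F , ↭-refl
    arrange 1F 0F _ = 2F , ↭-prep a (↭-swap b c ↭-refl)
    arrange 2F 1F _ = 0F , ↭-swap a b ↭-refl
    arrange 0F 1F _ = 2F , ↭-trans (↭-swap a b ↭-refl) (↭-prep b (↭-swap a c ↭-refl))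
    arrange 0F 2F _ = 1F , ↭-trans (↭-swap a b ↭-refl) (↭-trans (↭-prep b (↭-swap a c ↭-refl)) (↭-swap b c ↭-refl))
    arrange 1F 2F _ = 0F , ↭-trans (↭-prep a (↭-swap b c ↭-refl)) (↭-swap a c ↭-refl)
    arrange 0F 0F k≢l = contradiction refl k≢l
    arrange 1F 1F k≢l = contradiction refl k≢l
    arrange 2F 2F k≢l = contradiction refl k≢l

-- Inserting B ^ v ≤ c ^ u and cancelling c ^ u leaves at least one factor c on the left, as u < v;
-- hence c ≤ (2 R L) ^ v. The exponent is then multiplied by 4 so that c ^ 4 outweighs the c ^ 3
-- coming from `L`.
^-bound⇒≤ : ∀ c u v R L B .{{_ : NonZero c}} .{{_ : NonZero v}} → let E = 4 * v in
  u < v → c ≤ R * 2 * (L * B) → B ^ v ≤ c ^ u → L ^ E ≤ E ^ E * c ^ 3 → c ≤ (R * 2) ^ E * E ^ E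
^-bound⇒≤ c u v R L B u<v c≤ B^v≤ L^E≤ = ℕ.*-cancelʳ-≤ c _ (c ^ 3) {{ℕ.m^n≢0 c 3}} (begin
  c ^ 4                               ≤⟨ ℕ.^-monoˡ-≤ 4 c≤[R2L]^v ⟩
  ((R * 2 * L) ^ v) ^ 4               ≡⟨ ℕ.^-*-assoc (R * 2 * L) v 4 ⟩
  (R * 2 * L) ^ (v * 4)               ≡⟨ cong ((R * 2 * L) ^_) (ℕ.*-comm v 4) ⟩
  (R * 2 * L) ^ E                     ≡⟨ ^-distrib-* (R * 2) L E ⟩
  (R * 2) ^ E * L ^ E                 ≤⟨ ℕ.*-monoʳ-≤ ((R * 2) ^ E) L^E≤ ⟩
  (R * 2) ^ E * (E ^ E * c ^ 3)       ≡⟨ ℕ.*-assoc ((R * 2) ^ E) (E ^ E) (c ^ 3) ⟨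
  (R * 2) ^ E * E ^ E * c ^ 3         ∎)
  where
  open ℕ.≤-Reasoning
  E = 4 * v
  c≤[R2L]^v : c ≤ (R * 2 * L) ^ v
  c≤[R2L]^v = ℕ.*-cancelʳ-≤ c _ (c ^ u) {{ℕ.m^n≢0 c u}} (begin
    c ^ suc u                         ≤⟨ ℕ.^-monoʳ-≤ c u<v ⟩
    c ^ v                             ≤⟨ ℕ.^-monoˡ-≤ v c≤ ⟩
    (R * 2 * (L * B)) ^ v             ≡⟨ cong (_^ v) (ℕ.*-assoc (R * 2) L B) ⟨
    (R * 2 * L * B) ^ v               ≡⟨ ^-distrib-* (R * 2 * L) B v ⟩
    (R * 2 * L) ^ v * B ^ v           ≤⟨ ℕ.*-monoʳ-≤ ((R * 2 * L) ^ v) B^v≤ ⟩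
    (R * 2 * L) ^ v * c ^ u           ∎)

-- The target inequality admits no multiplicative constant. Since R ≥ 2, constants are absorbed into
-- the exponent: 2 ^ E ≤ R ^ E and E ^ E < 2 ^ (E ^ E) ≤ R ^ (E ^ E).
≤-^⇒<-^ : ∀ c R E → 2 ≤ R → c ≤ (R * 2) ^ E * E ^ E → c < R ^ (2 * E ℕ.+ E ^ E)
≤-^⇒<-^ c R@(suc _) E 2≤R c≤ = begin-strict
  c                             ≤⟨ c≤ ⟩
  (R * 2) ^ E * E ^ E           ≤⟨ ℕ.*-monoˡ-≤ (E ^ E) (ℕ.^-monoˡ-≤ E (ℕ.*-monoʳ-≤ R 2≤R)) ⟩
  (R * R) ^ E * E ^ E           ≡⟨ cong (λ x → (R * x) ^ E * E ^ E) (ℕ.*-identityʳ R) ⟨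
  (R ^ 2) ^ E * E ^ E           ≡⟨ cong (_* E ^ E) (ℕ.^-*-assoc R 2 E) ⟩
  R ^ (2 * E) * E ^ E
    <⟨ ℕ.*-monoʳ-< (R ^ (2 * E)) {{ℕ.m^n≢0 R (2 * E)}} (ℕ.<-≤-trans (n<2^n (E ^ E)) (ℕ.^-monoˡ-≤ (E ^ E) 2≤R)) ⟩
  R ^ (2 * E) * R ^ (E ^ E)     ≡⟨ ℕ.^-distribˡ-+-* R (2 * E) (E ^ E) ⟨
  R ^ (2 * E ℕ.+ E ^ E)         ∎
  where open ℕ.≤-Reasoning

sum-c : List (ℕ × ℕ × ℕ) → ℕ
sum-c []                 = 0
sum-c ((_ , _ , c) ∷ ts) = c ℕ.+ sum-c ts

∈⇒≤sum-c : ∀ {ts a b c} → (a , b , c) ∈ ts → c ≤ sum-c ts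
∈⇒≤sum-c (here refl) = ℕ.m≤m+n _ _
∈⇒≤sum-c (there t∈)  = ℕ.m≤n⇒m≤o+n _ (∈⇒≤sum-c t∈)

SDC⇒Oesterlé : SDC → OesterléABC
SDC⇒Oesterlé (η , 0<η , η<1 , exceptions , sdc) = from (<1⇒/-bound {η} 0<η η<1)
  where
  from : (∃₂ λ u v → u < suc v × (∀ {t} → lower η t → t ℚ.≤ + u / suc v)) → OesterléABC
  from (u , v , u<1+v , η≤) = fromℕ (suc Y) , λ { a b _ cop refl →
    <-^ᴿ (a ℕ.+ b) (rad (a * b * (a ℕ.+ b))) Y {{rad-nonZero (a * b * (a ℕ.+ b))}} (bound a b cop) }
    where
    E = 4 * suc v
    Y₀ = 2 * E ℕ.+ E ^ E
    -- The three terms serve the triples (1, N, q), the triples to which the hypothesis applies, and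
    -- the finitely many exceptions.
    Y = 2 ℕ.+ (Y₀ ℕ.+ sum-c exceptions)

    bound : ∀ a b .{{_ : NonZero a}} .{{_ : NonZero b}} .{{_ : NonZero (a ℕ.+ b)}} (cop : Coprime₃ a b (a ℕ.+ b)) →
            a ℕ.+ b < rad (a * b * (a ℕ.+ b)) ^ Y
    -- The goal is decidable, hence stable. Assuming its negation refutes both the special form and
    -- membership among the exceptions, so neither has to be decided.
    bound a b cop = subst (λ r → c < r ^ Y) R≡rad (decidable-stable (c ℕ.<? R ^ Y) λ c≮ →
      c≮ (small (sdc a b c cop refl (λ f → c≮ (form-case f)) (λ t∈ → c≮ (exceptional t∈)))))
      where
      open CoprimeTriple a b cop
      open Bounds a b cop
      open ℕ.≤-Reasoning
      instance
        R≢0 : NonZero R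
        R≢0 = ℕ.>-nonZero (ℕ.≤-trans (ℕ.s≤s ℕ.z≤n) 2≤R)

      form-case : OfForm1Nq a b c → c < R ^ Y
      form-case f = begin-strict
        c           ≤⟨ form⇒c≤1+R f ⟩
        1 ℕ.+ R     <⟨ ℕ.+-monoˡ-< R 2≤R ⟩
        R ℕ.+ R     ≡⟨ trans (cong (R ℕ.+_) (sym (ℕ.+-identityʳ R))) (ℕ.*-comm 2 R) ⟩
        R * 2       ≤⟨ ℕ.*-monoʳ-≤ R 2≤R ⟩
        R * R       ≡⟨ cong (R *_) (ℕ.*-identityʳ R) ⟨
        R ^ 2       ≤⟨ ℕ.^-monoʳ-≤ R (ℕ.m≤m+n 2 (Y₀ ℕ.+ sum-c exceptions)) ⟩
        R ^ Y       ∎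

      exceptional : (a , b , c) ∈ exceptions → c < R ^ Y
      exceptional t∈ = begin-strict
        c                     ≤⟨ ∈⇒≤sum-c t∈ ⟩
        sum-c exceptions      <⟨ n<2^n (sum-c exceptions) ⟩
        2 ^ sum-c exceptions  ≤⟨ ℕ.^-monoˡ-≤ (sum-c exceptions) 2≤R ⟩
        R ^ sum-c exceptions  ≤⟨ ℕ.^-monoʳ-≤ R (ℕ.m≤n⇒m≤o+n 2 (ℕ.m≤n+m (sum-c exceptions) Y₀)) ⟩
        R ^ Y                 ∎

      small : (∃[ ψ ] 𝒯[ a , b ] ψ × Independent ψ (+ a) (+ b) × ‖ ψ ‖ <ᴿ c ^ᴿ η) → c < R ^ Y
      small (ψ , (_ , additive) , indep , ψ<) =
        -- `B` is the integer part of c ^ (u / v), and the integers ∣ψ (ξ q)∣ do not exceed it.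
        let B , B^v≤ , <[1+B]^v = floor-root (suc v) (c ^ u)
            ψ≤B = λ q → ℕ.≤-pred (^-cancelˡ-< (suc v) (ℕ.≤-<-trans (‖‖-<-^ᴿ⇒ ψ η c u (suc v) η≤ ψ< q) <[1+B]^v))
        in ℕ.<-≤-trans
          (≤-^⇒<-^ c R E 2≤R (^-bound⇒≤ c u (suc v) R L B u<1+v (independent⇒c≤ ψ additive indep ψ≤B) B^v≤ (L-≤ E)))
          (ℕ.^-monoʳ-≤ R (ℕ.m≤n⇒m≤o+n 2 (ℕ.m≤m+n Y₀ (sum-c exceptions))))

-- For R ≤ c one has T R ≤ 2 c with T = 1 + c / R, so the hypothesis leaves the constant times one
-- extra factor R, which is at most c. For R > c the quotient is 0 and T = 1; there `suc K`, in
-- place of K, keeps the right-hand side positive.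
[1+c/R]^E-≤ : ∀ c R K E .{{_ : NonZero c}} .{{_ : NonZero R}} → c ^ E ≤ K ^ E * R ^ suc E →
              suc (c ℕ./ R) ^ E ≤ (2 * suc K) ^ E * c
[1+c/R]^E-≤ c R K E c^E≤ = by-cases (R ℕ.≤? c)
  where
  open ℕ.≤-Reasoning
  instance _ = ℕ.m^n≢0 R E
  by-cases : Dec (R ≤ c) → suc (c ℕ./ R) ^ E ≤ (2 * suc K) ^ E * c
  by-cases (no R≰c)  = begin
    suc (c ℕ./ R) ^ E       ≡⟨ cong (λ x → suc x ^ E) (ℕ.m<n⇒m/n≡0 (ℕ.≰⇒> R≰c)) ⟩
    1 ^ E                   ≡⟨ ℕ.^-zeroˡ E ⟩
    1                       ≤⟨ ℕ.>-nonZero⁻¹ _ {{ℕ.m*n≢0 ((2 * suc K) ^ E) c {{ℕ.m^n≢0 (2 * suc K) E}}}} ⟩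
    (2 * suc K) ^ E * c     ∎
  by-cases (yes R≤c) = ℕ.*-cancelʳ-≤ _ _ (R ^ E) (begin
    T ^ E * R ^ E                    ≡⟨ ^-distrib-* T R E ⟨
    (T * R) ^ E                      ≤⟨ ℕ.^-monoˡ-≤ E T*R≤2c ⟩
    (2 * c) ^ E                      ≡⟨ ^-distrib-* 2 c E ⟩
    2 ^ E * c ^ E                    ≤⟨ ℕ.*-monoʳ-≤ (2 ^ E) c^E≤ ⟩
    2 ^ E * (K ^ E * (R * R ^ E))
      ≤⟨ ℕ.*-monoʳ-≤ (2 ^ E) (ℕ.*-mono-≤ (ℕ.^-monoˡ-≤ E (ℕ.n≤1+n K)) (ℕ.*-monoˡ-≤ (R ^ E) R≤c)) ⟩
    2 ^ E * (suc K ^ E * (c * R ^ E)) ≡⟨ regroup (2 ^ E) (suc K ^ E) c (R ^ E) ⟩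
    2 ^ E * suc K ^ E * c * R ^ E    ≡⟨ cong (λ x → x * c * R ^ E) (^-distrib-* 2 (suc K) E) ⟨
    (2 * suc K) ^ E * c * R ^ E      ∎)
    where
    T = suc (c ℕ./ R)
    regroup : ∀ x y z t → x * (y * (z * t)) ≡ x * y * z * t
    regroup = ℕ-Ring.solve-∀
    T*R≤2c : T * R ≤ 2 * c
    T*R≤2c = ℕ.+-mono-≤ R≤c (ℕ.≤-trans (ℕ.m/n*n≤m c R) (ℕ.≤-reflexive (sym (ℕ.+-identityʳ c))))

c<[1+c/R]*R : ∀ c R .{{_ : NonZero R}} → c < suc (c ℕ./ R) * R
c<[1+c/R]*R c R = begin-strict
  c                               ≡⟨ ℕ.m≡m%n+[m/n]*n c R ⟩
  c ℕ.% R ℕ.+ c ℕ./ R * R         <⟨ ℕ.+-monoˡ-< (c ℕ./ R * R) (ℕ.m%n<n c R) ⟩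
  suc (c ℕ./ R) * R               ∎
  where open ℕ.≤-Reasoning

-- The factors contribute the exponents 3 (from V), 3 (from w), 3 F (from M) and 1 (from T) of c.

norm-bound : ∀ c F X₁ X₂ X₃ V w M T {{_ : NonZero V}} {{_ : NonZero w}} {{_ : NonZero M}} {{_ : NonZero T}} →
  let E = 4 * F in
  V ^ E ≤ X₁ * c ^ 3 → w ^ E ≤ X₂ * c ^ 3 → M ^ 4 ≤ c ^ 3 → T ^ E ≤ X₃ * c →
  suc (V * (2 * (w * (M * T)))) ^ E ≤ 2 ^ E * (X₁ * (2 ^ E * (X₂ * X₃))) * c ^ (7 ℕ.+ 3 * F)
norm-bound c F X₁ X₂ X₃ V w M T V≤ w≤ M≤ T≤ = begin
  suc B ^ E                                                   ≤⟨ ℕ.^-monoˡ-≤ E 1+B≤2B ⟩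
  (2 * B) ^ E                                                 ≡⟨ expand ⟩
  2 ^ E * (V ^ E * (2 ^ E * (w ^ E * (M ^ E * T ^ E))))
    ≤⟨ ℕ.*-monoʳ-≤ (2 ^ E) (ℕ.*-mono-≤ V≤ (ℕ.*-monoʳ-≤ (2 ^ E) (ℕ.*-mono-≤ w≤ (ℕ.*-mono-≤ M^E≤ T≤)))) ⟩
  2 ^ E * (X₁ * c ^ 3 * (2 ^ E * (X₂ * c ^ 3 * (c ^ (3 * F) * (X₃ * c)))))
                                                              ≡⟨ regroup (2 ^ E) X₁ X₂ X₃ c (c ^ (3 * F)) ⟩
  2 ^ E * (X₁ * (2 ^ E * (X₂ * X₃))) * (c ^ 7 * c ^ (3 * F))
    ≡⟨ cong (2 ^ E * (X₁ * (2 ^ E * (X₂ * X₃))) *_) (ℕ.^-distribˡ-+-* c 7 (3 * F)) ⟨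
  2 ^ E * (X₁ * (2 ^ E * (X₂ * X₃))) * c ^ (7 ℕ.+ 3 * F)      ∎
  where
  open ℕ.≤-Reasoning
  E = 4 * F
  B = V * (2 * (w * (M * T)))
  B≢0 : NonZero B
  B≢0 = ℕ.m*n≢0 V (2 * (w * (M * T))) {{it}}
    {{ℕ.m*n≢0 2 (w * (M * T)) {{_}} {{ℕ.m*n≢0 w (M * T) {{it}} {{ℕ.m*n≢0 M T}}}}}}
  1+B≤2B : suc B ≤ 2 * B
  1+B≤2B = ℕ.+-mono-≤ (ℕ.>-nonZero⁻¹ B {{B≢0}}) (ℕ.≤-reflexive (sym (ℕ.+-identityʳ B)))
  M^E≤ : M ^ E ≤ c ^ (3 * F)
  M^E≤ = subst₂ _≤_ (ℕ.^-*-assoc M 4 F) (ℕ.^-*-assoc c 3 F) (ℕ.^-monoˡ-≤ F M≤)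
  expand : (2 * B) ^ E ≡ 2 ^ E * (V ^ E * (2 ^ E * (w ^ E * (M ^ E * T ^ E))))
  expand = trans (^-distrib-* 2 B E) (cong (2 ^ E *_)
    (trans (^-distrib-* V _ E) (cong (V ^ E *_)
    (trans (^-distrib-* 2 _ E) (cong (2 ^ E *_)
    (trans (^-distrib-* w _ E) (cong (w ^ E *_) (^-distrib-* M T E))))))))
  regroup : ∀ t x₁ x₂ x₃ c d → t * (x₁ * (c * (c * (c * 1))) * (t * (x₂ * (c * (c * (c * 1))) * (d * (x₃ * c))))) ≡
            t * (x₁ * (t * (x₂ * x₃))) * ((c * (c * (c * (c * (c * (c * (c * 1))))))) * d)
  regroup = ℕ-Ring.solve-∀

module _ (F : ℕ) .{{_ : NonZero F}} (K : ℕ) where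

  private
    E = 4 * F
    instance
      E≢0 : NonZero E
      E≢0 = ℕ.m*n≢0 4 F

  -- The factors come, in order, from passing from B to B + 1, from `V`, from the factor 2 in the
  -- bound for z, from `w` and from T.
  norm-constant : ℕ
  norm-constant = 2 ^ E * ((E ^ E) ^ (2 ^ E) * (2 ^ E * (E ^ E * (2 * suc K) ^ E)))

  -- The norm estimate has exponent 7 + 3 F. One more factor c pays for `norm-constant`, and one
  -- more unit in the numerator makes the real inequality strict, which gives 9 + 3 F.
  small-ψ : ∀ a b .{{_ : NonZero a}} .{{_ : NonZero b}} .{{_ : NonZero (a ℕ.+ b)}} (cop : Coprime₃ a b (a ℕ.+ b)) →
    (a ℕ.+ b) ^ E ≤ K ^ E * rad (a * b * (a ℕ.+ b)) ^ suc E →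
    2 < a ℕ.+ b → norm-constant ≤ a ℕ.+ b → ¬ OfForm1Nq a b (a ℕ.+ b) →
    ∃[ ψ ] 𝒯[ a , b ] ψ × Independent ψ (+ a) (+ b) × ‖ ψ ‖ <ᴿ (a ℕ.+ b) ^ᴿ fromℚ (+ (9 ℕ.+ 3 * F) / E)
  small-ψ a b cop c^E≤ 2<c C≤c not-1Nq =
    let M , M^4≤c³ , c³<[1+M]^4 = floor-root 4 (c ^ 3)
        z , z≤ , rel , W≢0 = small-solution (λ k → summands≤c a b k cop) 2<c {M} c³<[1+M]^4 T (c<[1+c/R]*R c R) no-1Nq
        ψ , ψ∈𝒯 , indep , ψ≤B = solution⇒ψ z (2 * (w * (M * T))) z≤ rel W≢0
    in ψ , ψ∈𝒯 , indep , ‖‖-<-^ᴿ ψ (V * (2 * (w * (M * T)))) c (8 ℕ.+ 3 * F) E ψ≤B (B^E≤ M M^4≤c³ c³<[1+M]^4)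
    where
    open CoprimeTriple a b cop
    open Bounds a b cop
    open ℕ.≤-Reasoning
    instance
      R≢0 : NonZero R
      R≢0 = ℕ.>-nonZero (ℕ.≤-trans (ℕ.s≤s ℕ.z≤n) 2≤R)

    T : ℕ
    T = suc (c ℕ./ R)

    no-1Nq : ∀ i l → l ≢ owner i → m i ≡ 1 → summand l ≢ 1
    no-1Nq i l l≢o mᵢ≡1 nₗ≡1 = not-1Nq (form (l≢o ∘ sym)
      (subst Prime (sym (trans (n≡m*p i) (trans (cong (_* p i) mᵢ≡1) (ℕ.*-identityˡ (p i))))) (p-prime i)) nₗ≡1)

    w≢0 : NonZero w
    w≢0 = Fin.nonZeroIndex (proj₁
        (primeDivisor-complete N (proj₁ (proj₂ r)) (∣-trans (proj₂ (proj₂ r)) (summand∣N 2F))))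
      where r = prime-divisor (ℕ.≢-nonZero⁻¹ c) (ℕ.>⇒≢ (2≤a+b a b))

    B^E≤ : ∀ M → M ^ 4 ≤ c ^ 3 → c ^ 3 < suc M ^ 4 → suc (V * (2 * (w * (M * T)))) ^ E ≤ c ^ (8 ℕ.+ 3 * F)
    B^E≤ zero      _      c³<1      = contradiction (ℕ.n<1⇒n≡0 c³<1) (ℕ.≢-nonZero⁻¹ (c ^ 3) {{ℕ.m^n≢0 c 3}})
    B^E≤ M@(suc _) M^4≤c³ _ = begin
      suc (V * (2 * (w * (M * T)))) ^ E
        ≤⟨ norm-bound c F ((E ^ E) ^ (2 ^ E)) (E ^ E) ((2 * suc K) ^ E) V w M T {{V≢0}} {{w≢0}}
             (V-≤ E) (ℕ.≤-trans (ℕ.^-monoˡ-≤ E w≤L) (L-≤ E)) M^4≤c³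
             ([1+c/R]^E-≤ c R K E (subst (λ r → c ^ E ≤ K ^ E * r ^ suc E) (sym R≡rad) c^E≤)) ⟩
      norm-constant * c ^ (7 ℕ.+ 3 * F)
        ≤⟨ ℕ.*-monoˡ-≤ (c ^ (7 ℕ.+ 3 * F)) C≤c ⟩
      c ^ (8 ℕ.+ 3 * F) ∎

-- Here η = (9 + 3 F) / (4 F) = 3 / 4 + 9 / (4 F), which is below 1 exactly when F > 9, and (ABC) is
-- applied with ε = 1 / (4 F).
ABC⇒SDC-at : ABC → ∀ F → 9 < F → SDC
ABC⇒SDC-at abc F@(suc F-1) 9<F = from (ABC⇒^-bound abc (4 * F))
  where
  η<1 : 9 ℕ.+ 3 * F < 4 * F
  η<1 = ℕ.+-monoˡ-< (3 * F) 9<F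

  from : ∃[ K ] (∀ a b c .{{_ : NonZero a}} .{{_ : NonZero b}} .{{_ : NonZero c}} →
           Coprime₃ a b c → a ℕ.+ b ≡ c → c ^ (4 * F) ≤ K ^ (4 * F) * rad (a * b * c) ^ suc (4 * F)) → SDC
  from (K , c^E≤) = fromℚ η ,
    (0ℚ , (λ { (_ , refl , p<0) → ℚ.<⇒≤ p<0 }) , η , refl , 0<η) ,
    (η , (λ { (_ , refl , p<η) → ℚ.<⇒≤ p<η }) , ℕ→ℚ 1 , refl , η<1ℚ) ,
    exceptions ,
    λ { a b _ cop refl not-1Nq ∉exceptions →
      let X<c = large a b ∉exceptions in
      small-ψ F K a b cop (c^E≤ a b (a ℕ.+ b) cop refl)
        (ℕ.≤-<-trans (ℕ.m≤m+n 2 (norm-constant F K)) X<c)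
        (ℕ.≤-trans (ℕ.m≤n+m (norm-constant F K) 2) (ℕ.<⇒≤ X<c)) not-1Nq }
    where
    η = + (9 ℕ.+ 3 * F) / (4 * F)
    -- Chosen so that c > X gives both 2 < c and norm-constant ≤ c; all triples with entries up to X
    -- become exceptions.
    X = 2 ℕ.+ norm-constant F K

    0<η : 0ℚ ℚ.< η
    0<η = /-mono-< 0ℤ (+ (9 ℕ.+ 3 * F)) 0 (F-1 ℕ.+ 3 * F) (ℤ.+<+ (ℕ.s≤s ℕ.z≤n))

    η<1ℚ : η ℚ.< ℕ→ℚ 1
    η<1ℚ = /-mono-< (+ (9 ℕ.+ 3 * F)) (+ 1) (F-1 ℕ.+ 3 * F) 0
      (subst₂ ℤ._<_ (sym (ℤ.*-identityʳ (+ (9 ℕ.+ 3 * F)))) (sym (ℤ.*-identityˡ (+ (4 * F)))) (ℤ.+<+ η<1))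

    exceptions : List (ℕ × ℕ × ℕ)
    exceptions = cartesianProduct (upTo (suc X)) (cartesianProduct (upTo (suc X)) (upTo (suc X)))

    large : ∀ a b → (a , b , a ℕ.+ b) ∉ exceptions →
            X < a ℕ.+ b
    large a b t∉ = ℕ.≰⇒> λ c≤X → t∉ (∈-cartesianProduct⁺ (∈-upTo⁺ (ℕ.s≤s (ℕ.≤-trans (ℕ.m≤m+n a b) c≤X)))
      (∈-cartesianProduct⁺ (∈-upTo⁺ (ℕ.s≤s (ℕ.≤-trans (ℕ.m≤n+m b a) c≤X))) (∈-upTo⁺ (ℕ.s≤s c≤X))))

corollary4p6 : (ABC → SDC) × (SDC → OesterléABC)
corollary4p6 = (λ abc → ABC⇒SDC-at abc 10 ℕ.≤-refl) , SDC⇒Oesterlé
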